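{- Let $(T,s)$ be an instance of the firefighter problem on trees. Given a feasible solution $(x,y)$ of (LP') (the LP with Hartke's constraints) that is $1/2$-integral, there is a polynomial time algorithm that produces an integral solution (a strategy) saving at least $\frac56\sum_{v\in V(T)}y_v$ vertices.
   Context: $T=(V,E)$ is a finite tree rooted at the source $s$ where the fire starts. A strategy is a sequence $\{u_t\}_{t\ge1}$ of vertices, $u_t$ being picked at time $t$. A vertex $u$ is saved if on the path $(s=v_0,\dots,v_z=u)$ we have $v_i\in\{u_1,\dots,u_i\}$ for some $i\in\{1,\dots,z\}$. For $j\ge 1$ let $L_j$ be the set of vertices at distance exactly $j$ from $s$, let $P_v$ be the set of vertices on the path from $s$ to $v$, and let $T_v$ be the subtree rooted at $v$. (LP') is: maximize $\sum_{v\in V}y_v$ subject to $\sum_{u\in P_v\cup(T_v\cap L_j)}x_u\le1$ for every vertex $v$ and every layer $L_j$ below the layer of $v$; $y_v\le\sum_{u\in P_v}x_u$ for every $v\in V$; $x_v,y_v\in[0,1]$ for every $v$; and $x_s=0$ (the source cannot be picked). A solution $(x,y)$ is $1/2$-integral if $x_v\in\{0,\frac12,1\}$ for all $v$. -}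

module Defs where

open import Data.Bool.Base using (Bool; true; false; T)
open import Data.Fin.Base using (Fin; toℕ)
open import Data.Fin.Properties using (any?) renaming (_≟_ to _≟ᶠ_)
open import Data.Integer.Base as ℤ using (ℤ)
open import Data.List.Base using (List; []; _∷_; map; foldr; filter; length; lookup; take; allFin)
open import Data.List.Membership.Propositional using (_∈_)
import Data.List.Membership.DecPropositional as DecMembership
open import Data.List.Relation.Unary.Unique.Propositional using (Unique)
open import Data.Nat.Base as ℕ using (ℕ; zero; suc)
import Data.Nat.Properties as ℕₚ
open import Data.Nat.Binary.Base using (ℕᵇ; fromℕ) renaming (zero to 0ᵇ; 2[1+_] to 2[1+_]ᵇ; 1+[2_] to 1+[2_]ᵇ)
open import Data.Product.Base using (Σ-syntax; ∃-syntax; _×_; proj₁)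
open import Data.Rational.Base as ℚ using (ℚ; 0ℚ; 1ℚ; ½)
open import Data.Sum.Base using (_⊎_)
open import Relation.Binary.PropositionalEquality.Core using (_≡_; _≢_)
open import Relation.Nullary.Decidable using (_×-dec_; yes; no)
open import Relation.Unary using (Pred; Decidable; _∪_; _∩_)
open import Relation.Unary.Properties using (_∪?_; _∩?_)
open import Level using (0ℓ)

record Graph : Set where
  field
    order      : ℕ
    adj        : Fin order → Fin order → Bool
    adj-sym    : ∀ u v → adj u v ≡ adj v u
    adj-irrefl : ∀ v → adj v v ≡ false

  Vertex : Set
  Vertex = Fin order

  data Walk : Vertex → Vertex → Set where
    stop : ∀ {v} → Walk v v
    step : ∀ {u w v} → T (adj u w) → Walk w v → Walk u v

  vertices : ∀ {u v} → Walk u v → List Vertex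
  vertices {u} stop       = u ∷ []
  vertices {u} (step _ p) = u ∷ vertices p

  edgeCount : ∀ {u v} → Walk u v → ℕ
  edgeCount stop       = 0
  edgeCount (step _ p) = suc (edgeCount p)

  IsPath : ∀ {u v} → Walk u v → Set
  IsPath p = Unique (vertices p)

  -- Any two vertices are joined by exactly one path.
  IsTree : Set
  IsTree = ∀ u v → Σ[ p ∈ Walk u v ] IsPath p ×
                   (∀ (q : Walk u v) → IsPath q → vertices q ≡ vertices p)

record RootedTree : Set where
  field
    graph  : Graph
    isTree : Graph.IsTree graph
    source : Graph.Vertex graph

  open Graph graph public

  pathTo : ∀ v → Walk source v
  pathTo v = proj₁ (isTree source v)

  -- In a tree the distance from the source is the length of the unique path.
  dist : Vertex → ℕ
  dist v = edgeCount (pathTo v)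

  -- P v, Subtree v and Layer j are the sets P_v, T_v and L_j.
  P : Vertex → Pred Vertex 0ℓ
  P v u = u ∈ vertices (pathTo v)

  Subtree : Vertex → Pred Vertex 0ℓ
  Subtree v u = P u v

  Layer : ℕ → Pred Vertex 0ℓ
  Layer j u = dist u ≡ j

  open DecMembership (_≟ᶠ_ {order}) using (_∈?_)

  P? : ∀ v → Decidable (P v)
  P? v u = u ∈? vertices (pathTo v)

  Subtree? : ∀ v → Decidable (Subtree v)
  Subtree? v u = P? u v

  Layer? : ∀ j → Decidable (Layer j)
  Layer? j u = dist u ℕₚ.≟ j

  sumOver : {S : Pred Vertex 0ℓ} → Decidable S → (Vertex → ℚ) → ℚ
  sumOver S? f = foldr ℚ._+_ 0ℚ (map f (filter S? (allFin order)))

  sum : (Vertex → ℚ) → ℚ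
  sum f = foldr ℚ._+_ 0ℚ (map f (allFin order))

  -- The list u₁ ∷ u₂ ∷ … of picked vertices; nothing is picked after its end.
  -- This loses nothing: saving depends only on the picks up to the height of
  -- the tree, and any list may be padded with the source, which saves nothing.
  Strategy : Set
  Strategy = List Vertex

  -- With vertices (pathTo u) = v₀ ∷ … ∷ v_z and 1 ≤ i ≤ z, v_i ∈ {u₁, …, u_i}.
  Saved : Strategy → Pred Vertex 0ℓ
  Saved us u = Σ[ i ∈ Fin (length (vertices (pathTo u))) ]
    1 ℕ.≤ toℕ i × lookup (vertices (pathTo u)) i ∈ take (toℕ i) us

  Saved? : ∀ us → Decidable (Saved us)
  Saved? us u = any? λ i →
    (1 ℕₚ.≤? toℕ i) ×-dec (lookup (vertices (pathTo u)) i ∈? take (toℕ i) us)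

  savedCount : Strategy → ℕ
  savedCount us = length (filter (Saved? us) (allFin order))

  record Feasible (x y : Vertex → ℚ) : Set where
    field
      hartke   : ∀ v j → dist v ℕ.< j →
                 sumOver (P? v ∪? (Subtree? v ∩? Layer? j)) x ℚ.≤ 1ℚ
      coverage : ∀ v → y v ℚ.≤ sumOver (P? v) x
      x-lower  : ∀ v → 0ℚ ℚ.≤ x v
      x-upper  : ∀ v → x v ℚ.≤ 1ℚ
      y-lower  : ∀ v → 0ℚ ℚ.≤ y v
      y-upper  : ∀ v → y v ℚ.≤ 1ℚ
      x-source : x source ≡ 0ℚ

  HalfIntegral : (Vertex → ℚ) → Set
  HalfIntegral x = ∀ v → x v ≡ 0ℚ ⊎ x v ≡ ½ ⊎ x v ≡ 1ℚ

-- Model of computation: Jones's WHILE language (N. D. Jones, Computability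
-- and Complexity from a Programming Perspective, MIT Press 1997), whose
-- polynomial-time problems are exactly those of Turing machines.

data D : Set where
  nil  : D
  cons : D → D → D

size : D → ℕ
size nil        = 1
size (cons d e) = suc (size d ℕ.+ size e)

head tail : D → D
head nil        = nil
head (cons d _) = d
tail nil        = nil
tail (cons _ e) = e

data Expr : Set where
  var     : ℕ → Expr
  nilᵉ    : Expr
  consᵉ   : Expr → Expr → Expr
  hdᵉ tlᵉ : Expr → Expr

infix  6 _≔_
infixr 5 _⨾_

data Cmd : Set where
  _≔_           : ℕ → Expr → Cmd
  _⨾_           : Cmd → Cmd → Cmd
  if_then_else_ : Expr → Cmd → Cmd → Cmd
  while_loop_     : Expr → Cmd → Cmd

Store : Set
Store = ℕ → D

_[_↦_] : Store → ℕ → D → Store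
(σ [ X ↦ d ]) Y with Y ℕₚ.≟ X
... | yes _ = d
... | no  _ = σ Y

eval : Expr → Store → D
eval (var X)     σ = σ X
eval nilᵉ        σ = nil
eval (consᵉ e f) σ = cons (eval e σ) (eval f σ)
eval (hdᵉ e)     σ = head (eval e σ)
eval (tlᵉ e)     σ = tail (eval e σ)

cost : Expr → ℕ
cost (var X)     = 1
cost nilᵉ        = 1
cost (consᵉ e f) = suc (cost e ℕ.+ cost f)
cost (hdᵉ e)     = suc (cost e)
cost (tlᵉ e)     = suc (cost e)

-- ⟨ c , σ ⟩⇓ τ [ t ]: started in store σ, command c halts in store τ after
-- t time units.  As a condition, nil is false and every cons is true.
data ⟨_,_⟩⇓_[_] : Cmd → Store → Store → ℕ → Set where
  assign : ∀ {X e σ} →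
    ⟨ X ≔ e , σ ⟩⇓ (σ [ X ↦ eval e σ ]) [ suc (cost e) ]
  seq : ∀ {c₁ c₂ σ τ ρ t₁ t₂} →
    ⟨ c₁ , σ ⟩⇓ τ [ t₁ ] → ⟨ c₂ , τ ⟩⇓ ρ [ t₂ ] →
    ⟨ c₁ ⨾ c₂ , σ ⟩⇓ ρ [ suc (t₁ ℕ.+ t₂) ]
  if-true : ∀ {e c₁ c₂ σ τ t} → eval e σ ≢ nil →
    ⟨ c₁ , σ ⟩⇓ τ [ t ] →
    ⟨ if e then c₁ else c₂ , σ ⟩⇓ τ [ suc (cost e ℕ.+ t) ]
  if-false : ∀ {e c₁ c₂ σ τ t} → eval e σ ≡ nil →
    ⟨ c₂ , σ ⟩⇓ τ [ t ] →
    ⟨ if e then c₁ else c₂ , σ ⟩⇓ τ [ suc (cost e ℕ.+ t) ]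
  while-true : ∀ {e c σ τ ρ t₁ t₂} → eval e σ ≢ nil →
    ⟨ c , σ ⟩⇓ τ [ t₁ ] → ⟨ while e loop c , τ ⟩⇓ ρ [ t₂ ] →
    ⟨ while e loop c , σ ⟩⇓ ρ [ suc (cost e ℕ.+ (t₁ ℕ.+ t₂)) ]
  while-false : ∀ {e c σ} → eval e σ ≡ nil →
    ⟨ while e loop c , σ ⟩⇓ σ [ suc (cost e) ]

-- The input and the output are held by variable 0.
inputStore : D → Store
inputStore d zero    = d
inputStore d (suc _) = nil

_on_yields_within_ : Cmd → D → D → ℕ → Set
c on d yields d′ within b =
  ∃[ τ ] ∃[ t ] ⟨ c , inputStore d ⟩⇓ τ [ t ] × τ 0 ≡ d′ × t ℕ.≤ b

encodeBool : Bool → D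
encodeBool false = nil
encodeBool true  = cons nil nil

encodeList : {A : Set} → (A → D) → List A → D
encodeList f []       = nil
encodeList f (a ∷ as) = cons (f a) (encodeList f as)

-- Vertices are encoded in unary, which is harmless: the adjacency matrix is
-- part of every input.
encodeUnary : ℕ → D
encodeUnary zero    = nil
encodeUnary (suc k) = cons nil (encodeUnary k)

encodeFin : ∀ {n} → Fin n → D
encodeFin i = encodeUnary (toℕ i)

-- Binary, so that the size of an encoded number is logarithmic in its value.
encodeℕᵇ : ℕᵇ → D
encodeℕᵇ 0ᵇ        = nil
encodeℕᵇ 2[1+ b ]ᵇ = cons nil (encodeℕᵇ b)
encodeℕᵇ 1+[2 b ]ᵇ = cons (cons nil nil) (encodeℕᵇ b)

encodeℕ : ℕ → D
encodeℕ k = encodeℕᵇ (fromℕ k)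

encodeℤ : ℤ → D
encodeℤ (ℤ.+ k)    = cons nil (encodeℕ k)
encodeℤ ℤ.-[1+ k ] = cons (cons nil nil) (encodeℕ k)

encodeℚ : ℚ → D
encodeℚ q = cons (encodeℤ (ℚ.numerator q)) (encodeℕ (ℚ.denominatorℕ q))

module _ (𝒯 : RootedTree) where
  open RootedTree 𝒯

  encodeInstance : (x y : Vertex → ℚ) → D
  encodeInstance x y =
    cons (cons (encodeList (λ u → encodeList (λ v → encodeBool (adj u v)) (allFin order))
                           (allFin order))
               (encodeFin source))
         (cons (encodeList (λ v → encodeℚ (x v)) (allFin order))
               (encodeList (λ v → encodeℚ (y v)) (allFin order)))

  encodeStrategy : Strategy → D
  encodeStrategy = encodeList encodeFin

{-# OPTIONS --safe #-}

-- Let H₁, H₂, … be the sets of vertices with nonzero x in the layers.  By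
-- Hartke's constraints at the source |H_j| ≤ 2, and where |H_j| = 2 both
-- vertices have value ½; a root path meets at most two of these vertices, and
-- two vertices of one H_j never have a common ancestor of nonzero value.  In
-- layer j the algorithm picks the only vertex of H_j, or one of the two by a
-- rule.  Call a vertex top if no nonzero vertex lies strictly above it, and
-- covered if one that was picked does.
--   Two tops: use a random bit of the layer.
--   A top and a non-top: in tied mode pick the non-top unless it is covered;
--     in untied mode use the bit.
--   Two non-tops: pick the uncovered one; if both or neither are covered, use a
--     global tie-break bit.
-- In both modes a top is picked with probability at least ½.  If two nonzero
-- vertices lie on the path to v, then v is saved with probability 1 (tied) or
-- ≥ ¾ (untied) when the lower one shares its layer with a top, and ≥ ¾ (tied) or
-- ≥ ⅞ (untied) when it shares it with a non-top, since then v is lost only if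
-- neither of two tops was picked and the tie-break is unfavourable.  Hence tied
-- mode with weight ⅓ and untied mode with weight ⅔ save v with probability ≥ ⅚
-- in either case.  Untied mode only needs pairwise independent bits, tied mode
-- only a distribution invariant under complement, so the rows of a Hadamard
-- matrix and their complements suffice, and the best of these polynomially many
-- candidate strategies is found by enumeration.
module Submission where

open import Defs
import Data.Bool.Properties as Boolₚ
import Data.Fin.Properties as Finₚ
import Data.Integer.Base as ℤ
import Data.Integer.Properties as ℤₚ
import Data.List.Properties as Listₚ
import Data.List.Relation.Unary.All.Properties as Allₚ
import Data.List.Relation.Unary.AllPairs.Properties as AllPairsₚ
import Data.List.Relation.Unary.Any.Properties as Anyₚ
import Data.List.Relation.Unary.Unique.Propositional.Properties as Uniqueₚ
import Data.Nat.Properties as ℕₚ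
import Data.Rational.Properties as ℚₚ
import Data.Rational.Unnormalised.Properties as ℚᵘₚ
open import Data.Bool.Base using (Bool; true; false; not; _∧_; _∨_; _xor_; T)
  renaming (if_then_else_ to ifᵇ_then_else_)
open import Data.Bool.ListAction using (any)
open import Data.Empty using (⊥; ⊥-elim)
open import Data.Fin.Base using (Fin; toℕ; zero; suc)
open import Data.List.Base as List
  using (List; []; _∷_; _∷ʳ_; _++_; length; map; filter; filterᵇ; concat; reverse; foldl; foldr;
         drop; take; replicate; tabulate; allFin; downFrom; applyUpTo; applyDownFrom; lookup)
open import Data.List.Membership.Propositional using (_∈_; _∉_)
open import Data.List.Membership.Propositional.Properties
  using (∈-∃++; ∈-++⁻; ∈-++⁺ˡ; ∈-++⁺ʳ; ∈-map⁺; ∈-map⁻; ∈-filter⁺; ∈-filter⁻; ∈-allFin;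
         ∈-applyUpTo⁺; ∈-applyDownFrom⁻; ∈-concat⁺′; ∈-concat⁻′)
open import Data.List.Relation.Unary.All as All using (All; []; _∷_)
open import Data.List.Relation.Unary.AllPairs using ([]; _∷_)
open import Data.List.Relation.Unary.Any as Any using (here; there)
open import Data.List.Relation.Unary.Unique.Propositional using (Unique)
open import Data.Nat.Base as ℕ
  using (ℕ; zero; suc; pred; _+_; _*_; _^_; _∸_; _≤_; _<_; _≡ᵇ_; _≤ᵇ_; _<ᵇ_; z≤n; s≤s)
open import Data.Nat.Tactic.RingSolver using (solve-∀)
open import Data.Product.Base using (Σ-syntax; ∃-syntax; _×_; _,_; proj₁; proj₂)
open import Data.Rational.Base as ℚ using (ℚ; 0ℚ; 1ℚ; ½; _/_; toℚᵘ)
open import Data.Rational.Unnormalised.Base using (mkℚᵘ; _≃_; *≡*; *≤*)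
open import Data.Sum.Base using (_⊎_; inj₁; inj₂; [_,_]′)
open import Data.Unit.Base using (⊤; tt)
open import Function.Base using (_∘_; id)
open import Relation.Binary.PropositionalEquality
  using (_≡_; _≢_; _≗_; refl; sym; trans; cong; cong₂; subst; subst₂; module ≡-Reasoning)
open import Relation.Nullary.Decidable using (dec-true)
open import Relation.Nullary.Decidable.Core using (yes; no; does; T?)
open import Relation.Unary using (Decidable; _∪_; _∩_)
open import Relation.Unary.Properties using (_∪?_; _∩?_)

-- Polynomial-time programs

-- The weights are forced by the two kinds of pairs. The guaranteed success probabilities of tied
-- and untied mode are 1 and ¾ for one kind, ¾ and ⅞ for the other. With weight w on tied mode, the
-- first kind reaches ⅚ only if w ≥ ⅓, the second only if w ≤ ⅓. In integers, a row `h` stands for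
-- 12 candidates: two tie-breaks, `h` and its complement, untied mode counted twice; the goal is 10
-- of 12. In tied mode the fate of a top can be copied from a top of an earlier layer, so different
-- tops may always share their fate. Only the effect of complementing all bits can be controlled,
-- which yields ½ for one top and nothing about two. In untied mode a top that is not alone in its
-- layer depends on one bit, so two layers can be played against each other. The time bound must
-- hold for every input of the right type, trees or not. Each program therefore also carries a bound
-- on the size of its output, and each loop an invariant that keeps its accumulator small, since
-- repeated polynomial growth may be exponential.

infixl 6 _⊕_
infixl 7 _⊛_
infixr 8 _⊚_

-- Composition is a constructor, so the bounds of composed programs are just nested. The form c n^k
-- is extracted only once, at the very end. All coefficients are natural numbers, which makes every
-- bound monotone.
data Pol : Set where
  𝑛           : Pol
  K           : ℕ → Pol
  _⊕_ _⊛_ _⊚_ : Pol → Pol → Pol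

⟪_⟫ : Pol → ℕ → ℕ
⟪ 𝑛 ⟫     n = n
⟪ K c ⟫   n = c
⟪ p ⊕ q ⟫ n = ⟪ p ⟫ n + ⟪ q ⟫ n
⟪ p ⊛ q ⟫ n = ⟪ p ⟫ n * ⟪ q ⟫ n
⟪ p ⊚ q ⟫ n = ⟪ p ⟫ (⟪ q ⟫ n)

⟪⟫-mono : ∀ p {m n} → m ≤ n → ⟪ p ⟫ m ≤ ⟪ p ⟫ n
⟪⟫-mono 𝑛       m≤n = m≤n
⟪⟫-mono (K c)   m≤n = ℕₚ.≤-refl
⟪⟫-mono (p ⊕ q) m≤n = ℕₚ.+-mono-≤ (⟪⟫-mono p m≤n) (⟪⟫-mono q m≤n)
⟪⟫-mono (p ⊛ q) m≤n = ℕₚ.*-mono-≤ (⟪⟫-mono p m≤n) (⟪⟫-mono q m≤n)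
⟪⟫-mono (p ⊚ q) m≤n = ⟪⟫-mono p (⟪⟫-mono q m≤n)

^-distribʳ-* : ∀ k a b → (a * b) ^ k ≡ a ^ k * b ^ k
^-distribʳ-* zero    a b = refl
^-distribʳ-* (suc k) a b = trans (cong (a * b *_) (^-distribʳ-* k a b))
  (ℕₚ.[m*n]*[o*p]≡[m*o]*[n*p] a b (a ^ k) (b ^ k))

-- The condition `1 ≤ n`, true of every size, allows exponents to be raised when two monomials are
-- added.
monomial-bound : ∀ p → ∃[ c ] ∃[ k ] (∀ n → 1 ≤ n → ⟪ p ⟫ n ≤ c * n ^ k)
monomial-bound 𝑛 = 1 , 1 , λ n _ → ℕₚ.≤-reflexive (n≡1*n^1 n)
  where
  n≡1*n^1 : ∀ n → n ≡ 1 * n ^ 1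
  n≡1*n^1 n = sym (trans (ℕₚ.*-identityˡ (n ^ 1)) (ℕₚ.^-identityʳ n))
monomial-bound (K c) = c , 0 , λ n _ → ℕₚ.≤-reflexive (sym (ℕₚ.*-identityʳ c))
monomial-bound (p ⊕ q) with monomial-bound p | monomial-bound q
... | c₁ , k₁ , h₁ | c₂ , k₂ , h₂ = c₁ + c₂ , k₁ + k₂ , λ where
  n@(suc _) 1≤n → ℕₚ.≤-trans
    (ℕₚ.+-mono-≤
      (ℕₚ.≤-trans (h₁ n 1≤n) (ℕₚ.*-monoʳ-≤ c₁ (ℕₚ.^-monoʳ-≤ n (ℕₚ.m≤m+n k₁ k₂))))
      (ℕₚ.≤-trans (h₂ n 1≤n) (ℕₚ.*-monoʳ-≤ c₂ (ℕₚ.^-monoʳ-≤ n (ℕₚ.m≤n+m k₂ k₁)))))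
    (ℕₚ.≤-reflexive (sym (ℕₚ.*-distribʳ-+ (n ^ (k₁ + k₂)) c₁ c₂)))
monomial-bound (p ⊛ q) with monomial-bound p | monomial-bound q
... | c₁ , k₁ , h₁ | c₂ , k₂ , h₂ = c₁ * c₂ , k₁ + k₂ , λ n 1≤n →
  ℕₚ.≤-trans (ℕₚ.*-mono-≤ (h₁ n 1≤n) (h₂ n 1≤n))
    (ℕₚ.≤-reflexive (trans (ℕₚ.[m*n]*[o*p]≡[m*o]*[n*p] c₁ (n ^ k₁) c₂ (n ^ k₂))
                           (cong (c₁ * c₂ *_) (sym (ℕₚ.^-distribˡ-+-* n k₁ k₂)))))
monomial-bound (p ⊚ q) with monomial-bound p | monomial-bound q
-- `suc c₂` instead of `c₂` keeps the argument of the outer bound at least 1.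
... | c₁ , k₁ , h₁ | c₂ , k₂ , h₂ = c₁ * suc c₂ ^ k₁ , k₂ * k₁ , λ where
  n@(suc _) 1≤n → let
      q≤ : ⟪ q ⟫ n ≤ suc c₂ * n ^ k₂
      q≤ = ℕₚ.≤-trans (h₂ n 1≤n) (ℕₚ.*-monoˡ-≤ (n ^ k₂) (ℕₚ.n≤1+n c₂))
      1≤ : 1 ≤ suc c₂ * n ^ k₂
      1≤ = ℕₚ.*-mono-≤ {1} {suc c₂} {1} (s≤s z≤n) (ℕₚ.m^n>0 n k₂)
    in ℕₚ.≤-trans (⟪⟫-mono p q≤) (ℕₚ.≤-trans (h₁ _ 1≤)
         (ℕₚ.≤-reflexive (trans (cong (c₁ *_) (trans (^-distribʳ-* k₁ (suc c₂) (n ^ k₂))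
              (cong (suc c₂ ^ k₁ *_) (ℕₚ.^-*-assoc n k₂ k₁))))
           (sym (ℕₚ.*-assoc c₁ _ _)))))
cons≢nil : ∀ {d e} → cons d e ≢ nil
cons≢nil ()

update-≡ : ∀ (σ : Store) X d → (σ [ X ↦ d ]) X ≡ d
update-≡ σ X d with X ℕₚ.≟ X
... | yes _ = refl
... | no ¬p = ⊥-elim (¬p refl)

update-≢ : ∀ (σ : Store) X d {Y} → Y ≢ X → (σ [ X ↦ d ]) Y ≡ σ Y
update-≢ σ X d {Y} Y≢X with Y ℕₚ.≟ X
... | yes p = ⊥-elim (Y≢X p)
... | no  _ = refl

update-< : ∀ (σ : Store) X d Y → Y < X → (σ [ X ↦ d ]) Y ≡ σ Y
update-< σ X d Y Y<X = update-≢ σ X d (ℕₚ.<⇒≢ Y<X)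

-- A Hoare triple for total correctness with a time bound; later commands know the final store only
-- through `Q`.
Runs : Cmd → Store → ℕ → (Store → Set) → Set
Runs c σ b Q = ∃[ τ ] ∃[ t ] ⟨ c , σ ⟩⇓ τ [ t ] × Q τ × t ≤ b

assign-runs : ∀ {X e σ Q} → Q (σ [ X ↦ eval e σ ]) → Runs (X ≔ e) σ (suc (cost e)) Q
assign-runs q = _ , _ , assign , q , ℕₚ.≤-refl

seq-runs : ∀ {c₁ c₂ σ b₁ b₂ Q R} → Runs c₁ σ b₁ Q → (∀ τ → Q τ → Runs c₂ τ b₂ R) →
  Runs (c₁ ⨾ c₂) σ (suc (b₁ + b₂)) R
seq-runs (τ , t₁ , r₁ , q , le₁) f with f τ q
... | ρ , t₂ , r₂ , q′ , le₂ = ρ , _ , seq r₁ r₂ , q′ , s≤s (ℕₚ.+-mono-≤ le₁ le₂)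

-- Either branch is charged `b + b′`, since the bound must not depend on the outcome of the test.
if-true-runs : ∀ {e c₁ c₂ σ b b′ Q} → eval e σ ≢ nil → Runs c₁ σ b Q →
  Runs (if e then c₁ else c₂) σ (suc (cost e + (b + b′))) Q
if-true-runs {e} {b = b} {b′} ne (τ , t , r , q , le) = τ , _ , if-true ne r , q ,
  s≤s (ℕₚ.+-monoʳ-≤ (cost e) (ℕₚ.≤-trans le (ℕₚ.m≤m+n b b′)))

if-false-runs : ∀ {e c₁ c₂ σ b b′ Q} → eval e σ ≡ nil → Runs c₂ σ b′ Q →
  Runs (if e then c₁ else c₂) σ (suc (cost e + (b + b′))) Q
if-false-runs {e} {b = b} {b′} ne (τ , t , r , q , le) = τ , _ , if-false ne r , q ,
  s≤s (ℕₚ.+-monoʳ-≤ (cost e) (ℕₚ.≤-trans le (ℕₚ.m≤n+m b′ b)))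

weaken-runs : ∀ {c σ b b′ Q} → b ≤ b′ → Runs c σ b Q → Runs c σ b′ Q
weaken-runs b≤b′ (τ , t , r , q , le) = τ , t , r , q , ℕₚ.≤-trans le b≤b′

-- Typed functions and their programs

infixr 5 _⊗_

-- `raw` is for the encoded rationals, which are inspected as trees and never decoded.
data Ty : Set where
  unit bool nat raw : Ty
  list              : Ty → Ty
  _⊗_               : Ty → Ty → Ty

⟦_⟧ : Ty → Set
⟦ unit ⟧   = ⊤
⟦ bool ⟧   = Bool
⟦ nat ⟧    = ℕ
⟦ raw ⟧    = D
⟦ list A ⟧ = List ⟦ A ⟧
⟦ A ⊗ B ⟧  = ⟦ A ⟧ × ⟦ B ⟧

enc : ∀ A → ⟦ A ⟧ → D
enc unit     _       = nil
enc bool     b       = encodeBool b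
enc nat      k       = encodeUnary k
enc raw      d       = d
enc (list A) l       = encodeList (enc A) l
enc (A ⊗ B)  (a , b) = cons (enc A a) (enc B b)

-- The program reads its argument from variable X, leaves the result there and
-- may overwrite any variable above X.
record PolyTime (A B : Ty) (f : ⟦ A ⟧ → ⟦ B ⟧) : Set where
  field
    prog      : ℕ → Cmd
    time grow : Pol
    runs      : ∀ X σ a → σ X ≡ enc A a →
      Runs (prog X) σ (⟪ time ⟫ (size (enc A a)))
        (λ τ → τ X ≡ enc B (f a) × (∀ Y → Y < X → τ Y ≡ σ Y))
    bounded   : ∀ a → size (enc B (f a)) ≤ ⟪ grow ⟫ (size (enc A a))

open PolyTime

private variable
  A B C Γ : Ty

-- Separates the form in which a function is programmed from the form in which it is reasoned about.
≗-poly : ∀ {f g : ⟦ A ⟧ → ⟦ B ⟧} → f ≗ g → PolyTime A B f → PolyTime A B g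
≗-poly {B = B} f≗g F .prog = F .prog
≗-poly {B = B} f≗g F .time = F .time
≗-poly {B = B} f≗g F .grow = F .grow
≗-poly {A} {B} {f} {g} f≗g F .runs X σ a eq with F .runs X σ a eq
... | τ , t , r , (v , fr) , le = τ , t , r , (trans v (cong (enc B) (f≗g a)) , fr) , le
≗-poly {B = B} f≗g F .bounded a = subst (λ b → size (enc B b) ≤ _) (f≗g a) (F .bounded a)

expr-poly : ∀ {f : ⟦ A ⟧ → ⟦ B ⟧} (e : ℕ → Expr) (k : ℕ) (p : Pol) →
  (∀ X → cost (e X) ≤ k) →
  (∀ X σ a → σ X ≡ enc A a → eval (e X) σ ≡ enc B (f a)) →
  (∀ a → size (enc B (f a)) ≤ ⟪ p ⟫ (size (enc A a))) →
  PolyTime A B f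
expr-poly e k p cost≤ ok size≤ .prog X = X ≔ e X
expr-poly e k p cost≤ ok size≤ .time = K (suc k)
expr-poly e k p cost≤ ok size≤ .grow = p
expr-poly e k p cost≤ ok size≤ .runs X σ a eq = weaken-runs (s≤s (cost≤ X))
  (assign-runs (trans (update-≡ σ X _) (ok X σ a eq) , update-< σ X _))
expr-poly e k p cost≤ ok size≤ .bounded = size≤

infixr 9 _∙_

-- The reason for `grow`: the time of the second program is a polynomial in the size of the
-- intermediate value.
_∙_ : ∀ {g : ⟦ B ⟧ → ⟦ C ⟧} {f : ⟦ A ⟧ → ⟦ B ⟧} →
  PolyTime B C g → PolyTime A B f → PolyTime A C (λ a → g (f a))
(G ∙ F) .prog X = F .prog X ⨾ G .prog X
(G ∙ F) .time = K 1 ⊕ (F .time ⊕ G .time ⊚ F .grow)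
(G ∙ F) .grow = G .grow ⊚ F .grow
(_∙_ {f = f} G F) .runs X σ a eq = seq-runs (F .runs X σ a eq) λ τ (v , fr) →
  let ρ , t , r , (v′ , fr′) , le = G .runs X τ (f a) v
  in ρ , t , r , (v′ , λ Y Y<X → trans (fr′ Y Y<X) (fr Y Y<X)) ,
     ℕₚ.≤-trans le (⟪⟫-mono (G .time) (F .bounded a))
(_∙_ {f = f} G F) .bounded a = ℕₚ.≤-trans (G .bounded (f a)) (⟪⟫-mono (G .grow) (F .bounded a))

fst-poly : PolyTime (A ⊗ B) A proj₁
fst-poly {A} {B} = expr-poly (λ X → hdᵉ (var X)) 2 𝑛 (λ _ → ℕₚ.≤-refl)
  (λ { _ _ (a , b) eq → cong head eq })
  (λ { (a , b) → ℕₚ.m≤n⇒m≤1+n (ℕₚ.m≤m+n (size (enc A a)) (size (enc B b))) })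

snd-poly : PolyTime (A ⊗ B) B proj₂
snd-poly {A} {B} = expr-poly (λ X → tlᵉ (var X)) 2 𝑛 (λ _ → ℕₚ.≤-refl)
  (λ { _ _ (a , b) eq → cong tail eq })
  (λ { (a , b) → ℕₚ.m≤n⇒m≤1+n (ℕₚ.m≤n+m (size (enc B b)) (size (enc A a))) })

unit-poly : PolyTime Γ unit (λ _ → tt)
unit-poly = expr-poly (λ _ → nilᵉ) 1 (K 1) (λ _ → ℕₚ.≤-refl) (λ _ _ _ _ → refl) (λ _ → ℕₚ.≤-refl)

zero-poly : PolyTime Γ nat (λ _ → 0)
zero-poly = expr-poly (λ _ → nilᵉ) 1 (K 1) (λ _ → ℕₚ.≤-refl) (λ _ _ _ _ → refl) (λ _ → ℕₚ.≤-refl)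

nil-poly : PolyTime Γ (list A) (λ _ → [])
nil-poly = expr-poly (λ _ → nilᵉ) 1 (K 1) (λ _ → ℕₚ.≤-refl) (λ _ _ _ _ → refl) (λ _ → ℕₚ.≤-refl)

false-poly : PolyTime Γ bool (λ _ → false)
false-poly = expr-poly (λ _ → nilᵉ) 1 (K 1) (λ _ → ℕₚ.≤-refl) (λ _ _ _ _ → refl) (λ _ → ℕₚ.≤-refl)

true-poly : PolyTime Γ bool (λ _ → true)
true-poly = expr-poly (λ _ → consᵉ nilᵉ nilᵉ) 3 (K 3) (λ _ → ℕₚ.≤-refl) (λ _ _ _ _ → refl) (λ _ → ℕₚ.≤-refl)

-- A unary number and a list of that many units have the same encoding, so a number can drive a loop
-- over a list without any conversion.
units-poly : PolyTime nat (list unit) (λ k → List.replicate k tt)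
units-poly = expr-poly var 1 𝑛 (λ _ → ℕₚ.≤-refl)
  (λ X σ k eq → trans eq (unary k)) (λ k → ℕₚ.≤-reflexive (cong size (sym (unary k))))
  where
  unary : ∀ k → encodeUnary k ≡ encodeList (enc unit) (List.replicate k tt)
  unary zero    = refl
  unary (suc k) = cong (cons nil) (unary k)

-- Pairing, list extension and the unary successor are all encoded by a single `cons`.
cons-like : ∀ {f : ⟦ Γ ⟧ → ⟦ A ⟧} {g : ⟦ Γ ⟧ → ⟦ B ⟧} (h : ⟦ A ⟧ → ⟦ B ⟧ → ⟦ C ⟧) →
  (∀ a b → enc C (h a b) ≡ cons (enc A a) (enc B b)) →
  PolyTime Γ A f → PolyTime Γ B g → PolyTime Γ C (λ γ → h (f γ) (g γ))
-- A program destroys its argument, so each one works on a copy in a fresh variable while `X` keeps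
-- the original.
cons-like h ok F G .prog X =
  suc X ≔ var X ⨾ F .prog (suc X) ⨾
  suc (suc X) ≔ var X ⨾ G .prog (suc (suc X)) ⨾
  X ≔ consᵉ (var (suc X)) (var (suc (suc X)))
cons-like h ok F G .time =
  K 1 ⊕ (K 2 ⊕ (K 1 ⊕ (F .time ⊕ (K 1 ⊕ (K 2 ⊕ (K 1 ⊕ (G .time ⊕ K 4)))))))
cons-like h ok F G .grow = K 1 ⊕ (F .grow ⊕ G .grow)
cons-like {Γ = Γ} {A = A} {B = B} {f = f} {g = g} h ok F G .runs X σ a eq =
  seq-runs {Q = λ τ → τ (suc X) ≡ enc Γ a × (∀ Y → Y < suc X → τ Y ≡ σ Y)}
    (assign-runs (trans (update-≡ σ (suc X) _) eq , update-< σ (suc X) _)) λ σ₁ (v₁ , fr₁) →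
  seq-runs (F .runs (suc X) σ₁ a v₁) λ σ₂ (v₂ , fr₂) →
  seq-runs {Q = λ τ → τ (suc (suc X)) ≡ enc Γ a × (∀ Y → Y < suc (suc X) → τ Y ≡ σ₂ Y)}
    (assign-runs (trans (update-≡ σ₂ (suc (suc X)) _)
                        (trans (fr₂ _ ℕₚ.≤-refl) (trans (fr₁ _ ℕₚ.≤-refl) eq)) ,
                  update-< σ₂ (suc (suc X)) _)) λ σ₃ (v₃ , fr₃) →
  seq-runs (G .runs (suc (suc X)) σ₃ a v₃) λ σ₄ (v₄ , fr₄) →
  assign-runs
    ( trans (update-≡ σ₄ X _) (trans (cong₂ cons
        (trans (fr₄ _ ℕₚ.≤-refl) (trans (fr₃ _ ℕₚ.≤-refl) v₂)) v₄) (sym (ok (f a) (g a))))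
    , λ Y Y<X → trans (update-< σ₄ X _ Y Y<X)
        (let Y<1+X = ℕₚ.m<n⇒m<1+n Y<X ; Y<2+X = ℕₚ.m<n⇒m<1+n Y<1+X in
         trans (fr₄ Y Y<2+X) (trans (fr₃ Y Y<2+X) (trans (fr₂ Y Y<1+X) (fr₁ Y Y<1+X)))))
cons-like {f = f} {g = g} h ok F G .bounded a rewrite ok (f a) (g a) =
  s≤s (ℕₚ.+-mono-≤ (F .bounded a) (G .bounded a))

pair-poly : ∀ {f : ⟦ Γ ⟧ → ⟦ A ⟧} {g : ⟦ Γ ⟧ → ⟦ B ⟧} →
  PolyTime Γ A f → PolyTime Γ B g → PolyTime Γ (A ⊗ B) (λ γ → f γ , g γ)
pair-poly = cons-like _,_ (λ _ _ → refl)

cons-poly : ∀ {f : ⟦ Γ ⟧ → ⟦ A ⟧} {g : ⟦ Γ ⟧ → List ⟦ A ⟧} →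
  PolyTime Γ A f → PolyTime Γ (list A) g → PolyTime Γ (list A) (λ γ → f γ ∷ g γ)
cons-poly = cons-like _∷_ (λ _ _ → refl)

suc-poly : ∀ {g : ⟦ Γ ⟧ → ℕ} → PolyTime Γ nat g → PolyTime Γ nat (λ γ → suc (g γ))
suc-poly = cons-like {A = unit} (λ _ k → suc k) (λ _ _ → refl) unit-poly

if-poly : ∀ {b : ⟦ Γ ⟧ → Bool} {f g : ⟦ Γ ⟧ → ⟦ A ⟧} →
  PolyTime Γ bool b → PolyTime Γ A f → PolyTime Γ A g →
  PolyTime Γ A (λ γ → ifᵇ b γ then f γ else g γ)
if-poly P F G .prog X = suc X ≔ var X ⨾ P .prog (suc X) ⨾
  (if var (suc X) then F .prog X else G .prog X)
if-poly P F G .time =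
  K 1 ⊕ (K 2 ⊕ (K 1 ⊕ (P .time ⊕ (K 2 ⊕ (F .time ⊕ G .time)))))
if-poly P F G .grow = F .grow ⊕ G .grow
if-poly {Γ = Γ} {A = A} {b = b} {f} {g} P F G .runs X σ a eq =
  seq-runs {Q = λ τ → τ (suc X) ≡ enc Γ a × (∀ Y → Y < suc X → τ Y ≡ σ Y)}
    (assign-runs (trans (update-≡ σ (suc X) _) eq , update-< σ (suc X) _)) λ σ₁ (v₁ , fr₁) →
  seq-runs (P .runs (suc X) σ₁ a v₁) λ σ₂ (v₂ , fr₂) →
  branch σ₂ (b a) v₂ (trans (fr₂ _ ℕₚ.≤-refl) (trans (fr₁ _ ℕₚ.≤-refl) eq))
    (λ Y Y<X → trans (fr₂ Y (ℕₚ.m<n⇒m<1+n Y<X)) (fr₁ Y (ℕₚ.m<n⇒m<1+n Y<X)))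
  where
  branch : ∀ σ₂ c → σ₂ (suc X) ≡ encodeBool c → σ₂ X ≡ enc Γ a →
    (∀ Y → Y < X → σ₂ Y ≡ σ Y) →
    Runs (if var (suc X) then F .prog X else G .prog X) σ₂
      (2 + (⟪ F .time ⟫ (size (enc Γ a)) + ⟪ G .time ⟫ (size (enc Γ a))))
      (λ τ → τ X ≡ enc A (ifᵇ c then f a else g a) × (∀ Y → Y < X → τ Y ≡ σ Y))
  branch σ₂ true  v u fr with F .runs X σ₂ a u
  ... | τ , t , r , (w , fr′) , le = if-true-runs (λ n → cons≢nil (trans (sym v) n))
          (τ , t , r , (w , λ Y Y<X → trans (fr′ Y Y<X) (fr Y Y<X)) , le)
  branch σ₂ false v u fr with G .runs X σ₂ a u
  ... | τ , t , r , (w , fr′) , le = if-false-runs v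
          (τ , t , r , (w , λ Y Y<X → trans (fr′ Y Y<X) (fr Y Y<X)) , le)
if-poly {Γ = Γ} {b = b} {f} {g} P F G .bounded a with b a
... | true  = ℕₚ.≤-trans (F .bounded a) (ℕₚ.m≤m+n _ (⟪ G .grow ⟫ (size (enc Γ a))))
... | false = ℕₚ.≤-trans (G .bounded a) (ℕₚ.m≤n+m _ (⟪ F .grow ⟫ (size (enc Γ a))))

-- Case analysis and loops over lists

elimList : {A B : Set} → B → (A → List A → B) → List A → B
elimList z s []       = z
elimList z s (a ∷ as) = s a as

branch-size : ∀ γ {a} {as : List ⟦ A ⟧} {p} → size (enc (list A) (a ∷ as)) ≤ p →
  size (enc ((Γ ⊗ A) ⊗ list A) ((γ , a) , as)) ≤ 1 + (size (enc Γ γ) + p)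
branch-size {A = A} {Γ = Γ} γ {a} {as} le = s≤s (ℕₚ.≤-trans
  (ℕₚ.≤-reflexive (regroup (size (enc Γ γ)) (size (enc A a)) (size (enc (list A) as))))
  (ℕₚ.+-monoʳ-≤ (size (enc Γ γ)) le))
  where
  regroup : ∀ n a b → suc (n + a) + b ≡ n + suc (a + b)
  regroup = solve-∀

elim-poly : ∀ {l : ⟦ Γ ⟧ → List ⟦ A ⟧} {z : ⟦ Γ ⟧ → ⟦ B ⟧} {s : ⟦ (Γ ⊗ A) ⊗ list A ⟧ → ⟦ B ⟧} →
  PolyTime Γ (list A) l → PolyTime Γ B z → PolyTime ((Γ ⊗ A) ⊗ list A) B s →
  PolyTime Γ B (λ γ → elimList (z γ) (λ a as → s ((γ , a) , as)) (l γ))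
elim-poly L Z S .prog X = suc X ≔ var X ⨾ L .prog (suc X) ⨾
  (if var (suc X)
   then (X ≔ consᵉ (consᵉ (var X) (hdᵉ (var (suc X)))) (tlᵉ (var (suc X))) ⨾ S .prog X)
   else Z .prog X)
elim-poly L Z S .time =
  K 1 ⊕ (K 2 ⊕ (K 1 ⊕ (L .time ⊕ (K 2 ⊕ ((K 1 ⊕ (K 8 ⊕ S .time ⊚ (K 1 ⊕ (𝑛 ⊕ L .grow)))) ⊕ Z .time)))))
elim-poly L Z S .grow = S .grow ⊚ (K 1 ⊕ (𝑛 ⊕ L .grow)) ⊕ Z .grow
elim-poly {Γ = Γ} {A = A} {B = B} {l = l} {z} {s} L Z S .runs X σ γ eq =
  seq-runs {Q = λ τ → τ (suc X) ≡ enc Γ γ × (∀ Y → Y < suc X → τ Y ≡ σ Y)}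
    (assign-runs (trans (update-≡ σ (suc X) _) eq , update-< σ (suc X) _)) λ σ₁ (v₁ , fr₁) →
  seq-runs (L .runs (suc X) σ₁ γ v₁) λ σ₂ (v₂ , fr₂) →
  branch σ₂ (l γ) (L .bounded γ) v₂ (trans (fr₂ _ ℕₚ.≤-refl) (trans (fr₁ _ ℕₚ.≤-refl) eq))
    (λ Y Y<X → trans (fr₂ Y (ℕₚ.m<n⇒m<1+n Y<X)) (fr₁ Y (ℕₚ.m<n⇒m<1+n Y<X)))
  where
  N = size (enc Γ γ)
  branch : ∀ σ₂ as → size (enc (list A) as) ≤ ⟪ L .grow ⟫ N →
    σ₂ (suc X) ≡ enc (list A) as → σ₂ X ≡ enc Γ γ →
    (∀ Y → Y < X → σ₂ Y ≡ σ Y) → Runs _ σ₂ _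
      (λ τ → τ X ≡ enc B (elimList (z γ) (λ a as → s ((γ , a) , as)) as) ×
             (∀ Y → Y < X → τ Y ≡ σ Y))
  branch σ₂ [] _ v u fr with Z .runs X σ₂ γ u
  ... | τ , t , r , (w , fr′) , le = if-false-runs v
          (τ , t , r , (w , λ Y Y<X → trans (fr′ Y Y<X) (fr Y Y<X)) , le)
  branch σ₂ (a ∷ as) small v u fr = if-true-runs (λ n → cons≢nil (trans (sym v) n))
      (seq-runs {b₁ = 8}
        {Q = λ τ → τ X ≡ enc ((Γ ⊗ A) ⊗ list A) ((γ , a) , as) × (∀ Y → Y < X → τ Y ≡ σ₂ Y)}
        (assign-runs (trans (update-≡ σ₂ X _)
           (cong₂ cons (cong₂ cons u (cong head v)) (cong tail v)) , update-< σ₂ X _)) λ σ₃ (v₃ , fr₃) →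
        let τ , t , r , (w , fr′) , le = S .runs X σ₃ ((γ , a) , as) v₃
        in τ , t , r , (w , λ Y Y<X → trans (fr′ Y Y<X) (trans (fr₃ Y Y<X) (fr Y Y<X))) ,
           ℕₚ.≤-trans le (⟪⟫-mono (S .time) (branch-size {A = A} {Γ = Γ} γ small)))
elim-poly {Γ = Γ} {A = A} {l = l} L Z S .bounded γ with l γ | L .bounded γ
... | []     | _     = ℕₚ.≤-trans (Z .bounded γ) (ℕₚ.m≤n+m _ _)
... | a ∷ as | small = ℕₚ.≤-trans (S .bounded ((γ , a) , as))
  (ℕₚ.≤-trans (⟪⟫-mono (S .grow) (branch-size {A = A} {Γ = Γ} γ small)) (ℕₚ.m≤m+n _ _))

size≥1 : ∀ d → 1 ≤ size d
size≥1 nil        = ℕₚ.≤-refl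
size≥1 (cons _ _) = s≤s z≤n

length≤size : ∀ (l : List ⟦ A ⟧) → length l ≤ size (enc (list A) l)
length≤size         []      = z≤n
length≤size {A = A} (a ∷ l) = s≤s (ℕₚ.≤-trans (length≤size l) (ℕₚ.m≤n+m _ (size (enc A a))))

∈⇒size≤ : ∀ {a} {l : List ⟦ A ⟧} → a ∈ l → size (enc A a) ≤ size (enc (list A) l)
∈⇒size≤ (here refl)              = ℕₚ.m≤n⇒m≤1+n (ℕₚ.m≤m+n _ _)
∈⇒size≤ {A = A} (there {x = x} a∈) =
  ℕₚ.m≤n⇒m≤1+n (ℕₚ.≤-trans (∈⇒size≤ {A = A} a∈) (ℕₚ.m≤n+m _ (size (enc A x))))

-- I γ k b is an invariant of the accumulator b after k steps; it is needed only
-- to keep the accumulator polynomially small.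
record FoldInvariant {Γ A B : Ty} (l : ⟦ Γ ⟧ → List ⟦ A ⟧) (z : ⟦ Γ ⟧ → ⟦ B ⟧)
    (s : ⟦ (Γ ⊗ A) ⊗ B ⟧ → ⟦ B ⟧) (p : Pol) : Set₁ where
  field
    I     : ⟦ Γ ⟧ → ℕ → ⟦ B ⟧ → Set
    start : ∀ γ → I γ 0 (z γ)
    step  : ∀ γ k {a b} → a ∈ l γ → I γ k b → I γ (suc k) (s ((γ , a) , b))
    small : ∀ γ k {b} → k ≤ length (l γ) → I γ k b → size (enc B b) ≤ ⟪ p ⟫ (size (enc Γ γ))

module _ {l : ⟦ Γ ⟧ → List ⟦ A ⟧} {z : ⟦ Γ ⟧ → ⟦ B ⟧} {s : ⟦ (Γ ⊗ A) ⊗ B ⟧ → ⟦ B ⟧}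
  (L : PolyTime Γ (list A) l) (Z : PolyTime Γ B z) (S : PolyTime ((Γ ⊗ A) ⊗ B) B s)
  (p : Pol) (inv : FoldInvariant {A = A} {B = B} l z s p) where

  open FoldInvariant inv

  private
    go : ⟦ Γ ⟧ → ⟦ B ⟧ → List ⟦ A ⟧ → ⟦ B ⟧
    go γ = foldl (λ b a → s ((γ , a) , b))

    -- `X` holds the context, `1 + X` the rest of the list and `2 + X` the accumulator. The step
    -- runs from `3 + X` upwards and so leaves all three intact.
    body : ℕ → Cmd
    body X =
      (3 + X) ≔ consᵉ (consᵉ (var X) (hdᵉ (var (1 + X)))) (var (2 + X)) ⨾
      S .prog (3 + X) ⨾ (2 + X) ≔ var (3 + X) ⨾ (1 + X) ≔ tlᵉ (var (1 + X))

    scan : ℕ → Cmd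
    scan X = while var (1 + X) loop body X

    bodyTime : Pol
    bodyTime = K 1 ⊕ (K 7 ⊕ (K 1 ⊕ (S .time ⊚ (K 1 ⊕ (K 1 ⊕ (𝑛 ⊕ L .grow) ⊕ p)) ⊕ (K 1 ⊕ (K 2 ⊕ K 3)))))

    ⟦body⟧ : ⟦ Γ ⟧ → ℕ
    ⟦body⟧ γ = ⟪ bodyTime ⟫ (size (enc Γ γ))

    State : ℕ → Store → ⟦ Γ ⟧ → List ⟦ A ⟧ → ⟦ B ⟧ → Store → Set
    State X σ γ as b τ = τ X ≡ enc Γ γ × τ (1 + X) ≡ enc (list A) as × τ (2 + X) ≡ enc B b ×
      (∀ Y → Y < X → τ Y ≡ σ Y)

    body-runs : ∀ X σ γ a as b ρ → a ∈ l γ → size (enc B b) ≤ ⟪ p ⟫ (size (enc Γ γ)) →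
      State X σ γ (a ∷ as) b ρ →
      Runs (body X) ρ (⟦body⟧ γ) (State X σ γ as (s ((γ , a) , b)))
    body-runs X σ γ a as b ρ a∈ b≤ (u , v , w , fr) =
      seq-runs {b₁ = 7} {Q = λ τ → τ (3 + X) ≡ enc ((Γ ⊗ A) ⊗ B) ((γ , a) , b) ×
                                   (∀ Y → Y < 3 + X → τ Y ≡ ρ Y)}
        (assign-runs (trans (update-≡ ρ (3 + X) _)
            (cong₂ cons (cong₂ cons u (cong head v)) w) , update-< ρ (3 + X) _)) λ ρ₁ (v₁ , fr₁) →
      seq-runs (weaken-runs (⟪⟫-mono (S .time) arg≤) (S .runs (3 + X) ρ₁ _ v₁)) λ ρ₂ (v₂ , fr₂) →
      let ρ₂≡ρ = λ Y (Y< : Y < 3 + X) → trans (fr₂ Y Y<) (fr₁ Y Y<)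
          0< = ℕₚ.m<n⇒m<1+n (ℕₚ.m<n⇒m<1+n ℕₚ.≤-refl) in
      seq-runs {b₁ = 2} {Q = λ τ → τ (2 + X) ≡ ρ₂ (3 + X) × (∀ Y → Y < 2 + X → τ Y ≡ ρ₂ Y)}
        (assign-runs (update-≡ ρ₂ (2 + X) _ , update-< ρ₂ (2 + X) _)) λ ρ₃ (v₃ , fr₃) →
      assign-runs
        ( trans (update-< ρ₃ (1 + X) _ X ℕₚ.≤-refl)
            (trans (fr₃ X (ℕₚ.m<n⇒m<1+n ℕₚ.≤-refl)) (trans (ρ₂≡ρ X 0<) u))
        , trans (update-≡ ρ₃ (1 + X) _) (cong tail (trans (fr₃ (1 + X) ℕₚ.≤-refl)
            (trans (ρ₂≡ρ (1 + X) (ℕₚ.m<n⇒m<1+n ℕₚ.≤-refl)) v)))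
        , trans (update-≢ ρ₃ (1 + X) _ (ℕₚ.<⇒≢ {1 + X} ℕₚ.≤-refl ∘ sym)) (trans v₃ v₂)
        , λ Y Y<X → let Y<1+X = ℕₚ.m<n⇒m<1+n Y<X ; Y<2+X = ℕₚ.m<n⇒m<1+n Y<1+X in
            trans (update-< ρ₃ (1 + X) _ Y Y<1+X) (trans (fr₃ Y Y<2+X)
              (trans (ρ₂≡ρ Y (ℕₚ.m<n⇒m<1+n Y<2+X)) (fr Y Y<X))))
      where
      arg≤ : size (enc ((Γ ⊗ A) ⊗ B) ((γ , a) , b)) ≤ _
      arg≤ = s≤s (ℕₚ.+-mono-≤ (s≤s (ℕₚ.+-monoʳ-≤ _ (ℕₚ.≤-trans (∈⇒size≤ {A = A} a∈) (L .bounded γ)))) b≤)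

    scan-runs : ∀ X σ γ k as b ρ → k + length as ≤ length (l γ) → (∀ {a} → a ∈ as → a ∈ l γ) →
      I γ k b → State X σ γ as b ρ →
      Runs (scan X) ρ (length as * (2 + ⟦body⟧ γ) + 2) (State X σ γ [] (go γ b as))
    scan-runs X σ γ k [] b ρ _ _ _ st@(_ , v , _) = ρ , 2 , while-false v , st , ℕₚ.≤-refl
    scan-runs X σ γ k (a ∷ as) b ρ k≤ ⊆l i st@(_ , v , _) =
      let k≤′ = subst (_≤ length (l γ)) (ℕₚ.+-suc k (length as)) k≤
          i′ = step γ k (⊆l (here refl)) i
          ρ₁ , t₁ , r₁ , st₁ , le₁ = body-runs X σ γ a as b ρ (⊆l (here refl))
            (small γ k (ℕₚ.≤-trans (ℕₚ.m≤m+n k _) k≤) i) st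
          ρ₂ , t₂ , r₂ , st₂ , le₂ = scan-runs X σ γ (suc k) as _ ρ₁ k≤′ (⊆l ∘ there) i′ st₁
      in ρ₂ , _ , while-true (λ n → cons≢nil (trans (sym v) n)) r₁ r₂ , st₂ ,
         s≤s (s≤s (ℕₚ.≤-trans (ℕₚ.+-mono-≤ le₁ le₂)
           (ℕₚ.≤-reflexive (sym (ℕₚ.+-assoc (⟦body⟧ γ) _ 2)))))

    invariant : ∀ γ k as b → k + length as ≤ length (l γ) → (∀ {a} → a ∈ as → a ∈ l γ) →
      I γ k b → I γ (k + length as) (go γ b as)
    invariant γ k [] b _ _ i = subst (λ k → I γ k b) (sym (ℕₚ.+-identityʳ k)) i
    invariant γ k (a ∷ as) b k≤ ⊆l i =
      subst (λ k → I γ k (go γ b (a ∷ as))) (sym (ℕₚ.+-suc k (length as)))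
        (invariant γ (suc k) as _ (subst (_≤ length (l γ)) (ℕₚ.+-suc k (length as)) k≤)
          (⊆l ∘ there) (step γ k (⊆l (here refl)) i))

  foldl-poly-inv : PolyTime Γ B (λ γ → foldl (λ b a → s ((γ , a) , b)) (z γ) (l γ))
  foldl-poly-inv .prog X =
    (1 + X) ≔ var X ⨾ L .prog (1 + X) ⨾ (2 + X) ≔ var X ⨾ Z .prog (2 + X) ⨾
    scan X ⨾ X ≔ var (2 + X)
  foldl-poly-inv .time = K 1 ⊕ (K 2 ⊕ (K 1 ⊕ (L .time ⊕ (K 1 ⊕ (K 2 ⊕ (K 1 ⊕ (Z .time ⊕
    (K 1 ⊕ ((L .grow ⊛ (K 2 ⊕ bodyTime) ⊕ K 2) ⊕ K 2)))))))))
  foldl-poly-inv .grow = p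
  foldl-poly-inv .runs X σ γ eq =
    seq-runs {b₁ = 2} {Q = λ τ → τ (1 + X) ≡ enc Γ γ × (∀ Y → Y < 1 + X → τ Y ≡ σ Y)}
      (assign-runs (trans (update-≡ σ (1 + X) _) eq , update-< σ (1 + X) _)) λ σ₁ (v₁ , fr₁) →
    seq-runs (L .runs (1 + X) σ₁ γ v₁) λ σ₂ (v₂ , fr₂) →
    seq-runs {b₁ = 2} {Q = λ τ → τ (2 + X) ≡ enc Γ γ × (∀ Y → Y < 2 + X → τ Y ≡ σ₂ Y)}
      (assign-runs (trans (update-≡ σ₂ (2 + X) _)
          (trans (fr₂ X ℕₚ.≤-refl) (trans (fr₁ X ℕₚ.≤-refl) eq)) ,
        update-< σ₂ (2 + X) _)) λ σ₃ (v₃ , fr₃) →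
    seq-runs (Z .runs (2 + X) σ₃ γ v₃) λ σ₄ (v₄ , fr₄) →
    let σ₄≡σ₂ = λ Y (Y< : Y < 2 + X) → trans (fr₄ Y Y<) (fr₃ Y Y<)
        σ₄≡σ = λ Y (Y< : Y < 1 + X) → trans (σ₄≡σ₂ Y (ℕₚ.m<n⇒m<1+n Y<)) (trans (fr₂ Y Y<) (fr₁ Y Y<)) in
    seq-runs (weaken-runs (ℕₚ.+-monoˡ-≤ 2 (ℕₚ.*-monoˡ-≤ (2 + ⟦body⟧ γ)
                (ℕₚ.≤-trans (length≤size {A = A} (l γ)) (L .bounded γ))))
      (scan-runs X σ γ 0 (l γ) (z γ) σ₄ ℕₚ.≤-refl id (start γ)
        ( trans (σ₄≡σ X ℕₚ.≤-refl) eq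
        , trans (σ₄≡σ₂ (1 + X) ℕₚ.≤-refl) v₂
        , v₄
        , λ Y Y< → σ₄≡σ Y (ℕₚ.m<n⇒m<1+n Y<)))) λ σ₅ (_ , _ , v₅ , fr₅) →
    assign-runs (trans (update-≡ σ₅ X _) v₅ , λ Y Y< → trans (update-< σ₅ X _ Y Y<) (fr₅ Y Y<))
  foldl-poly-inv .bounded γ =
    small γ (length (l γ)) ℕₚ.≤-refl (invariant γ 0 (l γ) (z γ) ℕₚ.≤-refl id (start γ))

-- The increment may depend on the context and the list entry but not on the accumulator; such
-- additive growth stays polynomial over a whole loop.
Grows : ∀ {Γ A B} → (⟦ (Γ ⊗ A) ⊗ B ⟧ → ⟦ B ⟧) → Pol → Set
Grows {Γ} {A} {B} s q = ∀ γ a b →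
  size (enc B (s ((γ , a) , b))) ≤ ⟪ q ⟫ (size (enc (Γ ⊗ A) (γ , a))) + size (enc B b)

foldl-poly : ∀ {l : ⟦ Γ ⟧ → List ⟦ A ⟧} {z : ⟦ Γ ⟧ → ⟦ B ⟧} {s : ⟦ (Γ ⊗ A) ⊗ B ⟧ → ⟦ B ⟧} →
  PolyTime Γ (list A) l → PolyTime Γ B z → PolyTime ((Γ ⊗ A) ⊗ B) B s →
  ∀ q → Grows {Γ} {A} {B} s q →
  PolyTime Γ B (λ γ → foldl (λ b a → s ((γ , a) , b)) (z γ) (l γ))
foldl-poly {Γ = Γ} {A = A} {B = B} {l = l} {z} {s} L Z S q g = foldl-poly-inv L Z S
  (L .grow ⊛ q ⊚ (K 1 ⊕ (𝑛 ⊕ L .grow)) ⊕ Z .grow) record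
  { I     = λ γ k b → size (enc B b) ≤ k * ⟪ q ⊚ (K 1 ⊕ (𝑛 ⊕ L .grow)) ⟫ (size (enc Γ γ)) + ⟪ Z .grow ⟫
      (size (enc Γ γ))
  ; start = Z .bounded
  ; step  = λ γ k {a} {b} a∈ b≤ → ℕₚ.≤-trans (g γ a b) (ℕₚ.≤-trans
      (ℕₚ.+-mono-≤ (⟪⟫-mono q (s≤s (ℕₚ.+-monoʳ-≤ _ (ℕₚ.≤-trans (∈⇒size≤ {A = A} a∈) (L .bounded γ))))) b≤)
      (ℕₚ.≤-reflexive (sym (ℕₚ.+-assoc (⟪ q ⊚ (K 1 ⊕ (𝑛 ⊕ L .grow)) ⟫ (size (enc Γ γ))) _ _))))
  ; small = λ γ k k≤ b≤ → ℕₚ.≤-trans b≤ (ℕₚ.+-monoˡ-≤ _ (ℕₚ.*-monoˡ-≤ _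
      (ℕₚ.≤-trans k≤ (ℕₚ.≤-trans (length≤size {A = A} (l γ)) (L .bounded γ)))))
  }

reverse-poly : ∀ {l : ⟦ Γ ⟧ → List ⟦ A ⟧} →
  PolyTime Γ (list A) l → PolyTime Γ (list A) (λ γ → reverse (l γ))
reverse-poly {Γ = Γ} {A = A} L = foldl-poly L nil-poly (cons-poly (snd-poly ∙ fst-poly) snd-poly) 𝑛
  (λ γ a b → s≤s (ℕₚ.+-monoˡ-≤ _ (ℕₚ.m≤n+m _ (size (enc Γ γ)))))

-- Loops consume a list from the left, so the list is reversed beforehand.
foldr-poly : ∀ {l : ⟦ Γ ⟧ → List ⟦ A ⟧} {z : ⟦ Γ ⟧ → ⟦ B ⟧} {s : ⟦ (Γ ⊗ A) ⊗ B ⟧ → ⟦ B ⟧} →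
  PolyTime Γ (list A) l → PolyTime Γ B z → PolyTime ((Γ ⊗ A) ⊗ B) B s →
  ∀ q → Grows {Γ} {A} {B} s q →
  PolyTime Γ B (λ γ → foldr (λ a b → s ((γ , a) , b)) (z γ) (l γ))
foldr-poly {l = l} {z} L Z S q g =
  ≗-poly (λ γ → Listₚ.reverse-foldl _ (z γ) (l γ)) (foldl-poly (reverse-poly L) Z S q g)

map-poly : ∀ {l : ⟦ Γ ⟧ → List ⟦ A ⟧} {f : ⟦ Γ ⊗ A ⟧ → ⟦ B ⟧} →
  PolyTime Γ (list A) l → PolyTime (Γ ⊗ A) B f →
  PolyTime Γ (list B) (λ γ → map (λ a → f (γ , a)) (l γ))
map-poly {A = A} {B = B} {l = l} {f} L F = ≗-poly (λ γ → foldr-map γ (l γ))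
  (foldr-poly {A = A} {B = list B} L nil-poly (cons-poly (F ∙ fst-poly) snd-poly) (K 1 ⊕ F .grow)
    (λ γ a b → s≤s (ℕₚ.+-monoˡ-≤ _ (F .bounded (γ , a)))))
  where
  foldr-map : ∀ γ as → foldr (λ a b → f (γ , a) ∷ b) [] as ≡ map (λ a → f (γ , a)) as
  foldr-map γ []       = refl
  foldr-map γ (a ∷ as) = cong (f (γ , a) ∷_) (foldr-map γ as)

-- Booleans, unary numbers and list operations

bool-size : ∀ b → size (encodeBool b) ≤ 3
bool-size false = s≤s z≤n
bool-size true  = ℕₚ.≤-refl

not-poly : ∀ {b : ⟦ Γ ⟧ → Bool} → PolyTime Γ bool b → PolyTime Γ bool (λ γ → not (b γ))
not-poly {b = b} P = ≗-poly (λ γ → lemma (b γ)) (if-poly P false-poly true-poly)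
  where
  lemma : ∀ b → (ifᵇ b then false else true) ≡ not b
  lemma false = refl
  lemma true  = refl

∧-poly : ∀ {a b : ⟦ Γ ⟧ → Bool} → PolyTime Γ bool a → PolyTime Γ bool b →
  PolyTime Γ bool (λ γ → a γ ∧ b γ)
∧-poly {a = a} {b} P Q = ≗-poly (λ γ → lemma (a γ) (b γ)) (if-poly P Q false-poly)
  where
  lemma : ∀ a b → (ifᵇ a then b else false) ≡ a ∧ b
  lemma false _ = refl
  lemma true  _ = refl

∨-poly : ∀ {a b : ⟦ Γ ⟧ → Bool} → PolyTime Γ bool a → PolyTime Γ bool b →
  PolyTime Γ bool (λ γ → a γ ∨ b γ)
∨-poly {a = a} {b} P Q = ≗-poly (λ γ → lemma (a γ) (b γ)) (if-poly P true-poly Q)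
  where
  lemma : ∀ a b → (ifᵇ a then true else b) ≡ a ∨ b
  lemma false _ = refl
  lemma true  _ = refl

foldl-replicate : ∀ {S : Set} (f : S → S) x m →
  foldl (λ y _ → f y) x (replicate (suc m) tt) ≡ f (foldl (λ y _ → f y) x (replicate m tt))
foldl-replicate f x zero    = refl
foldl-replicate f x (suc m) = foldl-replicate f (f x) m

iterate-poly : ∀ {k : ⟦ Γ ⟧ → ℕ} {z : ⟦ Γ ⟧ → ⟦ B ⟧} {f : ⟦ B ⟧ → ⟦ B ⟧} →
  PolyTime Γ nat k → PolyTime Γ B z → PolyTime B B f → (∀ b → size (enc B (f b)) ≤ size (enc B b)) →
  PolyTime Γ B (λ γ → foldl (λ b _ → f b) (z γ) (replicate (k γ) tt))
iterate-poly N Z F f≤ = foldl-poly (units-poly ∙ N) Z (F ∙ snd-poly) (K 0) (λ _ _ → f≤)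

-- `tail nil` is `nil` just as `pred 0` is `0`, so iterated tails compute truncated subtraction. The
-- comparisons of numbers are derived from it.
∸-poly : ∀ {m n : ⟦ Γ ⟧ → ℕ} → PolyTime Γ nat m → PolyTime Γ nat n → PolyTime Γ nat (λ γ → m γ ∸ n γ)
∸-poly {m = m} {n} M N = ≗-poly (λ γ → lemma (m γ) (n γ)) (iterate-poly N M pred-poly pred≤)
  where
  pred-poly : PolyTime nat nat pred
  pred≤ : ∀ k → size (encodeUnary (pred k)) ≤ size (encodeUnary k)
  pred≤ zero    = ℕₚ.≤-refl
  pred≤ (suc k) = ℕₚ.m≤n⇒m≤1+n (ℕₚ.n≤1+n _)
  pred-poly = expr-poly (λ X → tlᵉ (var X)) 2 𝑛 (λ _ → ℕₚ.≤-refl)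
    (λ { _ _ zero eq → cong tail eq ; _ _ (suc k) eq → cong tail eq }) pred≤
  lemma : ∀ m n → foldl (λ b _ → pred b) m (replicate n tt) ≡ m ∸ n
  lemma m zero    = refl
  lemma m (suc n) = trans (foldl-replicate pred m n)
    (trans (cong pred (lemma m n)) (ℕₚ.pred[m∸n]≡m∸[1+n] m n))

isZero : ℕ → Bool
isZero k = elimList true (λ _ _ → false) (replicate k tt)

isZero-poly : ∀ {k : ⟦ Γ ⟧ → ℕ} → PolyTime Γ nat k → PolyTime Γ bool (λ γ → isZero (k γ))
isZero-poly N = elim-poly (units-poly ∙ N) true-poly false-poly

≤ᵇ-poly : ∀ {m n : ⟦ Γ ⟧ → ℕ} → PolyTime Γ nat m → PolyTime Γ nat n → PolyTime Γ bool (λ γ → m γ ≤ᵇ n γ)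
≤ᵇ-poly {m = m} {n} M N = ≗-poly (λ γ → lemma (m γ) (n γ)) (isZero-poly (∸-poly M N))
  where
  <ᵇ-suc : ∀ m n → (m <ᵇ suc n) ≡ (m ≤ᵇ n)
  <ᵇ-suc zero    n = refl
  <ᵇ-suc (suc m) n = refl
  lemma : ∀ m n → isZero (m ∸ n) ≡ (m ≤ᵇ n)
  lemma zero    zero    = refl
  lemma zero    (suc n) = refl
  lemma (suc m) zero    = refl
  lemma (suc m) (suc n) = trans (lemma m n) (sym (<ᵇ-suc m n))

≡ᵇ-poly : ∀ {m n : ⟦ Γ ⟧ → ℕ} → PolyTime Γ nat m → PolyTime Γ nat n → PolyTime Γ bool (λ γ → m γ ≡ᵇ n γ)
≡ᵇ-poly {m = m} {n} M N = ≗-poly (λ γ → lemma (m γ) (n γ))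
  (∧-poly (isZero-poly (∸-poly M N)) (isZero-poly (∸-poly N M)))
  where
  lemma : ∀ m n → isZero (m ∸ n) ∧ isZero (n ∸ m) ≡ (m ≡ᵇ n)
  lemma zero    zero    = refl
  lemma zero    (suc n) = refl
  lemma (suc m) zero    = refl
  lemma (suc m) (suc n) = lemma m n

any-poly : ∀ {l : ⟦ Γ ⟧ → List ⟦ A ⟧} {p : ⟦ Γ ⊗ A ⟧ → Bool} →
  PolyTime Γ (list A) l → PolyTime (Γ ⊗ A) bool p → PolyTime Γ bool (λ γ → any (λ a → p (γ , a)) (l γ))
any-poly {l = l} {p} L P = ≗-poly (λ γ → lemma γ (l γ))
  (foldr-poly L false-poly (∨-poly (P ∙ fst-poly) snd-poly) (K 3)
    (λ γ a b → ℕₚ.≤-trans (bool-size (p (γ , a) ∨ b)) (ℕₚ.m≤m+n 3 _)))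
  where
  lemma : ∀ γ as → foldr (λ a b → p (γ , a) ∨ b) false as ≡ any (λ a → p (γ , a)) as
  lemma γ []       = refl
  lemma γ (a ∷ as) = cong (p (γ , a) ∨_) (lemma γ as)

filter-poly : ∀ {l : ⟦ Γ ⟧ → List ⟦ A ⟧} {p : ⟦ Γ ⊗ A ⟧ → Bool} →
  PolyTime Γ (list A) l → PolyTime (Γ ⊗ A) bool p →
  PolyTime Γ (list A) (λ γ → filterᵇ (λ a → p (γ , a)) (l γ))
filter-poly {Γ = Γ} {A = A} {l = l} {p} L P = ≗-poly (λ γ → lemma γ (l γ))
  (foldr-poly L nil-poly (if-poly (P ∙ fst-poly) (cons-poly (snd-poly ∙ fst-poly) snd-poly) snd-poly) 𝑛 growth)
  where
  growth : Grows {Γ} {A} {list A} (λ ((γ , a) , b) → ifᵇ p (γ , a) then a ∷ b else b) 𝑛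
  growth γ a b with p (γ , a)
  ... | true  = s≤s (ℕₚ.+-monoˡ-≤ _ (ℕₚ.m≤n+m _ (size (enc Γ γ))))
  ... | false = ℕₚ.m≤n+m _ _
  lemma : ∀ γ as → foldr (λ a b → ifᵇ p (γ , a) then a ∷ b else b) [] as ≡ filterᵇ (λ a → p (γ , a)) as
  lemma γ []       = refl
  lemma γ (a ∷ as) with p (γ , a)
  ... | true  = cong (a ∷_) (lemma γ as)
  ... | false = lemma γ as

length-poly : ∀ {l : ⟦ Γ ⟧ → List ⟦ A ⟧} → PolyTime Γ (list A) l → PolyTime Γ nat (λ γ → length (l γ))
length-poly {A = A} {l = l} L = ≗-poly (λ γ → lemma (l γ))
  (foldr-poly L zero-poly (suc-poly snd-poly) (K 2) (λ _ _ _ → ℕₚ.≤-refl))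
  where
  lemma : ∀ (as : List ⟦ A ⟧) → foldr (λ _ b → suc b) 0 as ≡ length as
  lemma []       = refl
  lemma (a ∷ as) = cong suc (lemma as)

++-poly : ∀ {l m : ⟦ Γ ⟧ → List ⟦ A ⟧} → PolyTime Γ (list A) l → PolyTime Γ (list A) m →
  PolyTime Γ (list A) (λ γ → l γ ++ m γ)
++-poly {Γ = Γ} {A = A} {l = l} {m} L M = ≗-poly (λ γ → lemma (m γ) (l γ))
  (foldr-poly L M (cons-poly (snd-poly ∙ fst-poly) snd-poly) 𝑛
    (λ γ a b → s≤s (ℕₚ.+-monoˡ-≤ _ (ℕₚ.m≤n+m _ (size (enc Γ γ))))))
  where
  lemma : ∀ (bs as : List ⟦ A ⟧) → foldr _∷_ bs as ≡ as ++ bs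
  lemma bs []       = refl
  lemma bs (a ∷ as) = cong (a ∷_) (lemma bs as)

++-size : ∀ (as bs : List ⟦ A ⟧) →
  size (enc (list A) (as ++ bs)) ≤ size (enc (list A) as) + size (enc (list A) bs)
++-size []       bs = ℕₚ.n≤1+n _
++-size {A = A} (a ∷ as) bs = s≤s (ℕₚ.≤-trans (ℕₚ.+-monoʳ-≤ (size (enc A a)) (++-size as bs))
  (ℕₚ.≤-reflexive (sym (ℕₚ.+-assoc (size (enc A a)) _ _))))

concat-poly : ∀ {l : ⟦ Γ ⟧ → List (List ⟦ A ⟧)} → PolyTime Γ (list (list A)) l →
  PolyTime Γ (list A) (λ γ → concat (l γ))
concat-poly {Γ = Γ} {A = A} L = foldr-poly L nil-poly (++-poly (snd-poly ∙ fst-poly) snd-poly) 𝑛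
  (λ γ a b → ℕₚ.≤-trans (++-size {A = A} a b) (ℕₚ.+-monoˡ-≤ _ (ℕₚ.m≤n⇒m≤1+n (ℕₚ.m≤n+m _ (size (enc Γ γ))))))

drop1-size : ∀ (l : List ⟦ A ⟧) → size (enc (list A) (drop 1 l)) ≤ size (enc (list A) l)
drop1-size []      = ℕₚ.≤-refl
drop1-size {A = A} (a ∷ l) = ℕₚ.m≤n⇒m≤1+n (ℕₚ.m≤n+m _ (size (enc A a)))

drop1-poly : PolyTime (list A) (list A) (drop 1)
drop1-poly = expr-poly (λ X → tlᵉ (var X)) 2 𝑛 (λ _ → ℕₚ.≤-refl)
  (λ { _ _ [] eq → cong tail eq ; _ _ (_ ∷ _) eq → cong tail eq }) drop1-size

headOr : {S : Set} → S → List S → S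
headOr d = elimList d (λ a _ → a)

headOr-poly : ∀ {d : ⟦ Γ ⟧ → ⟦ A ⟧} {l : ⟦ Γ ⟧ → List ⟦ A ⟧} → PolyTime Γ A d → PolyTime Γ (list A) l →
  PolyTime Γ A (λ γ → headOr (d γ) (l γ))
headOr-poly Z L = elim-poly L Z (snd-poly ∙ fst-poly)

nth : {S : Set} → S → List S → ℕ → S
nth d []       k       = d
nth d (x ∷ xs) zero    = x
nth d (x ∷ xs) (suc k) = nth d xs k

nth-poly : ∀ {d : ⟦ Γ ⟧ → ⟦ A ⟧} {l : ⟦ Γ ⟧ → List ⟦ A ⟧} {k : ⟦ Γ ⟧ → ℕ} →
  PolyTime Γ A d → PolyTime Γ (list A) l → PolyTime Γ nat k → PolyTime Γ A (λ γ → nth (d γ) (l γ) (k γ))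
nth-poly {A = A} {d = d} {l} {k} Z L N = ≗-poly (λ γ → lemma (d γ) (l γ) (k γ))
  (headOr-poly Z (iterate-poly N L drop1-poly (drop1-size {A = A})))
  where
  iterate-[] : ∀ k → foldl (λ b _ → drop 1 b) [] (replicate k tt) ≡ ([] {A = ⟦ A ⟧})
  iterate-[] zero    = refl
  iterate-[] (suc k) = iterate-[] k
  lemma : ∀ d l k → headOr d (foldl (λ b _ → drop 1 b) l (replicate k tt)) ≡ nth d l k
  lemma d []       k       = cong (headOr d) (iterate-[] k)
  lemma d (x ∷ xs) zero    = refl
  lemma d (x ∷ xs) (suc k) = lemma d xs k

_∈ᵇ_ : ℕ → List ℕ → Bool
u ∈ᵇ us = any (u ≡ᵇ_) us

∈ᵇ-poly : ∀ {u : ⟦ Γ ⟧ → ℕ} {us : ⟦ Γ ⟧ → List ℕ} → PolyTime Γ nat u → PolyTime Γ (list nat) us →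
  PolyTime Γ bool (λ γ → u γ ∈ᵇ us γ)
∈ᵇ-poly U Us = any-poly Us (≡ᵇ-poly (U ∙ fst-poly) snd-poly)

nonempty : {S : Set} → List S → Bool
nonempty = elimList false (λ _ _ → true)

nonempty-poly : ∀ {l : ⟦ Γ ⟧ → List ⟦ A ⟧} → PolyTime Γ (list A) l → PolyTime Γ bool (λ γ → nonempty (l γ))
nonempty-poly L = elim-poly L false-poly true-poly

unary-size : ∀ k → size (encodeUnary k) ≡ suc (2 * k)
unary-size zero    = refl
unary-size (suc k) = trans (cong (2 +_) (unary-size k)) (regroup k)
  where
  regroup : ∀ k → 2 + suc (2 * k) ≡ suc (2 * suc k)
  regroup = solve-∀

list-size : ∀ {M} {l : List ⟦ A ⟧} → All (λ a → size (enc A a) ≤ M) l →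
  size (enc (list A) l) ≤ length l * suc M + 1
list-size []       = ℕₚ.≤-refl
list-size {A = A} {M} {a ∷ l} (a≤ ∷ l≤) = s≤s (ℕₚ.≤-trans (ℕₚ.+-mono-≤ a≤ (list-size l≤))
  (ℕₚ.≤-reflexive (sym (ℕₚ.+-assoc M _ 1))))

-- The next entry is the length of the list built so far, which saves a counter. The increment then
-- depends on the accumulator, so `Grows` is out of reach and the invariant determines the
-- accumulator exactly.
downFrom-poly : ∀ {l : ⟦ Γ ⟧ → List ⟦ A ⟧} → PolyTime Γ (list A) l →
  PolyTime Γ (list nat) (λ γ → downFrom (length (l γ)))
downFrom-poly {Γ = Γ} {A = A} {l = l} L = ≗-poly (λ γ → trans (iterate (l γ) 0) (cong downFrom (ℕₚ.+-identityʳ _)))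
  (foldl-poly-inv L nil-poly (cons-poly (length-poly snd-poly) snd-poly) p record
    { I     = λ γ k b → b ≡ downFrom k
    ; start = λ _ → refl
    ; step  = λ { _ k _ refl → cong (_∷ downFrom k) (Listₚ.length-downFrom k) }
    ; small = λ { γ k k≤ refl → ℕₚ.≤-trans (list-size {A = nat} (entries k k≤))
        (ℕₚ.+-monoˡ-≤ 1 (ℕₚ.*-monoˡ-≤ _ (ℕₚ.≤-trans (ℕₚ.≤-reflexive (Listₚ.length-downFrom k)) (≤grow γ k≤)))) }
    })
  where
  p = L .grow ⊛ (K 1 ⊕ (K 1 ⊕ K 2 ⊛ L .grow)) ⊕ K 1
  ≤grow : ∀ γ {k} → k ≤ length (l γ) → k ≤ ⟪ L .grow ⟫ (size (enc Γ γ))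
  ≤grow γ k≤ = ℕₚ.≤-trans k≤ (ℕₚ.≤-trans (length≤size {A = A} (l γ)) (L .bounded γ))
  entries : ∀ {γ} k → k ≤ length (l γ) →
    All (λ i → size (encodeUnary i) ≤ ⟪ K 1 ⊕ K 2 ⊛ L .grow ⟫ (size (enc Γ γ))) (downFrom k)
  entries zero    _  = []
  entries {γ} (suc k) k< = ℕₚ.≤-trans (ℕₚ.≤-reflexive (unary-size k))
    (s≤s (ℕₚ.*-monoʳ-≤ 2 (≤grow γ (ℕₚ.<⇒≤ k<)))) ∷ entries k (ℕₚ.<⇒≤ k<)
  iterate : ∀ (as : List ⟦ A ⟧) k →
    foldl (λ b _ → length b ∷ b) (downFrom k) as ≡ downFrom (length as + k)
  iterate []       k = refl
  iterate (a ∷ as) k = trans (cong (λ b → foldl (λ b _ → length b ∷ b) (b ∷ downFrom k) as) (Listₚ.length-downFrom k))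
    (trans (iterate as (suc k)) (cong downFrom (ℕₚ.+-suc (length as) k)))

-- The algorithm

Env : Ty
Env = (list (list bool) ⊗ nat) ⊗ list bool

matrix : ⟦ Env ⟧ → List (List Bool)
matrix e = proj₁ (proj₁ e)

root : ⟦ Env ⟧ → ℕ
root e = proj₂ (proj₁ e)

nz : ⟦ Env ⟧ → ℕ → Bool
nz e u = nth false (proj₂ e) u

adjacent : ⟦ Env ⟧ → ℕ → ℕ → Bool
adjacent e u w = nth false (nth [] (matrix e) u) w

-- The paths from the root are stored as lists that start with their last vertex.
endpoint : List ℕ → ℕ
endpoint = headOr 0

extends : ⟦ Env ⟧ → ℕ → List ℕ → Bool
extends e w p = adjacent e (endpoint p) w ∧ not (w ∈ᵇ p)

extendTo : ⟦ Env ⟧ → ℕ → List (List ℕ) → List ℕ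
extendTo e w = foldr (λ p q → ifᵇ extends e w p then w ∷ p else q) []

-- Enumerating by the new endpoint, with at most one path for each, keeps a level no longer than the
-- matrix even if the input is not a tree.
next : ⟦ Env ⟧ → List (List ℕ) → List (List ℕ)
next e L = filterᵇ nonempty (map (λ w → extendTo e w L) (downFrom (length (matrix e))))

levels : ⟦ Env ⟧ → List (List (List ℕ))
levels e = foldl (λ Ls _ → next e (headOr [] Ls) ∷ Ls) (((root e ∷ []) ∷ []) ∷ []) (matrix e)

-- The dropped entry is the layer of the source. From here on index `j` stands for layer `suc j`.
layers : ⟦ Env ⟧ → List (List (List ℕ))
layers e = drop 1 (reverse (levels e))

-- The source lies on every path and may occur among the picks as a placeholder; the test `nz` keeps
-- it from counting.
covered : ⟦ Env ⟧ → List ℕ → List ℕ → Bool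
covered e us p = any (λ u → nz e u ∧ u ∈ᵇ us) p

top : ⟦ Env ⟧ → List ℕ → Bool
top e p = not (any (λ u → nz e u) (drop 1 p))

Ctx : Ty
Ctx = Env ⊗ (bool ⊗ bool) ⊗ list bool

tied tie : ⟦ Ctx ⟧ → Bool
tied c = proj₁ (proj₁ (proj₂ c))
tie  c = proj₂ (proj₁ (proj₂ c))

bits : ⟦ Ctx ⟧ → List Bool
bits c = proj₂ (proj₂ c)

prefersFirst : ⟦ Ctx ⟧ → List ℕ → List ℕ → List ℕ → Bool
prefersFirst c us p q =
  ifᵇ top (proj₁ c) p
  then (ifᵇ top (proj₁ c) q then bit else (ifᵇ tied c then cov q else bit))
  else (ifᵇ top (proj₁ c) q then (ifᵇ tied c then not (cov p) else bit)
        else (ifᵇ cov p then (ifᵇ cov q then tie c else false) else (ifᵇ cov q then true else tie c)))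
  where
  -- One pick has been made for each earlier layer, so `length us` is the index of the current one.
  bit = nth false (bits c) (length us)
  cov = λ p → covered (proj₁ c) us (drop 1 p)

-- In a layer without nonzero vertices the source is picked, which saves nothing.
pick : ⟦ Ctx ⟧ → List ℕ → List (List ℕ) → ℕ
pick c us L = elimList (root (proj₁ c))
  (λ p ps → elimList (endpoint p)
    (λ q _ → ifᵇ prefersFirst c us p q then endpoint p else endpoint q) ps)
  (filterᵇ (λ p → nz (proj₁ c) (endpoint p)) L)

-- The latest pick comes first.
picks : ⟦ Ctx ⟧ → List ℕ
picks c = foldl (λ us L → pick c us L ∷ us) [] (layers (proj₁ c))

-- `covered` asks whether a vertex was picked, not when. On a feasible instance this is enough, as a
-- nonzero vertex can only be picked in the step of its own layer.
value : ⟦ Env ⟧ → List ℕ → ℕ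
value e us = length (filterᵇ (λ p → covered e us p) (concat (layers e)))

-- Sylvester's doubling of a Hadamard matrix, with `true` for 1 and `false` for -1.
double : List (List Bool) → List (List Bool)
double H = map (λ h → h ++ h) H ++ map (λ h → h ++ map not h) H

hadamard : ℕ → List (List Bool)
hadamard zero    = (true ∷ []) ∷ []
hadamard (suc m) = double (hadamard m)

-- Doubling stops as soon as there are enough columns for all layers, which keeps the matrix of
-- linear order. Since n ≤ 2^n, one round per row of the adjacency matrix is enough.
rows : ⟦ Env ⟧ → List (List Bool)
rows e = foldl (λ H _ → ifᵇ length (matrix e) ≤ᵇ length H then H else double H) ((true ∷ []) ∷ []) (matrix e)

modes : List (Bool × Bool)
modes = (true , true) ∷ (true , false) ∷ (false , true) ∷ (false , false) ∷ []

strategies : ⟦ Env ⟧ → List (List ℕ)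
strategies e = concat (map (λ h → map (λ m → picks (e , m , h)) modes) (rows e ++ map (map not) (rows e)))

best : ⟦ Env ⟧ → List ℕ
best e = foldl (λ b us → ifᵇ value e b ≤ᵇ value e us then us else b) [] (strategies e)

Input : Ty
Input = (list (list bool) ⊗ nat) ⊗ (list raw ⊗ list raw)

isCons : D → Bool
isCons nil        = false
isCons (cons _ _) = true

-- Whether the encoding of a rational has a nonzero numerator.
nonzero : D → Bool
nonzero d = isCons (tail (head d))

environment : ⟦ Input ⟧ → ⟦ Env ⟧
environment i = proj₁ i , map nonzero (proj₁ (proj₂ i))

solve : ⟦ Input ⟧ → List ℕ
solve i = reverse (best (environment i))

-- The algorithm runs in polynomial time

nz-poly : ∀ {e : ⟦ Γ ⟧ → ⟦ Env ⟧} {u : ⟦ Γ ⟧ → ℕ} →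
  PolyTime Γ Env e → PolyTime Γ nat u → PolyTime Γ bool (λ γ → nz (e γ) (u γ))
nz-poly E U = nth-poly false-poly (snd-poly ∙ E) U

endpoint-poly : ∀ {p : ⟦ Γ ⟧ → List ℕ} → PolyTime Γ (list nat) p → PolyTime Γ nat (λ γ → endpoint (p γ))
endpoint-poly P = headOr-poly zero-poly P

extends-poly : ∀ {e : ⟦ Γ ⟧ → ⟦ Env ⟧} {w : ⟦ Γ ⟧ → ℕ} {p : ⟦ Γ ⟧ → List ℕ} →
  PolyTime Γ Env e → PolyTime Γ nat w → PolyTime Γ (list nat) p →
  PolyTime Γ bool (λ γ → extends (e γ) (w γ) (p γ))
extends-poly E W P = ∧-poly
  (nth-poly false-poly (nth-poly nil-poly (fst-poly ∙ fst-poly ∙ E) (endpoint-poly P)) W)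
  (not-poly (∈ᵇ-poly W P))

extendTo-poly : PolyTime ((Env ⊗ list (list nat)) ⊗ nat) (list nat)
  (λ γ → extendTo (proj₁ (proj₁ γ)) (proj₂ γ) (proj₂ (proj₁ γ)))
extendTo-poly = foldr-poly (snd-poly ∙ fst-poly) nil-poly
  (if-poly (extends-poly (fst-poly ∙ fst-poly ∙ fst-poly ∙ fst-poly) (snd-poly ∙ fst-poly ∙ fst-poly)
      (snd-poly ∙ fst-poly))
    (cons-poly (snd-poly ∙ fst-poly ∙ fst-poly) (snd-poly ∙ fst-poly)) snd-poly)
  𝑛 growth
  where
  growth : Grows {(Env ⊗ list (list nat)) ⊗ nat} {list nat} {list nat}
    (λ γ → let ((((e , _) , w) , p) , q) = γ in ifᵇ extends e w p then w ∷ p else q) 𝑛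
  growth (eL , w) p q with extends (proj₁ eL) w p
  ... | true  = ℕₚ.≤-trans (s≤s (ℕₚ.+-monoˡ-≤ _ (ℕₚ.m≤n⇒m≤1+n (ℕₚ.m≤n+m _ (size (enc (Env ⊗ list (list nat)) eL))))))
                           (ℕₚ.m≤m+n _ _)
  ... | false = ℕₚ.m≤n+m _ _

next-poly : PolyTime (Env ⊗ list (list nat)) (list (list nat)) (λ γ → next (proj₁ γ) (proj₂ γ))
next-poly = filter-poly (map-poly (downFrom-poly (fst-poly ∙ fst-poly ∙ fst-poly)) extendTo-poly)
  (nonempty-poly snd-poly)

prefersFirst-poly : ∀ {c : ⟦ Γ ⟧ → ⟦ Ctx ⟧} {us p q : ⟦ Γ ⟧ → List ℕ} →
  PolyTime Γ Ctx c → PolyTime Γ (list nat) us → PolyTime Γ (list nat) p → PolyTime Γ (list nat) q →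
  PolyTime Γ bool (λ γ → prefersFirst (c γ) (us γ) (p γ) (q γ))

covered-poly : ∀ {e : ⟦ Γ ⟧ → ⟦ Env ⟧} {us p : ⟦ Γ ⟧ → List ℕ} →
  PolyTime Γ Env e → PolyTime Γ (list nat) us → PolyTime Γ (list nat) p →
  PolyTime Γ bool (λ γ → covered (e γ) (us γ) (p γ))
covered-poly E Us P = any-poly P (∧-poly (nz-poly (E ∙ fst-poly) snd-poly) (∈ᵇ-poly snd-poly (Us ∙ fst-poly)))

top-poly : ∀ {e : ⟦ Γ ⟧ → ⟦ Env ⟧} {p : ⟦ Γ ⟧ → List ℕ} →
  PolyTime Γ Env e → PolyTime Γ (list nat) p → PolyTime Γ bool (λ γ → top (e γ) (p γ))
top-poly E P = not-poly (any-poly (drop1-poly ∙ P) (nz-poly (E ∙ fst-poly) snd-poly))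

prefersFirst-poly {c = c} {us} {p} {q} Γc Us P Q =
  if-poly (top-poly E P)
    (if-poly (top-poly E Q) bit (if-poly tied-poly (cov Q) bit))
    (if-poly (top-poly E Q) (if-poly tied-poly (not-poly (cov P)) bit)
      (if-poly (cov P) (if-poly (cov Q) tie-poly false-poly) (if-poly (cov Q) true-poly tie-poly)))
  where
  E = fst-poly ∙ Γc
  tied-poly = fst-poly ∙ fst-poly ∙ snd-poly ∙ Γc
  tie-poly = snd-poly ∙ fst-poly ∙ snd-poly ∙ Γc
  bit = nth-poly false-poly (snd-poly ∙ snd-poly ∙ Γc) (length-poly Us)
  cov : ∀ {p} → PolyTime _ (list nat) p → PolyTime _ bool (λ γ → covered (proj₁ (c γ)) (us γ) (drop 1 (p γ)))
  cov P = covered-poly E Us (drop1-poly ∙ P)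

pick-poly : PolyTime ((Ctx ⊗ list (list nat)) ⊗ list nat) nat
  (λ γ → pick (proj₁ (proj₁ γ)) (proj₂ γ) (proj₂ (proj₁ γ)))
pick-poly = elim-poly (filter-poly (snd-poly ∙ fst-poly)
    (nz-poly (fst-poly ∙ fst-poly ∙ fst-poly ∙ fst-poly) (endpoint-poly snd-poly)))
  (snd-poly ∙ fst-poly ∙ fst-poly ∙ fst-poly ∙ fst-poly)
  (elim-poly snd-poly (endpoint-poly (snd-poly ∙ fst-poly))
    (if-poly (prefersFirst-poly (fst-poly ∙ fst-poly ∙ fst-poly ∙ fst-poly ∙ fst-poly ∙ fst-poly)
               (snd-poly ∙ fst-poly ∙ fst-poly ∙ fst-poly ∙ fst-poly)
               (snd-poly ∙ fst-poly ∙ fst-poly ∙ fst-poly) (snd-poly ∙ fst-poly))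
      (endpoint-poly (snd-poly ∙ fst-poly ∙ fst-poly ∙ fst-poly)) (endpoint-poly (snd-poly ∙ fst-poly))))

endpoint-size : ∀ p → size (encodeUnary (endpoint p)) ≤ size (enc (list nat) p)
endpoint-size []      = ℕₚ.≤-refl
endpoint-size (u ∷ p) = ℕₚ.m≤n⇒m≤1+n (ℕₚ.m≤m+n _ _)

-- The pick is the root or an endpoint of a path in `L`. The bound is free of `us`, which makes the
-- growth of the list of picks additive.
pick-size : ∀ c us L → size (encodeUnary (pick c us L)) ≤ size (enc (Ctx ⊗ list (list nat)) (c , L))
pick-size c us L with filterᵇ (λ p → nz (proj₁ c) (endpoint p)) L | Allₚ.filter⁺
    (λ p → T? (nz (proj₁ c) (endpoint p))) endpoints
  where
  endpoints : All (λ p → size (encodeUnary (endpoint p)) ≤ size (enc (Ctx ⊗ list (list nat)) (c , L))) L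
  endpoints = All.tabulate λ p∈ → ℕₚ.≤-trans (endpoint-size _)
    (ℕₚ.≤-trans (∈⇒size≤ {A = list nat} p∈) (ℕₚ.m≤n⇒m≤1+n (ℕₚ.m≤n+m _ (size (enc Ctx c)))))
... | []          | _             = ℕₚ.≤-trans (root-size c) (ℕₚ.m≤n⇒m≤1+n (ℕₚ.m≤m+n _ _))
  where
  root-size : ∀ c → size (encodeUnary (root (proj₁ c))) ≤ size (enc Ctx c)
  root-size (((A , s) , N) , r) = ℕₚ.m≤n⇒m≤1+n (ℕₚ.≤-trans (ℕₚ.m≤n⇒m≤1+n
    (ℕₚ.≤-trans (ℕₚ.m≤n⇒m≤1+n (ℕₚ.m≤n+m _ (size (enc (list (list bool)) A)))) (ℕₚ.m≤m+n _ _))) (ℕₚ.m≤m+n _ _))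
... | p ∷ []      | p≤ ∷ _        = p≤
... | p ∷ q ∷ _   | p≤ ∷ q≤ ∷ _   with prefersFirst c us p q
...   | true  = p≤
...   | false = q≤

-- A level is computed from the whole previous level, so its size is not an additive increment. The
-- invariant bounds the number of paths in a level uniformly and lets each path grow by one cell per
-- round.
levels-poly : ∀ {e : ⟦ Γ ⟧ → ⟦ Env ⟧} → PolyTime Γ Env e → PolyTime Γ (list (list (list nat))) (λ γ → levels (e γ))
levels-poly E = levels-poly′ ∙ E
  where
  -- One `cons` and a unary number below n, whose encoding has size at most 1 + 2 n.
  cell : Pol
  cell = K 1 ⊕ (K 1 ⊕ K 2 ⊛ 𝑛)

  Small : ⟦ Env ⟧ → ℕ → List (List ℕ) → Set
  Small e k L = length L ≤ size (enc Env e) ×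
    All (λ p → size (enc (list nat) p) ≤ suc k * ⟪ cell ⟫ (size (enc Env e))) L

  matrix≤ : ∀ e → size (enc (list (list bool)) (matrix e)) ≤ size (enc Env e)
  matrix≤ ((A , s) , N) = ℕₚ.m≤n⇒m≤1+n (ℕₚ.≤-trans (ℕₚ.m≤n⇒m≤1+n (ℕₚ.m≤m+n _ _)) (ℕₚ.m≤m+n _ _))

  order≤ : ∀ e → length (matrix e) ≤ size (enc Env e)
  order≤ e = ℕₚ.≤-trans (length≤size {A = list bool} (matrix e)) (matrix≤ e)

  root≤ : ∀ e → size (encodeUnary (root e)) ≤ size (enc Env e)
  root≤ ((A , s) , N) = ℕₚ.m≤n⇒m≤1+n (ℕₚ.≤-trans
    (ℕₚ.m≤n⇒m≤1+n (ℕₚ.m≤n+m _ (size (enc (list (list bool)) A)))) (ℕₚ.m≤m+n _ _))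

  Small-mono : ∀ e k {L} → Small e k L → Small e (suc k) L
  Small-mono e k (le , ps) = le , All.map (λ p≤ → ℕₚ.≤-trans p≤ (ℕₚ.m≤n+m _ (⟪ cell ⟫ (size (enc Env e))))) ps

  extendTo-small : ∀ e k w L → w < length (matrix e) → Small e k L →
    size (enc (list nat) (extendTo e w L)) ≤ suc (suc k) * ⟪ cell ⟫ (size (enc Env e))
  extendTo-small e k w L w< (_ , ps) = go ps
    where
    w≤ : suc (size (encodeUnary w)) ≤ ⟪ cell ⟫ (size (enc Env e))
    w≤ = s≤s (ℕₚ.≤-trans (ℕₚ.≤-reflexive (unary-size w))
           (s≤s (ℕₚ.*-monoʳ-≤ 2 (ℕₚ.≤-trans (ℕₚ.<⇒≤ w<) (order≤ e)))))
    go : ∀ {L} → All (λ p → size (enc (list nat) p) ≤ suc k * ⟪ cell ⟫ (size (enc Env e))) L →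
      size (enc (list nat) (extendTo e w L)) ≤ suc (suc k) * ⟪ cell ⟫ (size (enc Env e))
    go []             = s≤s z≤n
    go (_∷_ {p} q qs) with extends e w p
    ... | true  = ℕₚ.+-mono-≤ w≤ q
    ... | false = go qs

  downFrom-< : ∀ n → All (_< n) (downFrom n)
  downFrom-< zero    = []
  downFrom-< (suc n) = ℕₚ.≤-refl ∷ All.map ℕₚ.m<n⇒m<1+n (downFrom-< n)

  next-small : ∀ e k L → Small e k L → Small e (suc k) (next e L)
  next-small e k L sm =
    ℕₚ.≤-trans (Listₚ.length-filter (T? ∘ nonempty) (map (λ w → extendTo e w L) (downFrom (length (matrix e)))))
      (ℕₚ.≤-trans (ℕₚ.≤-reflexive (trans (Listₚ.length-map _ (downFrom (length (matrix e))))
                                          (Listₚ.length-downFrom _))) (order≤ e)) ,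
    Allₚ.filter⁺ (T? ∘ nonempty) (Allₚ.map⁺
        (All.map (λ {w} w< → extendTo-small e k w L w< sm) (downFrom-< (length (matrix e)))))

  headOr-small : ∀ e k {Ls} → All (Small e k) Ls → Small e k (headOr [] Ls)
  headOr-small e k []       = z≤n , []
  headOr-small e k (sm ∷ _) = sm

  start-small : ∀ e → Small e 0 ((root e ∷ []) ∷ [])
  start-small e = size≥1 (enc Env e) , s≤s (ℕₚ.≤-trans (ℕₚ.+-monoˡ-≤ 1 (root≤ e))
    (ℕₚ.≤-trans (ℕₚ.≤-reflexive (ℕₚ.+-comm (size (enc Env e)) 1))
        (ℕₚ.≤-trans (s≤s (ℕₚ.m≤m+n _ _)) (ℕₚ.m≤m+n _ 0)))) ∷ []

  bound : Pol
  bound = (K 1 ⊕ 𝑛) ⊛ (K 1 ⊕ (𝑛 ⊛ (K 1 ⊕ (K 1 ⊕ 𝑛) ⊛ cell) ⊕ K 1)) ⊕ K 1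

  levels-poly′ : PolyTime Env (list (list (list nat))) levels
  levels-poly′ = foldl-poly-inv {Γ = Env} {A = list bool} {B = list (list (list nat))}
    (fst-poly ∙ fst-poly) (cons-poly (cons-poly (cons-poly (snd-poly ∙ fst-poly) nil-poly) nil-poly) nil-poly)
    (cons-poly (next-poly ∙ pair-poly (fst-poly ∙ fst-poly) (headOr-poly nil-poly snd-poly)) snd-poly)
    bound record
      { I     = λ e k Ls → length Ls ≡ suc k × All (Small e k) Ls
      ; start = λ e → refl , start-small e ∷ []
      ; step  = λ e k _ (len , sm) → cong suc len ,
                  next-small e k _ (headOr-small e k sm) ∷ All.map (Small-mono e k) sm
      ; small = λ e k k≤ (len , sm) →
          let k≤N = ℕₚ.≤-trans k≤ (order≤ e) in
          ℕₚ.≤-trans (list-size {A = list (list nat)} (All.map (λ (L≤ , ps) →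
              ℕₚ.≤-trans (list-size {A = list nat} (All.map (λ p≤ → ℕₚ.≤-trans p≤ (ℕₚ.*-monoˡ-≤ _ (s≤s k≤N))) ps))
                (ℕₚ.+-monoˡ-≤ 1 (ℕₚ.*-monoˡ-≤ _ L≤))) sm))
            (ℕₚ.+-monoˡ-≤ 1 (ℕₚ.*-monoˡ-≤ _ (ℕₚ.≤-trans (ℕₚ.≤-reflexive len) (s≤s k≤N))))
      }

layers-poly : ∀ {e : ⟦ Γ ⟧ → ⟦ Env ⟧} → PolyTime Γ Env e → PolyTime Γ (list (list (list nat))) (λ γ → layers (e γ))
layers-poly E = drop1-poly ∙ reverse-poly (levels-poly E)

picks-poly : ∀ {c : ⟦ Γ ⟧ → ⟦ Ctx ⟧} → PolyTime Γ Ctx c → PolyTime Γ (list nat) (λ γ → picks (c γ))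
picks-poly Γc = picks-poly′ ∙ Γc
  where
  picks-poly′ : PolyTime Ctx (list nat) picks
  picks-poly′ = foldl-poly {Γ = Ctx} {A = list (list nat)} {B = list nat} (layers-poly fst-poly) nil-poly
    (cons-poly pick-poly snd-poly) (K 1 ⊕ 𝑛) (λ c L us → s≤s (ℕₚ.+-monoˡ-≤ _ (pick-size c us L)))

value-poly : ∀ {e : ⟦ Γ ⟧ → ⟦ Env ⟧} {us : ⟦ Γ ⟧ → List ℕ} → PolyTime Γ Env e → PolyTime Γ (list nat) us →
  PolyTime Γ nat (λ γ → value (e γ) (us γ))
value-poly E Us = length-poly (filter-poly (concat-poly (layers-poly E))
    (covered-poly (E ∙ fst-poly) (Us ∙ fst-poly) snd-poly))

double-poly : ∀ {H : ⟦ Γ ⟧ → List (List Bool)} → PolyTime Γ (list (list bool)) H →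
  PolyTime Γ (list (list bool)) (λ γ → double (H γ))
double-poly H = ++-poly (map-poly H (++-poly snd-poly snd-poly))
  (map-poly H (++-poly snd-poly (map-poly snd-poly (not-poly snd-poly))))

length-hadamard : ∀ m → length (hadamard m) ≡ 2 ^ m
length-hadamard zero    = refl
length-hadamard (suc m) = trans (Listₚ.length-++ (map _ (hadamard m)))
  (cong₂ _+_ (trans (Listₚ.length-map _ (hadamard m)) (length-hadamard m))
             (trans (trans (Listₚ.length-map _ (hadamard m)) (length-hadamard m)) (sym (ℕₚ.+-identityʳ _))))

hadamard-widths : ∀ m → All (λ h → length h ≡ 2 ^ m) (hadamard m)
hadamard-widths zero    = refl ∷ []
hadamard-widths (suc m) = Allₚ.++⁺
  (Allₚ.map⁺ (All.map (λ {h} w → trans (Listₚ.length-++ h) (cong₂ _+_ w (trans w (sym (ℕₚ.+-identityʳ _)))))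
      (hadamard-widths m)))
  (Allₚ.map⁺ (All.map (λ {h} w → trans (Listₚ.length-++ h) (cong₂ _+_ w
    (trans (Listₚ.length-map not h) (trans w (sym (ℕₚ.+-identityʳ _)))))) (hadamard-widths m)))

-- H is the Hadamard matrix reached after k steps of the loop in rows, n is the target.
Doubled : ℕ → ℕ → List (List Bool) → Set
Doubled n k H = ∃[ m ] H ≡ hadamard m × 2 ^ m ≤ suc (2 * n) × (n ≤ 2 ^ m ⊎ m ≡ k)

doubled-start : ∀ n → Doubled n 0 ((true ∷ []) ∷ [])
doubled-start n = 0 , refl , s≤s z≤n , inj₂ refl

doubled-step : ∀ n k {H} → Doubled n k H → Doubled n (suc k) (ifᵇ n ≤ᵇ length H then H else double H)
doubled-step n k (m , refl , le , or) with n ≤ᵇ length (hadamard m) in eq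
... | true  = m , refl , le , inj₁ (subst (n ≤_) (length-hadamard m) (ℕₚ.≤ᵇ⇒≤ n _ (subst T (sym eq) tt)))
... | false = suc m , refl , ℕₚ.m≤n⇒m≤1+n (ℕₚ.*-monoʳ-≤ 2 (ℕₚ.<⇒≤ 2^m<n)) , inj₂ (cong suc (m≡k or))
  where
  2^m<n : 2 ^ m < n
  2^m<n = ℕₚ.≰⇒> λ n≤ → subst T eq (ℕₚ.≤⇒≤ᵇ (subst (n ≤_) (sym (length-hadamard m)) n≤))
  m≡k : n ≤ 2 ^ m ⊎ m ≡ k → m ≡ k
  m≡k (inj₁ n≤) = ⊥-elim (ℕₚ.<⇒≱ 2^m<n n≤)
  m≡k (inj₂ eq) = eq

rows-poly : PolyTime Env (list (list bool)) rows
rows-poly = foldl-poly-inv {Γ = Env} {A = list bool} {B = list (list bool)}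
  (fst-poly ∙ fst-poly) (cons-poly (cons-poly true-poly nil-poly) nil-poly)
  (if-poly (≤ᵇ-poly (length-poly (fst-poly ∙ fst-poly ∙ fst-poly ∙ fst-poly)) (length-poly snd-poly)) snd-poly
      (double-poly snd-poly))
  bound record
    { I     = λ e k H → Doubled (length (matrix e)) k H
    ; start = λ e → doubled-start (length (matrix e))
    ; step  = λ e k _ → doubled-step (length (matrix e)) k
    ; small = λ e k _ → hadamard-size e
    }
  where
  bound : Pol
  bound = (K 1 ⊕ K 2 ⊛ 𝑛) ⊛ (K 1 ⊕ ((K 1 ⊕ K 2 ⊛ 𝑛) ⊛ K 4 ⊕ K 1)) ⊕ K 1

  hadamard-size : ∀ e {k H} → Doubled (length (matrix e)) k H →
      size (enc (list (list bool)) H) ≤ ⟪ bound ⟫ (size (enc Env e))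
  hadamard-size e@((A , s) , N) (m , refl , le , _) =
    ℕₚ.≤-trans (list-size {A = list bool} (All.map (λ {h} w → ℕₚ.≤-trans
        (list-size {A = bool} {M = 3} {l = h} (All.tabulate λ _ → bool-size _))
        (ℕₚ.+-monoˡ-≤ 1 (ℕₚ.*-monoˡ-≤ 4 (ℕₚ.≤-trans (ℕₚ.≤-reflexive w) 2^m≤)))) (hadamard-widths m)))
      (ℕₚ.+-monoˡ-≤ 1 (ℕₚ.*-monoˡ-≤ _ (ℕₚ.≤-trans (ℕₚ.≤-reflexive (length-hadamard m)) 2^m≤)))
    where
    2^m≤ : 2 ^ m ≤ suc (2 * size (enc Env e))
    2^m≤ = ℕₚ.≤-trans le (s≤s (ℕₚ.*-monoʳ-≤ 2 (ℕₚ.≤-trans (length≤size {A = list bool} A)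
      (ℕₚ.m≤n⇒m≤1+n (ℕₚ.≤-trans (ℕₚ.m≤n⇒m≤1+n (ℕₚ.m≤m+n _ _)) (ℕₚ.m≤m+n _ _))))))

strategies-poly : PolyTime Env (list (list nat)) strategies
strategies-poly = concat-poly (map-poly (++-poly rows-poly
    (map-poly rows-poly (map-poly snd-poly (not-poly snd-poly))))
  (map-poly modes-poly (picks-poly (pair-poly (fst-poly ∙ fst-poly) (pair-poly snd-poly (snd-poly ∙ fst-poly))))))
  where
  modes-poly : PolyTime Γ (list (bool ⊗ bool)) (λ _ → modes)
  modes-poly = cons-poly (pair-poly true-poly true-poly) (cons-poly (pair-poly true-poly false-poly)
    (cons-poly (pair-poly false-poly true-poly) (cons-poly (pair-poly false-poly false-poly) nil-poly)))

best-poly : PolyTime Env (list nat) best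
best-poly = foldl-poly {Γ = Env} {A = list nat} {B = list nat} strategies-poly nil-poly
  (if-poly (≤ᵇ-poly (value-poly (fst-poly ∙ fst-poly) snd-poly)
      (value-poly (fst-poly ∙ fst-poly) (snd-poly ∙ fst-poly)))
    (snd-poly ∙ fst-poly) snd-poly) 𝑛 growth
  where
  growth : Grows {Env} {list nat} {list nat} (λ γ → let ((e , us) , b) = γ in ifᵇ value e b ≤ᵇ value e us then us else b) 𝑛
  growth e us b with value e b ≤ᵇ value e us
  ... | true  = ℕₚ.≤-trans (ℕₚ.m≤n⇒m≤1+n (ℕₚ.m≤n+m _ (size (enc Env e)))) (ℕₚ.m≤m+n _ _)
  ... | false = ℕₚ.m≤n+m _ _

solve-poly : PolyTime Input (list nat) solve
solve-poly = reverse-poly (best-poly ∙ pair-poly fst-poly (map-poly (fst-poly ∙ snd-poly) (nonzero-poly ∙ snd-poly)))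
  where
  nonzero-poly : PolyTime raw bool nonzero
  nonzero-poly .prog X = if tlᵉ (hdᵉ (var X)) then X ≔ consᵉ nilᵉ nilᵉ else (X ≔ nilᵉ)
  nonzero-poly .time = K 4 ⊕ (K 4 ⊕ K 2)
  nonzero-poly .grow = K 3
  nonzero-poly .bounded d = bool-size (nonzero d)
  nonzero-poly .runs X σ d eq with tail (head (σ X)) in eq′
  ... | nil = if-false-runs {b = 4} eq′ (assign-runs
        ( trans (update-≡ σ X _) (cong (λ t → encodeBool (isCons t)) (trans (sym eq′) (cong (tail ∘ head) eq)))
        , update-< σ X _))
  ... | cons _ _ = if-true-runs {b = 4} (λ n → cons≢nil (trans (sym eq′) n)) (assign-runs
        ( trans (update-≡ σ X _) (cong (λ t → encodeBool (isCons t)) (trans (sym eq′) (cong (tail ∘ head) eq)))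
        , update-< σ X _))

-- Sums over lists and Hadamard matrices

private variable
  S R : Set

total : (S → ℕ) → List S → ℕ
total f []      = 0
total f (a ∷ l) = f a + total f l

total-++ : ∀ (f : S → ℕ) xs ys → total f (xs ++ ys) ≡ total f xs + total f ys
total-++ f []       ys = refl
total-++ f (x ∷ xs) ys = trans (cong (f x +_) (total-++ f xs ys)) (sym (ℕₚ.+-assoc (f x) _ _))

total-map : ∀ (f : R → ℕ) (g : S → R) xs → total f (map g xs) ≡ total (f ∘ g) xs
total-map f g []       = refl
total-map f g (x ∷ xs) = cong (f (g x) +_) (total-map f g xs)

total-mono : ∀ {f g : S → ℕ} {xs} → All (λ x → f x ≤ g x) xs → total f xs ≤ total g xs
total-mono []         = z≤n
total-mono (le ∷ les) = ℕₚ.+-mono-≤ le (total-mono les)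

total-cong : ∀ {f g : S → ℕ} {xs} → All (λ x → f x ≡ g x) xs → total f xs ≡ total g xs
total-cong []         = refl
total-cong (eq ∷ eqs) = cong₂ _+_ eq (total-cong eqs)

total-+ : ∀ (f g : S → ℕ) xs → total (λ x → f x + g x) xs ≡ total f xs + total g xs
total-+ f g []       = refl
total-+ f g (x ∷ xs) = trans (cong (f x + g x +_) (total-+ f g xs))
    (interchange (f x) (g x) (total f xs) (total g xs))
  where
  interchange : ∀ a b c d → (a + b) + (c + d) ≡ (a + c) + (b + d)
  interchange = solve-∀

total-const : ∀ k (xs : List S) → total (λ _ → k) xs ≡ length xs * k
total-const k []       = refl
total-const k (x ∷ xs) = cong (k +_) (total-const k xs)

total-* : ∀ k (f : S → ℕ) xs → total (λ x → k * f x) xs ≡ k * total f xs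
total-* k f []       = sym (ℕₚ.*-zeroʳ k)
total-* k f (x ∷ xs) = trans (cong (k * f x +_) (total-* k f xs)) (sym (ℕₚ.*-distribˡ-+ k (f x) _))

total-swap : ∀ (f : S → R → ℕ) xs ys →
  total (λ x → total (f x) ys) xs ≡ total (λ y → total (λ x → f x y) xs) ys
total-swap f []       ys = sym (trans (total-const 0 ys) (ℕₚ.*-zeroʳ (length ys)))
total-swap f (x ∷ xs) ys = trans (cong (total (f x) ys +_) (total-swap f xs ys))
  (sym (total-+ (f x) (λ y → total (λ x → f x y) xs) ys))

-- With the constant weight 1 this is the pigeonhole principle.
total-⊆ : ∀ (f : S → ℕ) {xs ys} → Unique xs → (∀ {x} → x ∈ xs → x ∈ ys) → total f xs ≤ total f ys
total-⊆ f []           ⊆ys = z≤n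
total-⊆ f {x ∷ xs} (x∉ ∷ uniq) ⊆ys with ∈-∃++ (⊆ys (here refl))
... | as , bs , refl = ℕₚ.≤-trans (ℕₚ.+-monoʳ-≤ (f x) (total-⊆ f uniq rest))
        (ℕₚ.≤-reflexive (begin
          f x + total f (as ++ bs)          ≡⟨ cong (f x +_) (total-++ f as bs) ⟩
          f x + (total f as + total f bs)   ≡⟨ exchange (f x) (total f as) (total f bs) ⟩
          total f as + (f x + total f bs)   ≡⟨ sym (total-++ f as (x ∷ bs)) ⟩
          total f (as ++ x ∷ bs)            ∎))
  where
  open ≡-Reasoning
  exchange : ∀ a b c → a + (b + c) ≡ b + (a + c)
  exchange = solve-∀
  rest : ∀ {y} → y ∈ xs → y ∈ as ++ bs
  rest {y} y∈ with ∈-++⁻ as (⊆ys (there y∈))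
  ... | inj₁ y∈as         = ∈-++⁺ˡ y∈as
  ... | inj₂ (here refl)  = ⊥-elim (All.lookup x∉ y∈ refl)
  ... | inj₂ (there y∈bs) = ∈-++⁺ʳ as y∈bs

𝟙 : Bool → ℕ
𝟙 false = 0
𝟙 true  = 1

length-filterᵇ : ∀ (p : S → Bool) xs → length (filterᵇ p xs) ≡ total (𝟙 ∘ p) xs
length-filterᵇ p []       = refl
length-filterᵇ p (x ∷ xs) with p x
... | true  = cong suc (length-filterᵇ p xs)
... | false = length-filterᵇ p xs

bit : List Bool → ℕ → Bool
bit = nth false

bit-++ˡ : ∀ g h i → i < length g → bit (g ++ h) i ≡ bit g i
bit-++ˡ (b ∷ g) h zero    _        = refl
bit-++ˡ (b ∷ g) h (suc i) (s≤s i<) = bit-++ˡ g h i i<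

bit-++ʳ : ∀ g h i → bit (g ++ h) (length g + i) ≡ bit h i
bit-++ʳ []      h i = refl
bit-++ʳ (b ∷ g) h i = bit-++ʳ g h i

bit-not : ∀ h i → i < length h → bit (map not h) i ≡ not (bit h i)
bit-not (b ∷ h) zero    _        = refl
bit-not (b ∷ h) (suc i) (s≤s i<) = bit-not h i i<

𝟙-not : ∀ b → 𝟙 b + 𝟙 (not b) ≡ 1
𝟙-not false = refl
𝟙-not true  = refl

differ : ℕ → ℕ → List Bool → Bool
differ i j h = bit h i xor bit h j

differ-sym : ∀ i j h → differ i j h ≡ differ j i h
differ-sym i j h = Boolₚ.xor-comm (bit h i) (bit h j)

total-double : ∀ (f : List Bool → ℕ) H →
  total f (double H) ≡ total (λ h → f (h ++ h) + f (h ++ map not h)) H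
total-double f H = trans (total-++ f (map (λ h → h ++ h) H) _)
  (trans (cong₂ _+_ (total-map f (λ h → h ++ h) H) (total-map f (λ h → h ++ map not h) H))
    (sym (total-+ (λ h → f (h ++ h)) (λ h → f (h ++ map not h)) H)))

xor-not-not : ∀ a b → (not a xor not b) ≡ (a xor b)
xor-not-not false b = Boolₚ.not-involutive b
xor-not-not true  b = refl

xor-notʳ : ∀ a b → (a xor not b) ≡ not (a xor b)
xor-notʳ false b = refl
xor-notʳ true  b = refl

-- Orthogonality of columns `i` and `j`. Together with the complemented rows it makes the bits of
-- two layers independent.
Half : ℕ → ℕ → ℕ → Set
Half m i j = 2 * total (𝟙 ∘ differ i j) (hadamard m) ≡ 2 ^ m

split : ∀ m i → i < 2 ^ suc m → i < 2 ^ m ⊎ ∃[ i′ ] i ≡ 2 ^ m + i′ × i′ < 2 ^ m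
split m i i< with i ℕₚ.<? 2 ^ m
... | yes i<′ = inj₁ i<′
... | no  i≮  = inj₂ (i ∸ 2 ^ m , sym (ℕₚ.m+[n∸m]≡n (ℕₚ.≮⇒≥ i≮)) ,
    ℕₚ.+-cancelˡ-< (2 ^ m) _ _ (subst (_< 2 ^ m + 2 ^ m) (sym (ℕₚ.m+[n∸m]≡n (ℕₚ.≮⇒≥ i≮)))
      (subst (λ k → i < 2 ^ m + k) (ℕₚ.+-identityʳ (2 ^ m)) i<)))

twice : ℕ → ℕ → List Bool → ℕ
twice i j h = 𝟙 (differ i j (h ++ h)) + 𝟙 (differ i j (h ++ map not h))

double-half : ∀ m i j (f : List Bool → ℕ) →
  (∀ h → length h ≡ 2 ^ m → twice i j h ≡ f h) → total f (hadamard m) ≡ 2 ^ m →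
  Half (suc m) i j
double-half m i j f twice≡f sum = cong (2 *_) (trans (total-double (𝟙 ∘ differ i j) (hadamard m))
  (trans (total-cong (All.map (λ {h} → twice≡f h) (hadamard-widths m))) sum))

module _ m (h g : List Bool) (w : length h ≡ 2 ^ m) where
  bit-low : ∀ {i} → i < 2 ^ m → bit (h ++ g) i ≡ bit h i
  bit-low {i} i< = bit-++ˡ h g i (subst (i <_) (sym w) i<)

  bit-high : ∀ k → bit (h ++ g) (2 ^ m + k) ≡ bit g k
  bit-high k = subst (λ l → bit (h ++ g) (l + k) ≡ bit g k) w (bit-++ʳ h g k)

-- Complementing the right half toggles whether the two columns differ, so exactly one of the two
-- rows made from each `h` counts, even when `i` equals `j`.
half-differ-mixed : ∀ m i j → i < 2 ^ m → j < 2 ^ m → Half (suc m) i (2 ^ m + j)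
half-differ-mixed m i j i< j< = double-half m i (2 ^ m + j) (λ _ → 1) one
  (trans (total-const 1 (hadamard m)) (trans (ℕₚ.*-identityʳ _) (length-hadamard m)))
  where
  one : ∀ h → length h ≡ 2 ^ m → twice i (2 ^ m + j) h ≡ 1
  one h w rewrite bit-low m h h w i< | bit-low m h (map not h) w i<
    | bit-high m h h w j | bit-high m h (map not h) w j | bit-not h j (subst (j <_) (sym w) j<)
    | xor-notʳ (bit h i) (bit h j) = 𝟙-not (differ i j h)

-- Columns in the same half compare in both new rows as they did in `h`, because complementing both
-- entries changes nothing; so the induction hypothesis is simply doubled.
half-differ : ∀ m {i j} → i < 2 ^ m → j < 2 ^ m → i ≢ j → Half m i j
half-differ zero    (s≤s z≤n) (s≤s z≤n) i≢j = ⊥-elim (i≢j refl)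
half-differ (suc m) {i} {j} i< j< i≢j with split m i i< | split m j j<
... | inj₁ i<′ | inj₁ j<′ = double-half m i j (λ h → 2 * 𝟙 (differ i j h)) same
    (trans (total-* 2 (𝟙 ∘ differ i j) (hadamard m)) (half-differ m i<′ j<′ i≢j))
  where
  same : ∀ h → length h ≡ 2 ^ m → twice i j h ≡ 2 * 𝟙 (differ i j h)
  same h w rewrite bit-low m h h w i<′ | bit-low m h h w j<′
    | bit-low m h (map not h) w i<′ | bit-low m h (map not h) w j<′ =
    cong (𝟙 (differ i j h) +_) (sym (ℕₚ.+-identityʳ _))
... | inj₂ (i′ , refl , i′<) | inj₂ (j′ , refl , j′<) =
  double-half m (2 ^ m + i′) (2 ^ m + j′) (λ h → 2 * 𝟙 (differ i′ j′ h)) same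
    (trans (total-* 2 (𝟙 ∘ differ i′ j′) (hadamard m))
      (half-differ m i′< j′< (λ eq → i≢j (cong (2 ^ m +_) eq))))
  where
  same : ∀ h → length h ≡ 2 ^ m → twice (2 ^ m + i′) (2 ^ m + j′) h ≡ 2 * 𝟙 (differ i′ j′ h)
  same h w rewrite bit-high m h h w i′ | bit-high m h h w j′
    | bit-high m h (map not h) w i′ | bit-high m h (map not h) w j′
    | bit-not h i′ (subst (i′ <_) (sym w) i′<) | bit-not h j′ (subst (j′ <_) (sym w) j′<)
    | xor-not-not (bit h i′) (bit h j′) = cong (𝟙 (differ i′ j′ h) +_) (sym (ℕₚ.+-identityʳ _))
... | inj₁ i<′ | inj₂ (j′ , refl , j′<) = half-differ-mixed m i j′ i<′ j′<
... | inj₂ (i′ , refl , i′<) | inj₁ j<′ = trans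
  (cong (2 *_) (total-cong (All.universal (λ h → cong 𝟙 (differ-sym (2 ^ m + i′) j h)) (hadamard (suc m)))))
  (half-differ-mixed m j i′ j<′ i′<)

-- The sign `κ` will record whether the two vertices have the same or opposite positions in the
-- lists of their layers.
half-agree : ∀ m {i j} → i < 2 ^ m → j < 2 ^ m → i ≢ j → ∀ κ →
  2 * total (λ h → 𝟙 (κ xor differ i j h)) (hadamard m) ≡ 2 ^ m
half-agree m i< j< i≢j false = half-differ m i< j< i≢j
half-agree m {i} {j} i< j< i≢j true = ℕₚ.+-cancelˡ-≡ (2 ^ m) _ _ (begin
  2 ^ m + 2 * agree                  ≡⟨ cong (_+ 2 * agree) (sym (half-differ m i< j< i≢j)) ⟩
  2 * total (𝟙 ∘ differ i j) H + 2 * agree ≡⟨ sym (ℕₚ.*-distribˡ-+ 2 (total (𝟙 ∘ differ i j) H) agree) ⟩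
  2 * (total (𝟙 ∘ differ i j) H + agree) ≡⟨ cong (2 *_) (sym (total-+ (𝟙 ∘ differ i j) _ H)) ⟩
  2 * total (λ h → 𝟙 (differ i j h) + 𝟙 (not (differ i j h))) H
    ≡⟨ cong (2 *_) (total-cong (All.universal (λ h → 𝟙-not (differ i j h)) H)) ⟩
  2 * total (λ _ → 1) H              ≡⟨ cong (2 *_)
      (trans (total-const 1 H) (trans (ℕₚ.*-identityʳ _) (length-hadamard m))) ⟩
  2 * 2 ^ m                          ≡⟨ cong (2 ^ m +_) (ℕₚ.+-identityʳ _) ⟩
  2 ^ m + 2 ^ m                      ∎)
  where
  open ≡-Reasoning
  H = hadamard m
  agree = total (λ h → 𝟙 (not (differ i j h))) H

-- Paths and layers of a tree

¬true⇒false : ∀ {b} → b ≢ true → b ≡ false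
¬true⇒false {false} _ = refl
¬true⇒false {true}  n = ⊥-elim (n refl)

T⇒≡ : ∀ {b} → T b → b ≡ true
T⇒≡ {true} _ = refl

≡⇒T : ∀ {b} → b ≡ true → T b
≡⇒T refl = tt

∧-true : ∀ {a b} → a ∧ b ≡ true → a ≡ true × b ≡ true
∧-true {true} eq = refl , eq

any⁺ : ∀ (f : S → Bool) {a l} → a ∈ l → f a ≡ true → any f l ≡ true
any⁺ f (here refl) eq rewrite eq = refl
any⁺ f {l = b ∷ _} (there a∈) eq with f b
... | true  = refl
... | false = any⁺ f a∈ eq

any⁻ : ∀ (f : S → Bool) l → any f l ≡ true → ∃[ a ] a ∈ l × f a ≡ true
any⁻ f (b ∷ l) eq with f b in fb
... | true  = b , here refl , fb
... | false = let a , a∈ , fa = any⁻ f l eq in a , there a∈ , fa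

≡ᵇ-refl : ∀ u → (u ≡ᵇ u) ≡ true
≡ᵇ-refl u = T⇒≡ (ℕₚ.≡⇒≡ᵇ u u refl)

∈ᵇ⁺ : ∀ {u us} → u ∈ us → (u ∈ᵇ us) ≡ true
∈ᵇ⁺ {u} u∈ = any⁺ (u ≡ᵇ_) u∈ (≡ᵇ-refl u)

∈ᵇ⁻ : ∀ {u us} → (u ∈ᵇ us) ≡ true → u ∈ us
∈ᵇ⁻ {u} {us} eq = let w , w∈ , u≡w = any⁻ (u ≡ᵇ_) us eq in
  subst (_∈ us) (sym (ℕₚ.≡ᵇ⇒≡ u w (≡⇒T u≡w))) w∈

nth-map-allFin : ∀ {n} d (f : Fin n → S) i → nth d (map f (allFin n)) (toℕ i) ≡ f i
nth-map-allFin d f i = trans (cong (λ l → nth d l (toℕ i)) (Listₚ.map-tabulate id f)) (nth-tabulate d f i)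
  where
  nth-tabulate : ∀ {n} d (f : Fin n → S) i → nth d (tabulate f) (toℕ i) ≡ f i
  nth-tabulate d f zero    = refl
  nth-tabulate d f (suc i) = nth-tabulate d (f ∘ suc) i

unique-++ˡ : ∀ (xs : List S) {ys} → Unique (xs ++ ys) → Unique xs
unique-++ˡ []       _             = []
unique-++ˡ (x ∷ xs) (x∉ ∷ uniq) = Allₚ.++⁻ˡ xs x∉ ∷ unique-++ˡ xs uniq

unique-∷ʳ⁻ : ∀ (xs : List S) {x} → Unique (xs ∷ʳ x) → x ∉ xs
unique-∷ʳ⁻ (y ∷ xs) (y∉ ∷ _)    (here refl) = All.lookup y∉ (∈-++⁺ʳ xs (here refl)) refl
unique-∷ʳ⁻ (y ∷ xs) (_ ∷ uniq) (there x∈)  = unique-∷ʳ⁻ xs uniq x∈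

unique-∷ʳ⁺ : ∀ {xs : List S} {x} → Unique xs → x ∉ xs → Unique (xs ∷ʳ x)
unique-∷ʳ⁺ uniq x∉ = Uniqueₚ.++⁺ uniq ([] ∷ []) λ { (x∈ , here refl) → x∉ x∈ }

index-< : ∀ {x : S} xs {ys} (x∈ : x ∈ xs ++ ys) → toℕ (Any.index x∈) < length xs → x ∈ xs
index-< (y ∷ xs) (here refl) _         = here refl
index-< (y ∷ xs) (there x∈)  (s≤s i<) = there (index-< xs x∈ i<)

module Tree (𝒯 : RootedTree) where
  open RootedTree 𝒯 public

  V : Set
  V = Vertex

  path : V → List V
  path v = vertices (pathTo v)

  path-unique : ∀ v → Unique (path v)
  path-unique v = proj₁ (proj₂ (isTree source v))

  length-vertices : ∀ {a v} (p : Walk a v) → length (vertices p) ≡ suc (edgeCount p)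
  length-vertices stop       = refl
  length-vertices (step _ p) = cong suc (length-vertices p)

  same-vertices : ∀ {v} (q : Walk source v) → IsPath q → vertices q ≡ path v
  same-vertices {v} = proj₂ (proj₂ (isTree source v))

  same-length : ∀ {v} (q : Walk source v) → IsPath q → edgeCount q ≡ dist v
  same-length {v} q isP = ℕₚ.suc-injective (trans (sym (length-vertices q))
    (trans (cong length (same-vertices q isP)) (length-vertices (pathTo v))))

  snoc : ∀ {a u w} → Walk a u → T (adj u w) → Walk a w
  snoc stop       e = step e stop
  snoc (step f p) e = step f (snoc p e)

  vertices-snoc : ∀ {a u w} (p : Walk a u) (e : T (adj u w)) → vertices (snoc p e) ≡ vertices p ∷ʳ w
  vertices-snoc stop       e = refl
  vertices-snoc {a} (step f p) e = cong (a ∷_) (vertices-snoc p e)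

  unsnoc : ∀ {a w j} (p : Walk a w) → edgeCount p ≡ suc j →
    ∃[ u ] Σ[ q ∈ Walk a u ] T (adj u w) × vertices p ≡ vertices q ∷ʳ w
  unsnoc {a} (step e stop) _ = a , stop , e , refl
  unsnoc {a} (step e p@(step _ _)) _ = let u , q , f , eq = unsnoc p refl in
    u , step e q , f , cong (a ∷_) eq

  prefix : ∀ {a v u} (p : Walk a v) (u∈ : u ∈ vertices p) →
    Σ[ q ∈ Walk a u ] ∃[ rest ] vertices p ≡ vertices q ++ rest × edgeCount q ≡ toℕ (Any.index u∈)
  prefix stop       (here refl) = stop , [] , refl , refl
  prefix (step e p) (here refl) = stop , vertices p , refl , refl
  prefix {a} (step e p) (there u∈) = let q , rest , eq , c = prefix p u∈ in
    step e q , rest , cong (a ∷_) eq , cong suc c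

  -- The initial segment up to `u` is a path, hence by uniqueness the path to `u`. So the position
  -- of `u` on any path through it is its depth, which is the index that `Saved` refers to.
  path-prefix : ∀ {u v} (u∈ : u ∈ path v) →
    (∃[ rest ] path v ≡ path u ++ rest) × dist u ≡ toℕ (Any.index u∈)
  path-prefix {u} {v} u∈ with prefix (pathTo v) u∈
  ... | q , rest , eq , c =
    let isP = unique-++ˡ (vertices q) (subst Unique eq (path-unique v)) in
    (rest , trans eq (cong (_++ rest) (same-vertices q isP))) , trans (sym (same-length q isP)) c

  target-∈ : ∀ {a v} (p : Walk a v) → v ∈ vertices p
  target-∈ stop       = here refl
  target-∈ (step _ p) = there (target-∈ p)

  self-∈ : ∀ v → v ∈ path v
  self-∈ v = target-∈ (pathTo v)

  path-trans : ∀ {a u v} → a ∈ path u → u ∈ path v → a ∈ path v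
  path-trans a∈ u∈ = let (rest , eq) , _ = path-prefix u∈ in subst (_ ∈_) (sym eq) (∈-++⁺ˡ a∈)

  dist-≤ : ∀ {u v} → u ∈ path v → dist u ≤ dist v
  dist-≤ {u} {v} u∈ = let _ , eq = path-prefix u∈ in ℕₚ.≤-pred
    (subst (suc (dist u) ≤_) (length-vertices (pathTo v))
        (subst (λ k → suc k ≤ length (path v)) (sym eq) (Finₚ.toℕ<n (Any.index u∈))))

  dist-≡ : ∀ {u v} → u ∈ path v → dist u ≡ dist v → u ≡ v
  dist-≡ {u} {v} u∈ eq =
    trans (Anyₚ.lookup-index u∈) (trans (cong (lookup (path v)) (Finₚ.toℕ-injective
      (trans (sym (proj₂ (path-prefix u∈))) (trans eq (proj₂ (path-prefix (self-∈ v)))))))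
      (sym (Anyₚ.lookup-index (self-∈ v))))

  dist-< : ∀ {u v} → u ∈ path v → u ≢ v → dist u < dist v
  dist-< u∈ u≢v = ℕₚ.≤∧≢⇒< (dist-≤ u∈) (u≢v ∘ dist-≡ u∈)

  path-linear : ∀ {a b v} → a ∈ path v → b ∈ path v → dist a ≤ dist b → a ∈ path b
  path-linear {a} {b} {v} a∈ b∈ le with path-prefix b∈
  ... | (rest , eq) , _ = index-< (path b) a∈′ (subst (toℕ (Any.index a∈′) <_) (sym (length-vertices (pathTo b)))
          (s≤s (ℕₚ.≤-trans (ℕₚ.≤-reflexive (index-eq a∈ eq)) le)))
    where
    a∈′ = subst (a ∈_) eq a∈
    index-eq : ∀ {l} (a∈ : a ∈ path v) (eq : path v ≡ l) → toℕ (Any.index (subst (a ∈_) eq a∈)) ≡ dist a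
    index-eq a∈ refl = sym (proj₂ (path-prefix a∈))

  unique-length : ∀ {l : List V} → Unique l → length l ≤ order
  unique-length {l} uniq = subst₂ _≤_
    (trans (total-const 1 l) (ℕₚ.*-identityʳ _))
    (trans (total-const 1 (allFin order)) (trans (ℕₚ.*-identityʳ _) (Listₚ.length-tabulate {n = order} id)))
    (total-⊆ (λ _ → 1) uniq (λ {v} _ → ∈-allFin v))

  dist-<-order : ∀ v → dist v < order
  dist-<-order v = subst (_≤ order) (length-vertices (pathTo v)) (unique-length (path-unique v))

  source-path : path source ≡ source ∷ []
  source-path = sym (same-vertices stop ([] ∷ []))

  dist-source : dist source ≡ 0
  dist-source = sym (same-length stop ([] ∷ []))

  source-∈ : ∀ v → source ∈ path v
  source-∈ v = go (pathTo v)
    where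
    go : ∀ {a v} (p : Walk a v) → a ∈ vertices p
    go stop       = here refl
    go (step _ _) = here refl

  dist-0 : ∀ {v} → dist v ≡ 0 → v ≡ source
  dist-0 {v} eq = sym (dist-≡ (source-∈ v) (trans dist-source (sym eq)))

  ℓpath : V → List ℕ
  ℓpath v = map toℕ (reverse (path v))

  ∈-ℓpath⁺ : ∀ {u v} → u ∈ path v → toℕ u ∈ ℓpath v
  ∈-ℓpath⁺ u∈ = ∈-map⁺ toℕ (Anyₚ.reverse⁺ u∈)

  ∈-ℓpath⁻ : ∀ {k v} → k ∈ ℓpath v → ∃[ u ] k ≡ toℕ u × u ∈ path v
  ∈-ℓpath⁻ k∈ = let u , u∈ , eq = ∈-map⁻ toℕ k∈ in u , eq , Anyₚ.reverse⁻ u∈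

  path-last : ∀ v → ∃[ us ] path v ≡ us ∷ʳ v
  path-last v = go (pathTo v)
    where
    go : ∀ {a v} (p : Walk a v) → ∃[ us ] vertices p ≡ us ∷ʳ v
    go stop       = [] , refl
    go {a} (step _ p) = let us , eq = go p in a ∷ us , cong (a ∷_) eq

  ℓpath-∷ʳ : ∀ {v us} → path v ≡ us ∷ʳ v → ℓpath v ≡ toℕ v ∷ map toℕ (reverse us)
  ℓpath-∷ʳ {v} {us} eq = trans (cong (map toℕ ∘ reverse) eq) (cong (map toℕ) (Listₚ.reverse-++ us (v ∷ [])))

  endpoint-ℓpath : ∀ v → endpoint (ℓpath v) ≡ toℕ v
  endpoint-ℓpath v = cong endpoint (ℓpath-∷ʳ (proj₂ (path-last v)))

  strict⁺ : ∀ {u v} → u ∈ path v → u ≢ v → toℕ u ∈ drop 1 (ℓpath v)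
  strict⁺ {u} {v} u∈ u≢v with path-last v
  ... | us , eq rewrite ℓpath-∷ʳ eq with ∈-++⁻ us (subst (u ∈_) eq u∈)
  ...   | inj₁ u∈us        = ∈-map⁺ toℕ (Anyₚ.reverse⁺ u∈us)
  ...   | inj₂ (here refl) = ⊥-elim (u≢v refl)

  strict⁻ : ∀ {k v} → k ∈ drop 1 (ℓpath v) → ∃[ u ] k ≡ toℕ u × u ∈ path v × u ≢ v
  strict⁻ {k} {v} k∈ with path-last v
  ... | us , eq rewrite ℓpath-∷ʳ eq with ∈-map⁻ toℕ k∈
  ...   | u , u∈ , refl = let u∈us = Anyₚ.reverse⁻ u∈ in
          u , refl , subst (u ∈_) (sym eq) (∈-++⁺ˡ u∈us) ,
          λ { refl → unique-∷ʳ⁻ us (subst Unique eq (path-unique v)) u∈us }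

  path-extend : ∀ {u w} → T (adj u w) → w ∉ path u → path w ≡ path u ∷ʳ w
  path-extend {u} {w} e w∉ = trans (sym (same-vertices (snoc (pathTo u) e)
      (subst Unique (sym (vertices-snoc (pathTo u) e)) (unique-∷ʳ⁺ (path-unique u) w∉))))
    (vertices-snoc (pathTo u) e)

  dist-extend : ∀ {u w} → path w ≡ path u ∷ʳ w → dist w ≡ suc (dist u)
  dist-extend {u} {w} eq = ℕₚ.suc-injective (trans (sym (length-vertices (pathTo w)))
    (trans (cong length eq) (trans (Listₚ.length-++ (path u))
        (trans (ℕₚ.+-comm _ 1) (cong suc (length-vertices (pathTo u)))))))

  ℓpath-extend : ∀ {u w} → path w ≡ path u ∷ʳ w → ℓpath w ≡ toℕ w ∷ ℓpath u
  ℓpath-extend = ℓpath-∷ʳ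

  parent : ∀ {w j} → dist w ≡ suc j →
    ∃[ u ] T (adj u w) × w ∉ path u × path w ≡ path u ∷ʳ w
  parent {w} eq with unsnoc (pathTo w) eq
  ... | u , q , e , eq′ =
    let uniq = subst Unique eq′ (path-unique w)
        q≡ = same-vertices q (unique-++ˡ (vertices q) uniq)
    in u , e , subst (w ∉_) q≡ (unique-∷ʳ⁻ (vertices q) uniq) , trans eq′ (cong (_∷ʳ w) q≡)

  -- Reversed to match `downFrom`, the order in which the program runs through the vertices; its
  -- lists can then be identified by equality rather than up to permutation.
  vs : List V
  vs = reverse (allFin order)

  ∈-vs : ∀ v → v ∈ vs
  ∈-vs v = Anyₚ.reverse⁺ (∈-allFin v)

  map-toℕ-vs : map toℕ vs ≡ downFrom order
  map-toℕ-vs = trans (Listₚ.reverse-map toℕ (allFin order))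
      (trans (cong reverse (trans (Listₚ.map-tabulate id toℕ) (tabulate-toℕ order id))) (Listₚ.reverse-upTo order))
    where
    tabulate-toℕ : ∀ n (f : ℕ → ℕ) → tabulate {n = n} (f ∘ toℕ) ≡ applyUpTo f n
    tabulate-toℕ zero    f = refl
    tabulate-toℕ (suc n) f = cong (f 0 ∷_) (tabulate-toℕ n (f ∘ suc))

  layer : ℕ → List V
  layer zero    = source ∷ []
  layer (suc j) = filter (Layer? (suc j)) vs

  layer-dist : ∀ j {v} → v ∈ layer j → dist v ≡ j
  layer-dist zero    (here refl) = dist-source
  layer-dist (suc j) v∈          = proj₂ (∈-filter⁻ (Layer? (suc j)) {xs = vs} v∈)

  ∈-layer : ∀ j {v} → dist v ≡ j → v ∈ layer j
  ∈-layer zero    eq rewrite dist-0 eq = here refl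
  ∈-layer (suc j) eq = ∈-filter⁺ (Layer? (suc j)) (∈-vs _) eq

  Lv : ℕ → List (List ℕ)
  Lv j = map ℓpath (layer j)

  -- The search computes the layers of the tree

  module Levels (N : List Bool) where
    env : ⟦ Env ⟧
    env = (map (λ u → map (adj u) (allFin order)) (allFin order) , toℕ source) , N

    adjacent-env : ∀ u w → adjacent env (toℕ u) (toℕ w) ≡ adj u w
    adjacent-env u w = trans (cong (λ l → nth false l (toℕ w))
        (nth-map-allFin [] (λ u → map (adj u) (allFin order)) u))
      (nth-map-allFin false (adj u) w)

    extends⁺ : ∀ u w → T (adj u w) → w ∉ path u → extends env (toℕ w) (ℓpath u) ≡ true
    extends⁺ u w e w∉ = cong₂ _∧_
      (trans (cong (λ k → adjacent env k (toℕ w)) (endpoint-ℓpath u)) (trans (adjacent-env u w) (T⇒≡ e)))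
      (cong not (¬true⇒false λ eq → let u′ , eq′ , u′∈ = ∈-ℓpath⁻ (∈ᵇ⁻ {toℕ w} {ℓpath u} eq) in
        w∉ (subst (_∈ path u) (sym (Finₚ.toℕ-injective eq′)) u′∈)))

    extends⁻ : ∀ u w → extends env (toℕ w) (ℓpath u) ≡ true → path w ≡ path u ∷ʳ w
    extends⁻ u w eq with ∧-true {adjacent env (endpoint (ℓpath u)) (toℕ w)} eq
    ... | e , w∉ = path-extend
      (≡⇒T (trans (sym (adjacent-env u w)) (trans (cong (λ k → adjacent env k (toℕ w)) (sym (endpoint-ℓpath u))) e)))
      (λ w∈ → true≢false (trans (sym w∉) (cong not (∈ᵇ⁺ (∈-ℓpath⁺ w∈)))))
      where
      true≢false : true ≢ false
      true≢false ()

    -- Any successful extension yields a path to `w`, hence the path to `w`. The other alternative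
    -- says that no vertex of `us` is the parent of `w`; applied to a whole layer, it keeps `w` out
    -- of the next one.
    extendTo-layer : ∀ j w us → (∀ {u} → u ∈ us → dist u ≡ j) →
      (extendTo env (toℕ w) (map ℓpath us) ≡ [] × (∀ {u} → u ∈ us → path w ≢ path u ∷ʳ w)) ⊎
      (extendTo env (toℕ w) (map ℓpath us) ≡ ℓpath w × dist w ≡ suc j)
    extendTo-layer j w [] d = inj₁ (refl , λ ())
    extendTo-layer j w (u ∷ us) d with extends env (toℕ w) (ℓpath u) in eq
    ... | true = let eq′ = extends⁻ u w eq in
      inj₂ (sym (ℓpath-extend eq′) , trans (dist-extend eq′) (cong suc (d (here refl))))
    ... | false with extendTo-layer j w us (d ∘ there)
    ...   | inj₂ found = inj₂ found
    ...   | inj₁ (none , ¬ext) = inj₁ (none , λ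
      { (here refl) eq′ → false≢true (trans (sym eq) (extends⁺ u w (edge eq′) (absent eq′)))
      ; (there u∈)      → ¬ext u∈ })
      where
      false≢true : false ≢ true
      false≢true ()
      absent : path w ≡ path u ∷ʳ w → w ∉ path u
      absent eq′ = unique-∷ʳ⁻ (path u) (subst Unique eq′ (path-unique w))
      edge : path w ≡ path u ∷ʳ w → T (adj u w)
      edge eq′ with parent (dist-extend eq′)
      ... | u′ , e , _ , eq″ = subst (λ u → T (adj u w))
          (last≡ (Listₚ.∷ʳ-injectiveˡ (path u′) (path u) (trans (sym eq″) eq′))) e
        where
        last≡ : path u′ ≡ path u → u′ ≡ u
        last≡ p≡ with path-last u | path-last u′
        ... | xs , p | ys , q = Listₚ.∷ʳ-injectiveʳ ys xs (trans (sym q) (trans p≡ p))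

    next-layer : ∀ j → next env (Lv j) ≡ Lv (suc j)
    next-layer j = trans (cong (λ l → filterᵇ nonempty (map (λ w → extendTo env w (Lv j)) l))
        (trans (cong downFrom (trans (Listₚ.length-map _ (allFin order)) (Listₚ.length-tabulate {n = order} id)))
            (sym map-toℕ-vs)))
      (trans (cong (filterᵇ nonempty) (sym (Listₚ.map-∘ vs))) (go vs))
      where
      go : ∀ ws → filterᵇ nonempty (map (λ w → extendTo env (toℕ w) (Lv j)) ws) ≡ map ℓpath
          (filter (Layer? (suc j)) ws)
      go []       = refl
      go (w ∷ ws) with extendTo-layer j w (layer j) (layer-dist j)
      ... | inj₂ (eq , d) rewrite eq | ℓpath-∷ʳ (proj₂ (path-last w)) = trans (cong (_ ∷_) (go ws))
        (trans (cong (_∷ map ℓpath (filter (Layer? (suc j)) ws)) (sym (ℓpath-∷ʳ (proj₂ (path-last w)))))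
          (cong (map ℓpath) (sym (Listₚ.filter-accept (Layer? (suc j)) d))))
      ... | inj₁ (eq , ¬ext) rewrite eq = trans (go ws)
        (cong (map ℓpath) (sym (Listₚ.filter-reject (Layer? (suc j)) λ d →
          let u , e , w∉ , eq′ = parent d in
          ¬ext (∈-layer j (ℕₚ.suc-injective (trans (sym (dist-extend eq′)) d))) eq′)))

    layers-env : layers env ≡ applyUpTo (Lv ∘ suc) order
    layers-env = trans (cong (drop 1 ∘ reverse) levels-env)
      (trans (cong (drop 1) (trans (sym (Listₚ.reverse-map Lv (downFrom (suc order))))
          (cong (map Lv) (Listₚ.reverse-downFrom (suc order)))))
        (Listₚ.map-applyUpTo suc Lv order))
      where
      go : ∀ k (xs : List (List Bool)) →
        foldl (λ Ls _ → next env (headOr [] Ls) ∷ Ls) (map Lv (downFrom (suc k))) xs ≡ map Lv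
            (downFrom (length xs + suc k))
      go k []       = refl
      go k (x ∷ xs) rewrite next-layer k = trans (go (suc k) xs) (cong (map Lv ∘ downFrom) (ℕₚ.+-suc (length xs) (suc k)))
      start : (toℕ source ∷ []) ∷ [] ≡ Lv 0
      start = cong (λ p → map toℕ (reverse p) ∷ []) (sym source-path)
      levels-env : levels env ≡ map Lv (downFrom (suc order))
      levels-env = trans (cong (λ L → foldl (λ Ls _ → next env (headOr [] Ls) ∷ Ls) (L ∷ []) (matrix env)) start)
        (trans (go 0 (matrix env)) (cong (map Lv ∘ downFrom)
          (trans (ℕₚ.+-comm _ 1) (cong suc
              (trans (Listₚ.length-map _ (allFin order)) (Listₚ.length-tabulate {n = order} id))))))

-- The linear program

-- The analysis counts in units of one half, in ℕ; rationals remain only where the constraints enter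
-- and where the guarantee is stated.
half : ℕ → ℚ
half k = ℤ.+ k / 2

toℚᵘ-half : ∀ k → toℚᵘ (half k) ≃ mkℚᵘ (ℤ.+ k) 1
toℚᵘ-half k = ℚₚ.toℚᵘ-fromℚᵘ (mkℚᵘ (ℤ.+ k) 1)

half-+ : ∀ a b → half (a + b) ≡ half a ℚ.+ half b
half-+ a b = ℚₚ.toℚᵘ-injective (ℚᵘₚ.≃-trans (toℚᵘ-half (a + b))
  (ℚᵘₚ.≃-trans (*≡* same) (ℚᵘₚ.≃-sym (ℚᵘₚ.≃-trans (ℚₚ.toℚᵘ-homo-+ (half a) (half b))
    (ℚᵘₚ.+-cong (toℚᵘ-half a) (toℚᵘ-half b))))))
  where
  same : ℤ.+ (a + b) ℤ.* ℤ.+ 4 ≡ (ℤ.+ a ℤ.* ℤ.+ 2 ℤ.+ ℤ.+ b ℤ.* ℤ.+ 2) ℤ.* ℤ.+ 2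
  same = trans (cong (ℤ._* ℤ.+ 4) (ℤₚ.pos-+ a b)) (trans (sym (ℤₚ.*-assoc (ℤ.+ a ℤ.+ ℤ.+ b) (ℤ.+ 2) (ℤ.+ 2)))
    (cong (ℤ._* ℤ.+ 2) (ℤₚ.*-distribʳ-+ (ℤ.+ 2) (ℤ.+ a) (ℤ.+ b))))

half≤1 : ∀ k → half k ℚ.≤ 1ℚ → k ≤ 2
half≤1 k le with ℚᵘₚ.≤-respˡ-≃ (toℚᵘ-half k) (ℚₚ.toℚᵘ-mono-≤ le)
... | *≤* le′ = ℤₚ.drop‿+≤+ (subst (ℤ._≤ ℤ.+ 2) (ℤₚ.*-identityʳ (ℤ.+ k)) le′)

-- Clearing denominators in 5/6 · q/2 ≤ b gives 12, which is also the weighted number of candidates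
-- per row.
five-sixths : ∀ q b {z} → z ℚ.≤ half q → 5 * q ≤ 12 * b → (ℤ.+ 5 / 6) ℚ.* z ℚ.≤ ℤ.+ b / 1
five-sixths q b {z} z≤ le = ℚₚ.≤-trans (ℚₚ.*-monoˡ-≤-nonNeg (ℤ.+ 5 / 6) z≤)
  (ℚₚ.toℚᵘ-cancel-≤ (ℚᵘₚ.≤-respˡ-≃ (ℚᵘₚ.≃-sym (ℚᵘₚ.≃-trans (ℚₚ.toℚᵘ-homo-* (ℤ.+ 5 / 6) (half q))
      (ℚᵘₚ.*-cong (ℚᵘₚ.≃-refl {mkℚᵘ (ℤ.+ 5) 5}) (toℚᵘ-half q))))
    (ℚᵘₚ.≤-respʳ-≃ (ℚᵘₚ.≃-sym (ℚₚ.toℚᵘ-fromℚᵘ (mkℚᵘ (ℤ.+ b) 0))) (*≤* le′))))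
  where
  le′ : (ℤ.+ 5 ℤ.* ℤ.+ q) ℤ.* ℤ.+ 1 ℤ.≤ ℤ.+ b ℤ.* ℤ.+ 12
  le′ = subst₂ ℤ._≤_ (sym (trans (ℤₚ.*-identityʳ (ℤ.+ 5 ℤ.* ℤ.+ q)) (sym (ℤₚ.pos-* 5 q))))
    (sym (trans (sym (ℤₚ.pos-* b 12)) (cong ℤ.+_ (ℕₚ.*-comm b 12)))) (ℤ.+≤+ le)

module LP (𝒯 : RootedTree) (x y : RootedTree.Vertex 𝒯 → ℚ)
  (feasible : RootedTree.Feasible 𝒯 x y) (halfIntegral : RootedTree.HalfIntegral 𝒯 x) where

  open Tree 𝒯
  open Feasible feasible
  open Levels (map (λ v → nonzero (encodeℚ (x v))) (allFin order)) public

  twice-value : ∀ {q} → q ≡ 0ℚ ⊎ q ≡ ½ ⊎ q ≡ 1ℚ → ℕ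
  twice-value (inj₁ _)        = 0
  twice-value (inj₂ (inj₁ _)) = 1
  twice-value (inj₂ (inj₂ _)) = 2

  m : V → ℕ
  m v = twice-value (halfIntegral v)

  NZ : V → Set
  NZ v = nz env (toℕ v) ≡ true

  x≡half : ∀ v → x v ≡ half (m v)
  x≡half v with halfIntegral v
  ... | inj₁ eq        = eq
  ... | inj₂ (inj₁ eq) = eq
  ... | inj₂ (inj₂ eq) = eq

  nz-env : ∀ v → nz env (toℕ v) ≡ nonzero (encodeℚ (x v))
  nz-env v = nth-map-allFin false (λ v → nonzero (encodeℚ (x v))) v

  NZ⇒1≤m : ∀ {v} → NZ v → 1 ≤ m v
  NZ⇒1≤m {v} eq with halfIntegral v | trans (sym (nz-env v)) eq
  ... | inj₁ x≡0         | eq′ rewrite x≡0 with () ← eq′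
  ... | inj₂ (inj₁ _)    | _ = s≤s z≤n
  ... | inj₂ (inj₂ _)    | _ = s≤s z≤n

  1≤m⇒NZ : ∀ {v} → 1 ≤ m v → NZ v
  1≤m⇒NZ {v} le with halfIntegral v
  ... | inj₂ (inj₁ eq) = trans (nz-env v) (cong (λ q → nonzero (encodeℚ q)) eq)
  ... | inj₂ (inj₂ eq) = trans (nz-env v) (cong (λ q → nonzero (encodeℚ q)) eq)

  ¬NZ-source : nz env (toℕ source) ≡ false
  ¬NZ-source = trans (nz-env source) (cong (λ q → nonzero (encodeℚ q)) x-source)

  sum-half : ∀ l → foldr ℚ._+_ 0ℚ (map x l) ≡ half (total m l)
  sum-half []      = refl
  sum-half (v ∷ l) = trans (cong₂ ℚ._+_ (x≡half v) (sum-half l)) (sym (half-+ (m v) (total m l)))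

  -- In this form a violation is shown by listing a few distinct vertices of the constraint set
  -- instead of evaluating the whole sum.
  hartke-ℕ : ∀ v j → dist v < j → ∀ {us} → Unique us →
    All (P v ∪ (Subtree v ∩ Layer j)) us → total m us ≤ 2
  hartke-ℕ v j v<j uniq all = ℕₚ.≤-trans
    (total-⊆ m uniq (λ u∈ → ∈-filter⁺ S? (∈-allFin _) (All.lookup all u∈)))
    (half≤1 _ (subst (ℚ._≤ 1ℚ) (sum-half (filter S? (allFin order))) (hartke v j v<j)))
    where
    S? = P? v ∪? (Subtree? v ∩? Layer? j)

  path-≤2 : ∀ v {us} → Unique us → All (P v) us → total m us ≤ 2
  path-≤2 v uniq all = hartke-ℕ v (suc (dist v)) ℕₚ.≤-refl uniq (All.map inj₁ all)

  layer-≤2 : ∀ j {us} → Unique us → All (Layer (suc j)) us → total m us ≤ 2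
  layer-≤2 j uniq all = hartke-ℕ source (suc j) (subst (_< suc j) (sym dist-source) (s≤s z≤n)) uniq
    (All.map (λ {u} d → inj₂ (source-∈ u , d)) all)

  -- Twice the `x`-weight of the root path, so by coverage at least twice `y v`. Every vertex is
  -- measured against this number.
  Q : V → ℕ
  Q v = total m (filter (P? v) (allFin order))

  sum-y≤ : ∀ vs → foldr ℚ._+_ 0ℚ (map y vs) ℚ.≤ half (total Q vs)
  sum-y≤ []       = ℚₚ.≤-refl
  sum-y≤ (v ∷ vs) = subst (y v ℚ.+ foldr ℚ._+_ 0ℚ (map y vs) ℚ.≤_) (sym (half-+ (Q v) (total Q vs)))
    (ℚₚ.+-mono-≤ (subst (y v ℚ.≤_) (sum-half (filter (P? v) (allFin order))) (coverage v)) (sum-y≤ vs))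

-- The vertices picked by the algorithm

module Rounding (𝒯 : RootedTree) (x y : RootedTree.Vertex 𝒯 → ℚ)
  (feasible : RootedTree.Feasible 𝒯 x y) (halfIntegral : RootedTree.HalfIntegral 𝒯 x) where

  open Tree 𝒯 public
  open LP 𝒯 x y feasible halfIntegral public

  -- Three nonzero vertices weigh at least 3/2. `S` will be a root path, a layer, or a vertex
  -- together with a layer of its subtree.
  three : ∀ {S : V → Set} → (∀ {us} → Unique us → All S us → total m us ≤ 2) →
    ∀ {a b c} → NZ a → NZ b → NZ c → a ≢ b → a ≢ c → b ≢ c → S a → S b → S c → ⊥
  three ≤2 na nb nc a≢b a≢c b≢c sa sb sc =
      ℕₚ.<⇒≱ (ℕₚ.+-mono-≤ (NZ⇒1≤m na) (ℕₚ.+-mono-≤ (NZ⇒1≤m nb) (ℕₚ.+-mono-≤ (NZ⇒1≤m nc) z≤n)))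
    (≤2 ((a≢b ∷ a≢c ∷ []) ∷ (b≢c ∷ []) ∷ [] ∷ []) (sa ∷ sb ∷ sc ∷ []))

  NZ⇒≢source : ∀ {u} → NZ u → u ≢ source
  NZ⇒≢source nu refl with () ← trans (sym nu) ¬NZ-source

  IsTop : V → Set
  IsTop u = ∀ {a} → a ∈ path u → NZ a → a ≡ u

  record Below (a b : V) : Set where
    field
      NZ-a : NZ a
      a∈   : a ∈ path b
      a≢b  : a ≢ b
      only : ∀ {a′} → a′ ∈ path b → NZ a′ → a′ ≡ b ⊎ a′ ≡ a

    a<b : dist a < dist b
    a<b = dist-< a∈ a≢b

    top-a : IsTop a
    top-a a′∈ na′ with only (path-trans a′∈ a∈) na′
    ... | inj₁ refl = ⊥-elim (ℕₚ.<⇒≱ a<b (dist-≤ a′∈))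
    ... | inj₂ eq   = eq

  below : ∀ {a b} → NZ a → NZ b → a ∈ path b → a ≢ b → Below a b
  below {a} {b} na nb a∈ a≢b = record { NZ-a = na ; a∈ = a∈ ; a≢b = a≢b ; only = only }
    where
    only : ∀ {a′} → a′ ∈ path b → NZ a′ → a′ ≡ b ⊎ a′ ≡ a
    only {a′} a′∈ na′ with a′ Finₚ.≟ b | a′ Finₚ.≟ a
    ... | yes eq | _      = inj₁ eq
    ... | no _   | yes eq = inj₂ eq
    ... | no ≢b  | no ≢a  = ⊥-elim (three (path-≤2 b) na′ na nb ≢a ≢b a≢b a′∈ a∈ (self-∈ b))

  top-or-below : ∀ {u} → NZ u → IsTop u ⊎ ∃[ a ] Below a u
  top-or-below {u} nu with any (λ k → nz env k) (drop 1 (ℓpath u)) in eq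
  ... | true with any⁻ (λ k → nz env k) (drop 1 (ℓpath u)) eq
  ...   | k , k∈ , nk with strict⁻ k∈
  ...     | a , refl , a∈ , a≢u = inj₂ (a , below nk nu a∈ a≢u)
  top-or-below {u} nu | false = inj₁ λ {a} a∈ na → only a∈ na
    where
    only : ∀ {a} → a ∈ path u → NZ a → a ≡ u
    only {a} a∈ na with a Finₚ.≟ u
    ... | yes eq′ = eq′
    ... | no a≢u with () ← trans (sym eq) (any⁺ (λ k → nz env k) (strict⁺ a∈ a≢u) na)

  top-true : ∀ {u} → IsTop u → top env (ℓpath u) ≡ true
  top-true {u} isTop = cong not (¬true⇒false λ eq →
    let k , k∈ , nk = any⁻ (λ k → nz env k) (drop 1 (ℓpath u)) eq in no-ancestor k∈ nk)
    where
    no-ancestor : ∀ {k} → k ∈ drop 1 (ℓpath u) → nz env k ≡ true → ⊥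
    no-ancestor k∈ nk with strict⁻ k∈
    ... | a , refl , a∈ , a≢u = a≢u (isTop a∈ nk)

  top-false : ∀ {a u} → Below a u → top env (ℓpath u) ≡ false
  top-false b = cong not (any⁺ (λ k → nz env k) (strict⁺ (Below.a∈ b) (Below.a≢b b)) (Below.NZ-a b))

  -- With `a` the only nonzero vertex strictly above `b`, being covered depends on the fate of a
  -- single top.
  covered-below : ∀ {a b} us → Below a b → covered env us (drop 1 (ℓpath b)) ≡ (toℕ a ∈ᵇ us)
  covered-below {a} {b} us bl with toℕ a ∈ᵇ us in eq
  ... | true  = any⁺ (λ u → nz env u ∧ u ∈ᵇ us) (strict⁺ (Below.a∈ bl) (Below.a≢b bl)) (cong₂ _∧_ (Below.NZ-a bl) eq)
  ... | false = ¬true⇒false λ eq′ →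
    let k , k∈ , h = any⁻ (λ u → nz env u ∧ u ∈ᵇ us) (drop 1 (ℓpath b)) eq′ in absurd k∈ (∧-true h)
    where
    absurd : ∀ {k} → k ∈ drop 1 (ℓpath b) → nz env k ≡ true × (k ∈ᵇ us) ≡ true → ⊥
    absurd k∈ (nk , k∈us) with strict⁻ k∈
    ... | a′ , refl , a′∈ , a′≢b with Below.only bl a′∈ nk
    ...   | inj₁ a′≡b = a′≢b a′≡b
    ...   | inj₂ refl with () ← trans (sym eq) k∈us

  isNZ : V → Bool
  isNZ v = nz env (toℕ v)

  nzLayer : ℕ → List V
  nzLayer j = filterᵇ isNZ (layer (suc j))

  ∈-nzLayer⁻ : ∀ j {u} → u ∈ nzLayer j → dist u ≡ suc j × NZ u
  ∈-nzLayer⁻ j u∈ = let u∈′ , t = ∈-filter⁻ (T? ∘ isNZ) {xs = layer (suc j)} u∈ in layer-dist (suc j) u∈′ , T⇒≡ t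

  ∈-nzLayer⁺ : ∀ j {u} → dist u ≡ suc j → NZ u → u ∈ nzLayer j
  ∈-nzLayer⁺ j d nu = ∈-filter⁺ (T? ∘ isNZ) (∈-layer (suc j) d) (≡⇒T nu)

  vs-unique : Unique vs
  vs-unique = reverse-unique (allFin order) (Uniqueₚ.allFin⁺ order)
    where
    reverse-unique : ∀ l → Unique l → Unique (List.reverse l)
    reverse-unique []      _             = []
    reverse-unique (v ∷ l) uniq@(_ ∷ uniq′) = subst Unique (sym (Listₚ.unfold-reverse v l))
      (unique-∷ʳ⁺ (reverse-unique l uniq′) λ v∈ → Uniqueₚ.Unique[x∷xs]⇒x∉xs uniq (Anyₚ.reverse⁻ v∈))

  layer-unique : ∀ j → Unique (layer (suc j))
  layer-unique j = Uniqueₚ.filter⁺ (Layer? (suc j)) vs-unique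

  nzLayer-unique : ∀ j → Unique (nzLayer j)
  nzLayer-unique j = Uniqueₚ.filter⁺ (T? ∘ isNZ) (layer-unique j)

  filter-Lv : ∀ j → filterᵇ (λ p → nz env (endpoint p)) (Lv (suc j)) ≡ map ℓpath (nzLayer j)
  filter-Lv j = go (layer (suc j))
    where
    go : ∀ us → filterᵇ (λ p → nz env (endpoint p)) (map ℓpath us) ≡ map ℓpath (filterᵇ isNZ us)
    go []       = refl
    go (u ∷ us) rewrite endpoint-ℓpath u with isNZ u
    ... | true  = cong (ℓpath u ∷_) (go us)
    ... | false = go us

  data Shape (j : ℕ) (u : V) : Set where
    lone   : nzLayer j ≡ u ∷ [] → Shape j u
    first  : ∀ w → nzLayer j ≡ u ∷ w ∷ [] → Shape j u
    second : ∀ w → nzLayer j ≡ w ∷ u ∷ [] → Shape j u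

  shape : ∀ {j u} → dist u ≡ suc j → NZ u → Shape j u
  shape {j} {u} d nu = go (nzLayer j) refl (∈-nzLayer⁺ j d nu)
    where
    go : ∀ us → nzLayer j ≡ us → u ∈ us → Shape j u
    go (a ∷ [])         eq (here refl)         = lone eq
    go (a ∷ b ∷ [])     eq (here refl)         = first b eq
    go (a ∷ b ∷ [])     eq (there (here refl)) = second a eq
    go (a ∷ b ∷ c ∷ us) eq _ with subst Unique eq (nzLayer-unique j)
    ... | (a≢b ∷ a≢c ∷ _) ∷ (b≢c ∷ _) ∷ _ = ⊥-elim (three (layer-≤2 j)
          (nz∈ (here refl)) (nz∈ (there (here refl))) (nz∈ (there (there (here refl)))) a≢b a≢c b≢c
          (d∈ (here refl)) (d∈ (there (here refl))) (d∈ (there (there (here refl)))))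
      where
      nz∈ : ∀ {v} → v ∈ a ∷ b ∷ c ∷ us → NZ v
      nz∈ v∈ = proj₂ (∈-nzLayer⁻ j (subst (_ ∈_) (sym eq) v∈))
      d∈ : ∀ {v} → v ∈ a ∷ b ∷ c ∷ us → dist v ≡ suc j
      d∈ v∈ = proj₁ (∈-nzLayer⁻ j (subst (_ ∈_) (sym eq) v∈))

  record Partners (j : ℕ) (u w : V) : Set where
    field
      u≢w     : u ≢ w
      NZ-u    : NZ u
      NZ-w    : NZ w
      dist-u  : dist u ≡ suc j
      dist-w  : dist w ≡ suc j

  partners : ∀ {j u w} → nzLayer j ≡ u ∷ w ∷ [] → Partners j u w
  partners {j} {u} {w} eq with subst Unique eq (nzLayer-unique j)
     | ∈-nzLayer⁻ j (subst (u ∈_) (sym eq) (here refl)) | ∈-nzLayer⁻ j (subst (w ∈_) (sym eq) (there (here refl)))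
  ... | (u≢w ∷ []) ∷ _ | du , nu | dw , nw = record { u≢w = u≢w ; NZ-u = nu ; NZ-w = nw ; dist-u = du ; dist-w = dw }

  ctx : Bool → Bool → List Bool → ⟦ Ctx ⟧
  ctx t τ h = env , (t , τ) , h

  -- The recursive form of the loop in `picks`; it gives a name to the state on which each choice is
  -- based.
  picksUpTo : ⟦ Ctx ⟧ → ℕ → List ℕ
  picksUpTo c zero    = []
  picksUpTo c (suc j) = pick c (picksUpTo c j) (Lv (suc j)) ∷ picksUpTo c j

  length-picksUpTo : ∀ c j → length (picksUpTo c j) ≡ j
  length-picksUpTo c zero    = refl
  length-picksUpTo c (suc j) = cong suc (length-picksUpTo c j)

  picks-env : ∀ t τ h → picks (ctx t τ h) ≡ picksUpTo (ctx t τ h) order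
  picks-env t τ h = trans (cong (foldl addPick []) layers-env) (go order)
    where
    addPick : List ℕ → List (List ℕ) → List ℕ
    addPick us L = pick (ctx t τ h) us L ∷ us
    go : ∀ j → foldl addPick [] (applyUpTo (Lv ∘ suc) j) ≡ picksUpTo (ctx t τ h) j
    go zero    = refl
    go (suc j) = trans (cong (foldl addPick []) (sym (Listₚ.applyUpTo-∷ʳ (Lv ∘ suc) j)))
      (trans (Listₚ.foldl-∷ʳ addPick [] (Lv (suc j)) (applyUpTo (Lv ∘ suc) j))
          (cong (λ us → addPick us (Lv (suc j))) (go j)))

  module _ (t τ : Bool) (h : List Bool) where
    private
      c = ctx t τ h

    pick-lone : ∀ us {j u} → nzLayer j ≡ u ∷ [] → pick c us (Lv (suc j)) ≡ toℕ u
    pick-lone us {j} {u} eq rewrite filter-Lv j | eq = endpoint-ℓpath u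

    pick-pair : ∀ us {j u w} → nzLayer j ≡ u ∷ w ∷ [] →
      pick c us (Lv (suc j)) ≡ (ifᵇ prefersFirst c us (ℓpath u) (ℓpath w) then toℕ u else toℕ w)
    pick-pair us {j} {u} {w} eq rewrite filter-Lv j | eq | endpoint-ℓpath u | endpoint-ℓpath w = refl

    pick-in-layer : ∀ us j → pick c us (Lv (suc j)) ≡ toℕ source ⊎
      ∃[ v ] v ∈ nzLayer j × pick c us (Lv (suc j)) ≡ toℕ v
    pick-in-layer us j rewrite filter-Lv j with nzLayer j
    ... | []        = inj₁ refl
    ... | u ∷ []    = inj₂ (u , here refl , endpoint-ℓpath u)
    ... | u ∷ w ∷ _ with prefersFirst c us (ℓpath u) (ℓpath w)
    ...   | true  = inj₂ (u , here refl , endpoint-ℓpath u)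
    ...   | false = inj₂ (w , there (here refl) , endpoint-ℓpath w)

    picked : V → Bool
    picked u = toℕ u ∈ᵇ picksUpTo c (dist u)

    not-picked-elsewhere : ∀ {u} → NZ u → ∀ j → dist u ≢ suc j →
      (toℕ u ≡ᵇ pick c (picksUpTo c j) (Lv (suc j))) ≡ false
    not-picked-elsewhere {u} nu j d≢ = ¬true⇒false λ eq → go (ℕₚ.≡ᵇ⇒≡ (toℕ u) _ (≡⇒T eq))
      where
      go : toℕ u ≢ pick c (picksUpTo c j) (Lv (suc j))
      go eq with pick-in-layer (picksUpTo c j) j
      ... | inj₁ eq′ = NZ⇒≢source nu (Finₚ.toℕ-injective (trans eq eq′))
      ... | inj₂ (v , v∈ , eq′) with Finₚ.toℕ-injective {i = u} {v} (trans eq eq′)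
      ...   | refl = d≢ (proj₁ (∈-nzLayer⁻ j v∈))

    not-picked-before : ∀ {u} → NZ u → ∀ j → j < dist u → (toℕ u ∈ᵇ picksUpTo c j) ≡ false
    not-picked-before nu zero    _ = refl
    not-picked-before nu (suc j) j< = cong₂ _∨_ (not-picked-elsewhere nu j (ℕₚ.>⇒≢ j<))
      (not-picked-before nu j (ℕₚ.<-trans ℕₚ.≤-refl j<))

    -- A pick is the source or a nonzero vertex of the current layer, so only the step of its own
    -- layer can pick `u`. Coverage in a later step, coverage at the end and being saved in time
    -- thus reduce to the one Boolean `picked u`.
    picked-stable : ∀ {u} → NZ u → ∀ j → dist u ≤ j → (toℕ u ∈ᵇ picksUpTo c j) ≡ picked u
    picked-stable {u} nu j d≤ with ℕₚ.m≤n⇒m<n∨m≡n d≤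
    ... | inj₂ refl = refl
    picked-stable {u} nu (suc j) d≤ | inj₁ d< = trans
      (cong (_∨ (toℕ u ∈ᵇ picksUpTo c j)) (not-picked-elsewhere nu j (ℕₚ.<⇒≢ d<)))
      (picked-stable nu j (ℕₚ.≤-pred d<))

    picked-now : ∀ {j u} → NZ u → dist u ≡ suc j → picked u ≡ (toℕ u ≡ᵇ pick c (picksUpTo c j) (Lv (suc j)))
    picked-now {j} {u} nu d rewrite d | not-picked-before nu j (ℕₚ.≤-reflexive (sym d)) = Boolₚ.∨-identityʳ _

    picked-lone : ∀ {j u} → nzLayer j ≡ u ∷ [] → NZ u → dist u ≡ suc j → picked u ≡ true
    picked-lone {j} {u} eq nu d = trans (picked-now nu d)
      (trans (cong (toℕ u ≡ᵇ_) (pick-lone (picksUpTo c j) eq)) (≡ᵇ-refl (toℕ u)))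

    prefers : ℕ → V → V → Bool
    prefers j u w = prefersFirst c (picksUpTo c j) (ℓpath u) (ℓpath w)

    private
      ≡ᵇ-≢ : ∀ {u w : V} → u ≢ w → (toℕ u ≡ᵇ toℕ w) ≡ false
      ≡ᵇ-≢ {u} {w} u≢w = ¬true⇒false λ eq → u≢w (Finₚ.toℕ-injective (ℕₚ.≡ᵇ⇒≡ (toℕ u) (toℕ w) (≡⇒T eq)))

    picked-first : ∀ {j u w} → nzLayer j ≡ u ∷ w ∷ [] → picked u ≡ prefers j u w
    picked-first {j} {u} {w} eq = trans (picked-now NZ-u dist-u)
      (trans (cong (toℕ u ≡ᵇ_) (pick-pair (picksUpTo c j) eq)) (choose (prefers j u w)))
      where
      open Partners (partners eq)
      choose : ∀ b → (toℕ u ≡ᵇ (ifᵇ b then toℕ u else toℕ w)) ≡ b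
      choose true  = ≡ᵇ-refl (toℕ u)
      choose false = ≡ᵇ-≢ u≢w

    picked-second : ∀ {j u w} → nzLayer j ≡ w ∷ u ∷ [] → picked u ≡ not (prefers j w u)
    picked-second {j} {u} {w} eq = trans (picked-now NZ-w dist-w)
      (trans (cong (toℕ u ≡ᵇ_) (pick-pair (picksUpTo c j) eq)) (choose (prefers j w u)))
      where
      open Partners (partners eq)
      choose : ∀ b → (toℕ u ≡ᵇ (ifᵇ b then toℕ w else toℕ u)) ≡ not b
      choose true  = ≡ᵇ-≢ (u≢w ∘ sym)
      choose false = ≡ᵇ-refl (toℕ u)

    private
      -- `a` lies in an earlier layer, so its fate is settled when the layer of `b` is decided.
      covers : ∀ {j a b} → Below a b → dist b ≡ suc j →
        covered env (picksUpTo c j) (drop 1 (ℓpath b)) ≡ picked a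
      covers {j} bl d = trans (covered-below (picksUpTo c j) bl)
        (picked-stable (Below.NZ-a bl) j (ℕₚ.≤-pred (subst (_ <_) d (Below.a<b bl))))

    module _ {j u w} (pair : nzLayer j ≡ u ∷ w ∷ []) where
      open Partners (partners pair)

      prefers-top-top : IsTop u → IsTop w → prefers j u w ≡ bit h j
      prefers-top-top tu tw rewrite top-true tu | top-true tw | length-picksUpTo c j = refl

      prefers-top-below : ∀ {a} → IsTop u → Below a w → prefers j u w ≡ (ifᵇ t then picked a else bit h j)
      prefers-top-below tu bw rewrite top-true tu | top-false bw | length-picksUpTo c j | covers bw dist-w = refl

      prefers-below-top : ∀ {a} → Below a u → IsTop w → prefers j u w ≡ (ifᵇ t then not (picked a) else bit h j)
      prefers-below-top bu tw rewrite top-false bu | top-true tw | length-picksUpTo c j | covers bu dist-u = refl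

      prefers-below-below : ∀ {a a′} → Below a u → Below a′ w →
        prefers j u w ≡ (ifᵇ picked a then (ifᵇ picked a′ then τ else false) else (ifᵇ picked a′ then true else τ))
      prefers-below-below bu bw rewrite top-false bu | top-false bw | covers bu dist-u | covers bw dist-w = refl

-- Counting over the candidate strategies

𝟙-mono : ∀ {a b} → (a ≡ true → b ≡ true) → 𝟙 a ≤ 𝟙 b
𝟙-mono {false}     _ = z≤n
𝟙-mono {true}  {b} h rewrite h refl = ℕₚ.≤-refl

-- The four candidates that one mode makes from `h`: both tie-breaks, with `h` and with its
-- complement.
part : (Bool → List Bool → Bool) → List Bool → ℕ
part f h = (𝟙 (f true h) + 𝟙 (f true (map not h))) + (𝟙 (f false h) + 𝟙 (f false (map not h)))

part-mono : ∀ {f g} h → (∀ τ k → f τ k ≡ true → g τ k ≡ true) → part f h ≤ part g h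
part-mono h imp = ℕₚ.+-mono-≤ (ℕₚ.+-mono-≤ (𝟙-mono (imp true h)) (𝟙-mono (imp true (map not h))))
                              (ℕₚ.+-mono-≤ (𝟙-mono (imp false h)) (𝟙-mono (imp false (map not h))))

part-full : ∀ {f} h → (∀ τ k → f τ k ≡ true) → part f h ≡ 4
part-full h all rewrite all true h | all true (map not h) | all false h | all false (map not h) = refl

-- Probability at least ½ within each complementary pair. That it holds for each tie-break
-- separately replaces the independence of tie-break and bits.
OneOf : (Bool → List Bool → Bool) → List Bool → Set
OneOf f h = ∀ τ → f τ h ∨ f τ (map not h) ≡ true

𝟙-∨ : ∀ a b → a ∨ b ≡ true → 1 ≤ 𝟙 a + 𝟙 b
𝟙-∨ true  b    _  = s≤s z≤n
𝟙-∨ false true _  = s≤s z≤n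

part-half : ∀ {f} h → OneOf f h → 2 ≤ part f h
part-half {f} h one = ℕₚ.+-mono-≤ (𝟙-∨ (f true h) (f true (map not h)) (one true))
                                  (𝟙-∨ (f false h) (f false (map not h)) (one false))

-- The ¾ of tied mode: two from the favourable tie-break and at least one from the complementary
-- pair under the other.
part-half-full : ∀ {f} h δ → OneOf f h → (∀ k → f (not δ) k ≡ true) → 3 ≤ part f h
part-half-full {f} h true  one all rewrite all h | all (map not h) =
  ℕₚ.+-mono-≤ (𝟙-∨ (f true h) (f true (map not h)) (one true)) ℕₚ.≤-refl
part-half-full {f} h false one all rewrite all h | all (map not h) =
  s≤s (s≤s (𝟙-∨ (f false h) (f false (map not h)) (one false)))

-- If the two disjuncts differ at `h`, both `h` and its complement succeed, otherwise exactly one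
-- does. The indicator averages to ½ over the rows, giving 3 of 4.
part-two : ∀ {f} h {i j} ε ε′ → i < length h → j < length h →
  (∀ τ k → f τ k ≡ (ε xor bit k i) ∨ (ε′ xor bit k j)) →
  part f h ≡ 2 + 2 * 𝟙 ((ε xor ε′) xor differ i j h)
part-two {f} h {i} {j} ε ε′ i< j< eq rewrite eq true h | eq true (map not h) | eq false h | eq false (map not h)
  | bit-not h i i< | bit-not h j j< = table ε ε′ (bit h i) (bit h j)
  where
  table : ∀ ε ε′ p q → let a = 𝟙 ((ε xor p) ∨ (ε′ xor q)) ; b = 𝟙 ((ε xor not p) ∨ (ε′ xor not q)) in
    (a + b) + (a + b) ≡ 2 + 2 * 𝟙 ((ε xor ε′) xor (p xor q))
  table false false false false = refl
  table false false false true  = refl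
  table false false true  false = refl
  table false false true  true  = refl
  table false true  false false = refl
  table false true  false true  = refl
  table false true  true  false = refl
  table false true  true  true  = refl
  table true  false false false = refl
  table true  false false true  = refl
  table true  false true  false = refl
  table true  false true  true  = refl
  table true  true  false false = refl
  table true  true  false true  = refl
  table true  true  true  false = refl
  table true  true  true  true  = refl

-- The favourable tie-break contributes 2, the other one 1 plus the indicator. On average this is 3½
-- of 4, the ⅞ of untied mode.
part-three : ∀ {f} h {i j} ε ε′ δ → i < length h → j < length h →
  (∀ τ k → f τ k ≡ (ε xor bit k i) ∨ ((ε′ xor bit k j) ∨ (δ xor τ))) →
  part f h ≡ 3 + 𝟙 ((ε xor ε′) xor differ i j h)
part-three {f} h {i} {j} ε ε′ δ i< j< eq rewrite eq true h | eq true (map not h) | eq false h | eq false (map not h)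
  | bit-not h i i< | bit-not h j j< = table ε ε′ δ (bit h i) (bit h j)
  where
  table : ∀ ε ε′ δ p q →
    let a = λ τ → 𝟙 ((ε xor p) ∨ ((ε′ xor q) ∨ (δ xor τ)))
        b = λ τ → 𝟙 ((ε xor not p) ∨ ((ε′ xor not q) ∨ (δ xor τ))) in
    (a true + b true) + (a false + b false) ≡ 3 + 𝟙 ((ε xor ε′) xor (p xor q))
  table false false false false false = refl
  table false false false false true  = refl
  table false false false true  false = refl
  table false false false true  true  = refl
  table false false true  false false = refl
  table false false true  false true  = refl
  table false false true  true  false = refl
  table false false true  true  true  = refl
  table false true  false false false = refl
  table false true  false false true  = refl
  table false true  false true  false = refl
  table false true  false true  true  = refl
  table false true  true  false false = refl
  table false true  true  false true  = refl
  table false true  true  true  false = refl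
  table false true  true  true  true  = refl
  table true  false false false false = refl
  table true  false false false true  = refl
  table true  false false true  false = refl
  table true  false false true  true  = refl
  table true  false true  false false = refl
  table true  false true  false true  = refl
  table true  false true  true  false = refl
  table true  false true  true  true  = refl
  table true  true  false false false = refl
  table true  true  false false true  = refl
  table true  true  false true  false = refl
  table true  true  false true  true  = refl
  table true  true  true  false false = refl
  table true  true  true  false true  = refl
  table true  true  true  true  false = refl
  table true  true  true  true  true  = refl

xor-not : ∀ b → b xor not b ≡ true
xor-not false = refl
xor-not true  = refl

-- Tied mode counts once, untied mode twice: together 12 candidates per row h.
count : (Bool → Bool → List Bool → Bool) → List Bool → ℕ
count f h = part (f true) h + 2 * part (f false) h

-- Success of the two modes on a pair of nonzero vertices

module Count (𝒯 : RootedTree) (x y : RootedTree.Vertex 𝒯 → ℚ)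
  (feasible : RootedTree.Feasible 𝒯 x y) (halfIntegral : RootedTree.HalfIntegral 𝒯 x) where

  open Rounding 𝒯 x y feasible halfIntegral public

  dist-suc : ∀ {u} → NZ u → ∃[ j ] dist u ≡ suc j × j < order
  dist-suc {u} nu with dist u in eq
  ... | zero  = ⊥-elim (NZ⇒≢source nu (dist-0 eq))
  ... | suc j = j , refl , ℕₚ.<-trans ℕₚ.≤-refl (subst (_< order) eq (dist-<-order u))

  prefers-untied : ∀ {j u w} τ h → nzLayer j ≡ u ∷ w ∷ [] → IsTop u ⊎ IsTop w →
    prefers false τ h j u w ≡ bit h j
  prefers-untied {u = u} {w} τ h eq tops with top-or-below (Partners.NZ-u (partners eq)) | top-or-below
      (Partners.NZ-w (partners eq))
  ... | inj₁ tu       | inj₁ tw       = prefers-top-top false τ h eq tu tw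
  ... | inj₁ tu       | inj₂ (_ , bw) = prefers-top-below false τ h eq tu bw
  ... | inj₂ (_ , bu) | inj₁ tw       = prefers-below-top false τ h eq bu tw
  ... | inj₂ (_ , bu) | inj₂ (_ , bw) = ⊥-elim ([ ¬top bu , ¬top bw ]′ tops)
    where
    ¬top : ∀ {a u} → Below a u → IsTop u → ⊥
    ¬top b t = Below.a≢b b (t (Below.a∈ b) (Below.NZ-a b))

  Always : Bool → V → Set
  Always t u = ∀ τ h → picked t τ h u ≡ true

  -- `ε` is the position in the list of the layer: `false` for the first vertex, `true` for the
  -- second.
  ByBit : ℕ → V → Set
  ByBit j u = ∃[ ε ] (∀ τ h → picked false τ h u ≡ ε xor bit h j)

  untied-top : ∀ {j u} → dist u ≡ suc j → NZ u → IsTop u → Always false u ⊎ ByBit j u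
  untied-top d nu tu with shape d nu
  ... | lone eq     = inj₁ λ τ h → picked-lone false τ h eq nu d
  ... | first w eq  = inj₂ (false , λ τ h → trans (picked-first false τ h eq) (prefers-untied τ h eq (inj₁ tu)))
  ... | second w eq = inj₂ (true , λ τ h → trans (picked-second false τ h eq)
      (cong not (prefers-untied τ h eq (inj₂ tu))))

  one-of-layer : ∀ {j a b} t τ h → dist a ≡ suc j → dist b ≡ suc j → NZ a → NZ b → a ≢ b →
    picked t τ h a ∨ picked t τ h b ≡ true
  one-of-layer {j} {a} {b} t τ h da db na nb a≢b with shape da na | ∈-nzLayer⁺ j db nb
  ... | lone eq     | b∈ rewrite picked-lone t τ h eq na da = refl
  ... | first w eq  | b∈ with subst (b ∈_) eq b∈
  ...   | here refl         = ⊥-elim (a≢b refl)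
  ...   | there (here refl) rewrite picked-first t τ h eq | picked-second t τ h eq = Boolₚ.∨-inverseʳ (prefers t τ h j a b)
  one-of-layer {j} {a} {b} t τ h da db na nb a≢b | second w eq | b∈ with subst (b ∈_) eq b∈
  ...   | here refl rewrite picked-first t τ h eq | picked-second t τ h eq = Boolₚ.∨-inverseˡ (prefers t τ h j b a)
  ...   | there (here refl) = ⊥-elim (a≢b refl)

  -- If the partner of `a` is a non-top below `a′`, then `a` is picked exactly when `a′` is, and
  -- `a′` is a top of an earlier layer. This chain, whose descent is bounded by `k`, ends at a lone
  -- vertex or at two tops, where complementing flips the choice. The row must be long enough
  -- because bits beyond its end default to `false` and do not flip.
  tied-top : ∀ k {a} → dist a < k → NZ a → IsTop a → ∀ h → order ≤ length h →
    OneOf (λ τ g → picked true τ g a) h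
  tied-top (suc k) {a} a<k na ta h wide τ with dist-suc na
  ... | j , d , j< with shape d na
  ...   | lone eq rewrite picked-lone true τ h eq na d = refl
  ...   | first w eq rewrite picked-first true τ h eq | picked-first true τ (map not h) eq with top-or-below (Partners.NZ-w (partners eq))
  ...     | inj₁ tw rewrite prefers-top-top true τ h eq ta tw | prefers-top-top true τ (map not h) eq ta tw
              | bit-not h j (ℕₚ.≤-trans j< wide) = Boolₚ.∨-inverseʳ (bit h j)
  ...     | inj₂ (a′ , bw) rewrite prefers-top-below true τ h eq ta bw | prefers-top-below true τ (map not h) eq ta bw =
              tied-top k (ℕₚ.<-≤-trans (Below.a<b bw)
                  (ℕₚ.≤-trans (ℕₚ.≤-reflexive (trans (Partners.dist-w (partners eq)) (sym d))) (ℕₚ.≤-pred a<k)))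
                (Below.NZ-a bw) (Below.top-a bw) h wide τ
  tied-top (suc k) {a} a<k na ta h wide τ | j , d , j< | second w eq
    rewrite picked-second true τ h eq | picked-second true τ (map not h) eq with top-or-below (Partners.NZ-u (partners eq))
  ...     | inj₁ tw rewrite prefers-top-top true τ h eq tw ta | prefers-top-top true τ (map not h) eq tw ta
              | bit-not h j (ℕₚ.≤-trans j< wide) = Boolₚ.∨-inverseʳ (not (bit h j))
  ...     | inj₂ (a′ , bw) rewrite prefers-below-top true τ h eq bw ta | prefers-below-top true τ (map not h) eq bw ta
              | Boolₚ.not-involutive (picked true τ h a′) | Boolₚ.not-involutive (picked true τ (map not h) a′) =
              tied-top k (ℕₚ.<-≤-trans (Below.a<b bw)
                  (ℕₚ.≤-trans (ℕₚ.≤-reflexive (trans (Partners.dist-u (partners eq)) (sym d))) (ℕₚ.≤-pred a<k)))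
                (Below.NZ-a bw) (Below.top-a bw) h wide τ

  -- The cases are those of the partner of `b`. If it is a non-top below `a′` and `a` is not picked,
  -- then `b` is chosen when `a′` is picked and by the tie-break otherwise; `δ` is the position of
  -- `b` in its layer.
  data Second (j : ℕ) (a b : V) : Set where
    alone    : (∀ t → Always t b) → Second j a b
    with-top : ByBit j b → (∀ τ h → picked true τ h b ≡ not (picked true τ h a)) → Second j a b
    with-second : ∀ {a′} → NZ a′ → IsTop a′ → a ≢ a′ → ∀ δ →
      (∀ t τ h → picked t τ h a ∨ picked t τ h b ≡ picked t τ h a ∨ (picked t τ h a′ ∨ (δ xor τ))) → Second j a b

  second-kind : ∀ {j a b} → Below a b → NZ b → dist b ≡ suc j → Second j a b
  second-kind {j} {a} {b} bl nb d with shape d nb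
  ... | lone eq = alone λ t τ h → picked-lone t τ h eq nb d
  ... | first w eq with top-or-below (Partners.NZ-w (partners eq))
  ...   | inj₁ tw = with-top
            (false , λ τ h → trans (picked-first false τ h eq) (prefers-untied τ h eq (inj₂ tw)))
            (λ τ h → trans (picked-first true τ h eq) (prefers-below-top true τ h eq bl tw))
  ...   | inj₂ (a′ , bw) = with-second (Below.NZ-a bw) (Below.top-a bw)
      (distinct-ancestors bl bw (partners eq)) false λ t τ h →
            trans (cong (picked t τ h a ∨_) (trans (picked-first t τ h eq) (prefers-below-below t τ h eq bl bw)))
                  (table (picked t τ h a) (picked t τ h a′) τ)
    where
    table : ∀ p q τ → p ∨ (ifᵇ p then (ifᵇ q then τ else false) else (ifᵇ q then true else τ)) ≡ p ∨
        (q ∨ (false xor τ))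
    table true  _     _ = refl
    table false true  _ = refl
    table false false _ = refl
    -- With a common ancestor `a`, the vertices `a`, `b` and `w` would violate Hartke's constraint
    -- for `a` and the layer of `b` and `w`.
    distinct-ancestors : ∀ {a a′ b w} → Below a b → Below a′ w → Partners j b w → a ≢ a′
    distinct-ancestors {a} {_} {b} {w} bb bw pt refl =
        three (hartke-ℕ a (suc j) (subst (dist a <_) (Partners.dist-u pt) (Below.a<b bb)))
      (Below.NZ-a bb) (Partners.NZ-u pt) (Partners.NZ-w pt) (Below.a≢b bb) (Below.a≢b bw) (Partners.u≢w pt)
      (inj₁ (self-∈ a)) (inj₂ (Below.a∈ bb , Partners.dist-u pt)) (inj₂ (Below.a∈ bw , Partners.dist-w pt))
  second-kind {j} {a} {b} bl nb d | second w eq with top-or-below (Partners.NZ-u (partners eq))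
  ...   | inj₁ tw = with-top
            (true , λ τ h → trans (picked-second false τ h eq) (cong not (prefers-untied τ h eq (inj₁ tw))))
            (λ τ h → trans (picked-second true τ h eq) (cong not (prefers-top-below true τ h eq tw bl)))
  ...   | inj₂ (a′ , bw) = with-second (Below.NZ-a bw) (Below.top-a bw)
      (distinct-ancestors bl bw (partners eq)) true λ t τ h →
            trans (cong (picked t τ h a ∨_)
                (trans (picked-second t τ h eq) (cong not (prefers-below-below t τ h eq bw bl))))
                  (table (picked t τ h a) (picked t τ h a′) τ)
    where
    table : ∀ p q τ → p ∨ not (ifᵇ q then (ifᵇ p then τ else false) else (ifᵇ p then true else τ)) ≡ p ∨
        (q ∨ (true xor τ))
    table true  _     _ = refl
    table false true  _ = refl
    table false false _ = refl
    distinct-ancestors : ∀ {a a′ b w} → Below a b → Below a′ w → Partners j w b → a ≢ a′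
    distinct-ancestors {a} {_} {b} {w} bb bw pt refl =
        three (hartke-ℕ a (suc j) (subst (dist a <_) (Partners.dist-w pt) (Below.a<b bb)))
      (Below.NZ-a bb) (Partners.NZ-w pt) (Partners.NZ-u pt) (Below.a≢b bb) (Below.a≢b bw) (Partners.u≢w pt ∘ sym)
      (inj₁ (self-∈ a)) (inj₂ (Below.a∈ bb , Partners.dist-w pt)) (inj₂ (Below.a∈ bw , Partners.dist-u pt))

  either : V → V → Bool → Bool → List Bool → Bool
  either a b t τ h = picked t τ h a ∨ picked t τ h b

  -- The 10 of 12 are reached on every row or on average: the indicator is 1 on half of the rows, so
  -- the term with factor `k` averages to `k`.
  data PairCount (a b : V) : Set where
    enough  : (∀ h → order ≤ length h → 10 ≤ count (either a b) h) → PairCount a b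
    average : ∀ {i j} κ k base → i < order → j < order → i ≢ j → base + k ≡ 10 →
      (∀ h → order ≤ length h → base + k * (2 * 𝟙 (κ xor differ i j h)) ≤ count (either a b) h) → PairCount a b

  -- Certain success in untied mode already counts 8, so tied mode only has to contribute its 2 for
  -- the top `a`.
  count-full : ∀ {a b} h → (∀ τ g → either a b false τ g ≡ true) → 2 ≤ part (either a b true) h →
    10 ≤ count (either a b) h
  count-full h full le rewrite part-full h full = ℕₚ.+-monoˡ-≤ 8 le

  tied-one : ∀ {a} b h → NZ a → IsTop a → order ≤ length h → OneOf (either a b true) h
  tied-one {a} b h na ta wide τ with picked true τ h a | picked true τ (map not h) a | tied-top
      (suc (dist a)) ℕₚ.≤-refl na ta h wide τ
  ... | true  | _     | _ = refl
  ... | false | true  | _ = Boolₚ.∨-zeroʳ _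

  pair-count : ∀ {a b} → Below a b → NZ b → PairCount a b
  pair-count {a} {b} bl nb with dist-suc (Below.NZ-a bl) | dist-suc nb
  ... | i , da , i< | j , db , j< with untied-top da (Below.NZ-a bl) (Below.top-a bl) | second-kind bl nb db
  ...   | _ | alone all = enough λ h wide → count-full h
            (λ τ g → trans (cong (picked false τ g a ∨_) (all false τ g)) (Boolₚ.∨-zeroʳ _))
            (part-half {either a b true} h (tied-one b h (Below.NZ-a bl) (Below.top-a bl) wide))
  ...   | inj₁ all | _ = enough λ h wide → count-full h
            (λ τ g → cong (_∨ picked false τ g b) (all τ g))
            (part-half {either a b true} h (tied-one b h (Below.NZ-a bl) (Below.top-a bl) wide))
  -- In tied mode `b` is picked exactly when `a` is not, which counts 4; untied mode adds twice 2 +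
  -- 2 d, where d is the indicator.
  ...   | inj₂ (ε , ha) | with-top (ε′ , hb) tied = average (ε xor ε′) 2 8 i< j<
            (λ i≡j → ℕₚ.<⇒≢ (Below.a<b bl) (trans da (trans (cong suc i≡j) (sym db)))) refl λ h wide →
                ℕₚ.≤-reflexive (sym
              (trans (cong₂ (λ p q → p + 2 * q)
                (part-full h λ τ g → trans (cong (picked true τ g a ∨_) (tied τ g))
                    (Boolₚ.∨-inverseʳ (picked true τ g a)))
                (part-two h ε ε′ (ℕₚ.≤-trans i< wide) (ℕₚ.≤-trans j< wide) λ τ g → cong₂ _∨_ (ha τ g) (hb τ g)))
              (eight (𝟙 ((ε xor ε′) xor differ i j h)))))
    where
    eight : ∀ d → 4 + 2 * (2 + 2 * d) ≡ 8 + 2 * (2 * d)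
    eight = solve-∀
  ...   | inj₂ (ε , ha) | with-second {a′} na′ ta′ a≢a′ δ eq with dist-suc na′
  ...     | i′ , da′ , i′< with i ℕₚ.≟ i′ | untied-top da′ na′ ta′
  -- The tops `a` and `a′` share a layer, so one of them is picked and untied mode never fails.
  ...       | yes refl | _ = enough λ h wide → count-full h
                (λ τ g → trans (eq false τ g)
                    (absorb {picked false τ g a} {picked false τ g a′}
                        (one-of-layer false τ g da da′ (Below.NZ-a bl) na′ a≢a′)))
                (part-half {either a b true} h (tied-one b h (Below.NZ-a bl) (Below.top-a bl) wide))
    where
    absorb : ∀ {p q r} → p ∨ q ≡ true → p ∨ (q ∨ r) ≡ true
    absorb {true}         _ = refl
    absorb {false} {true} _ = refl
  ...       | no _ | inj₁ all′ = enough λ h wide → count-full h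
                (λ τ g → trans (eq false τ g)
                    (trans (cong (λ q → picked false τ g a ∨ (q ∨ (δ xor τ))) (all′ τ g)) (Boolₚ.∨-zeroʳ _)))
                (part-half {either a b true} h (tied-one b h (Below.NZ-a bl) (Below.top-a bl) wide))
  -- Tied mode gives at least 3 and untied mode twice 3 + d, where d is the indicator; together 9 +
  -- 2 d.
  ...       | no i≢i′ | inj₂ (ε′ , ha′) = average (ε xor ε′) 1 9 i< i′< i≢i′ refl λ h wide →
                ℕₚ.≤-trans (ℕₚ.≤-reflexive (nine (𝟙 ((ε xor ε′) xor differ i i′ h))))
                  (ℕₚ.+-mono-≤
                    (part-half-full {either a b true} h δ (tied-one b h (Below.NZ-a bl) (Below.top-a bl) wide) λ g →
                      trans (eq true (not δ) g)
                          (trans (cong (λ r → picked true (not δ) g a ∨ (picked true (not δ) g a′ ∨ r)) (xor-not δ))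
                        (trans (cong (picked true (not δ) g a ∨_) (Boolₚ.∨-zeroʳ _)) (Boolₚ.∨-zeroʳ _))))
                    (ℕₚ.*-monoʳ-≤ 2 (ℕₚ.≤-reflexive
                        (sym (part-three h ε ε′ δ (ℕₚ.≤-trans i< wide) (ℕₚ.≤-trans i′< wide)
                      λ τ g → trans (eq false τ g) (cong₂ (λ p q → p ∨ (q ∨ (δ xor τ))) (ha τ g) (ha′ τ g)))))))
    where
    nine : ∀ d → 9 + 1 * (2 * d) ≡ 3 + 2 * (3 + d)
    nine = solve-∀

-- Averages over rows and the search for the best candidate

m<2^m : ∀ m → m < 2 ^ m
m<2^m zero    = s≤s z≤n
m<2^m (suc m) = ℕₚ.+-mono-≤ (ℕₚ.≤-trans (s≤s z≤n) (m<2^m m)) (ℕₚ.≤-trans (m<2^m m) (ℕₚ.m≤m+n _ 0))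

rows-hadamard : ∀ e → ∃[ m ] rows e ≡ hadamard m × length (matrix e) ≤ 2 ^ m
rows-hadamard e = finish (subst (λ k → Doubled n k (rows e)) (ℕₚ.+-identityʳ n) (go (matrix e) 0 (doubled-start n)))
  where
  n = length (matrix e)
  go : ∀ (xs : List (List Bool)) k {H} → Doubled n k H →
    Doubled n (length xs + k) (foldl (λ H _ → ifᵇ n ≤ᵇ length H then H else double H) H xs)
  go []       k d = d
  go (x ∷ xs) k {H} d = subst (λ k → Doubled n k (foldl (λ H _ → ifᵇ n ≤ᵇ length H then H else double H) H (x ∷ xs)))
    (ℕₚ.+-suc (length xs) k) (go xs (suc k) (doubled-step n k d))
  finish : Doubled n n (rows e) → ∃[ m ] rows e ≡ hadamard m × n ≤ 2 ^ m
  finish (m , eq , _ , inj₁ le)   = m , eq , le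
  finish (m , eq , _ , inj₂ refl) = m , eq , ℕₚ.<⇒≤ (m<2^m m)

total-≥ : ∀ {A : Set} {k} {f : A → ℕ} {xs} → All (λ a → k ≤ f a) xs → length xs * k ≤ total f xs
total-≥ []         = z≤n
total-≥ (le ∷ les) = ℕₚ.+-mono-≤ le (total-≥ les)

total-≤ : ∀ {A : Set} {k} {f : A → ℕ} {xs} → All (λ a → f a ≤ k) xs → total f xs ≤ length xs * k
total-≤ []         = z≤n
total-≤ (le ∷ les) = ℕₚ.+-mono-≤ le (total-≤ les)

total-average : ∀ m {i j} κ k base {f : List Bool → ℕ} → i < 2 ^ m → j < 2 ^ m → i ≢ j →
  All (λ h → base + k * (2 * 𝟙 (κ xor differ i j h)) ≤ f h) (hadamard m) →
  2 ^ m * (base + k) ≤ total f (hadamard m)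
total-average m {i} {j} κ k base {f} i< j< i≢j les = ℕₚ.≤-trans (ℕₚ.≤-reflexive (sym (begin
  total (λ h → base + k * (2 * 𝟙 (κ xor differ i j h))) H          ≡⟨ total-+ (λ _ → base) _ H ⟩
  total (λ _ → base) H + total (λ h → k * (2 * 𝟙 (κ xor differ i j h))) H
    ≡⟨ cong₂ _+_ (trans (total-const base H) (cong (_* base) (length-hadamard m)))
                 (trans (total-* k _ H) (cong (k *_) (trans (total-* 2 _ H) (half-agree m i< j< i≢j κ)))) ⟩
  2 ^ m * base + k * 2 ^ m                                         ≡⟨ cong ((2 ^ m * base) +_) (ℕₚ.*-comm k (2 ^ m)) ⟩
  2 ^ m * base + 2 ^ m * k                                         ≡⟨ sym (ℕₚ.*-distribˡ-+ (2 ^ m) base k) ⟩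
  2 ^ m * (base + k)                                               ∎)))
  (total-mono les)
  where
  open ≡-Reasoning
  H = hadamard m

length-filter-total : ∀ {A : Set} {P : A → Set} (P? : Decidable P) xs →
  length (filter P? xs) ≡ total (λ a → 𝟙 (does (P? a))) xs
length-filter-total P? []       = refl
length-filter-total P? (a ∷ xs) with does (P? a)
... | true  = cong suc (length-filter-total P? xs)
... | false = length-filter-total P? xs

count-mono : ∀ {f g} h → (∀ t τ k → f t τ k ≡ true → g t τ k ≡ true) → count f h ≤ count g h
count-mono {f} {g} h imp = ℕₚ.+-mono-≤ (part-mono {f true} {g true} h (imp true))
  (ℕₚ.*-monoʳ-≤ 2 (part-mono {f false} {g false} h (imp false)))

best-of : ∀ {A : Set} (f : A → ℕ) (b : A) (l : List A) →
  let r = foldl (λ b a → ifᵇ f b ≤ᵇ f a then a else b) b l in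
  (r ≡ b ⊎ r ∈ l) × f b ≤ f r × All (λ a → f a ≤ f r) l
best-of f b []      = inj₁ refl , ℕₚ.≤-refl , []
best-of f b (a ∷ l) with f b ≤ᵇ f a in eq
... | true  with best-of f a l
...   | inj₁ r≡a , a≤ , les = inj₂ (here r≡a) , ℕₚ.≤-trans (ℕₚ.≤ᵇ⇒≤ _ _ (≡⇒T eq)) a≤ , a≤ ∷ les
...   | inj₂ r∈  , a≤ , les = inj₂ (there r∈) , ℕₚ.≤-trans (ℕₚ.≤ᵇ⇒≤ _ _ (≡⇒T eq)) a≤ , a≤ ∷ les
best-of f b (a ∷ l) | false with best-of f b l
...   | r∈ , b≤ , les = [ inj₁ , inj₂ ∘ there ]′ r∈ , b≤ ,
        ℕₚ.≤-trans (ℕₚ.<⇒≤ (ℕₚ.≰⇒> λ le → subst T eq (ℕₚ.≤⇒≤ᵇ le))) b≤ ∷ les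

∈-strategies⁻ : ∀ e {us} → us ∈ strategies e → ∃[ t ] ∃[ τ ] ∃[ h ] us ≡ picks (e , (t , τ) , h)
∈-strategies⁻ e {us} us∈ with ∈-concat⁻′ (map (λ h → map (λ m → picks (e , m , h)) modes)
    (rows e ++ map (map not) (rows e))) us∈
... | _ , us∈′ , l∈ with ∈-map⁻ (λ h → map (λ m → picks (e , m , h)) modes) l∈
...   | h , _ , refl with ∈-map⁻ (λ m → picks (e , m , h)) us∈′
...     | (t , τ) , _ , eq = t , τ , h , eq

∈-strategies⁺ : ∀ e t τ {h} → h ∈ rows e ++ map (map not) (rows e) → picks (e , (t , τ) , h) ∈ strategies e
∈-strategies⁺ e t τ {h} h∈ = ∈-concat⁺′ (∈-map⁺ (λ m → picks (e , m , h)) (mode-∈ t τ))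
  (∈-map⁺ (λ h → map (λ m → picks (e , m , h)) modes) h∈)
  where
  mode-∈ : ∀ t τ → (t , τ) ∈ modes
  mode-∈ true  true  = here refl
  mode-∈ true  false = there (here refl)
  mode-∈ false true  = there (there (here refl))
  mode-∈ false false = there (there (there (here refl)))

encodeList-map : ∀ {S R : Set} (f : R → D) (g : S → R) l → encodeList f (map g l) ≡ encodeList (λ a → f (g a)) l
encodeList-map f g []      = refl
encodeList-map f g (a ∷ l) = cong (cons (f (g a))) (encodeList-map f g l)

encodeList-cong : ∀ {S : Set} {f g : S → D} (l : List S) → (∀ a → f a ≡ g a) → encodeList f l ≡ encodeList g l
encodeList-cong []      eq = refl
encodeList-cong (a ∷ l) eq = cong₂ cons (eq a) (encodeList-cong l eq)

-- The guarantee for the best candidate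

module Final (𝒯 : RootedTree) (x y : RootedTree.Vertex 𝒯 → ℚ)
  (feasible : RootedTree.Feasible 𝒯 x y) (halfIntegral : RootedTree.HalfIntegral 𝒯 x) where

  open Count 𝒯 x y feasible halfIntegral

  hit : V → Bool → Bool → List Bool → Bool
  hit v t τ g = covered env (picks (ctx t τ g)) (ℓpath v)

  hit-picked : ∀ {a v} → NZ a → a ∈ path v → ∀ t τ g → picked t τ g a ≡ true → hit v t τ g ≡ true
  hit-picked {a} {v} na a∈ t τ g eq = any⁺ (λ u → nz env u ∧ u ∈ᵇ picks (ctx t τ g)) (∈-ℓpath⁺ a∈)
    (cong₂ _∧_ na (trans (cong (toℕ a ∈ᵇ_) (picks-env t τ g))
      (trans (picked-stable t τ g na order (ℕₚ.<⇒≤ (dist-<-order a))) eq)))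

  nzPath : V → List V
  nzPath v = filterᵇ isNZ (filter (P? v) (allFin order))

  ∈-nzPath⁺ : ∀ {u v} → u ∈ path v → NZ u → u ∈ nzPath v
  ∈-nzPath⁺ {u} {v} u∈ nu = ∈-filter⁺ (T? ∘ isNZ) (∈-filter⁺ (P? v) (∈-allFin u) u∈) (≡⇒T nu)

  ∈-nzPath⁻ : ∀ {u v} → u ∈ nzPath v → u ∈ path v × NZ u
  ∈-nzPath⁻ {u} {v} u∈ = let u∈′ , t = ∈-filter⁻ (T? ∘ isNZ) {xs = filter (P? v) (allFin order)} u∈ in
    proj₂ (∈-filter⁻ (P? v) {xs = allFin order} u∈′) , T⇒≡ t

  nzPath-unique : ∀ v → Unique (nzPath v)
  nzPath-unique v = Uniqueₚ.filter⁺ (T? ∘ isNZ) (Uniqueₚ.filter⁺ (P? v) (Uniqueₚ.allFin⁺ order))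

  Q-nzPath : ∀ v → Q v ≡ total m (nzPath v)
  Q-nzPath v = go (filter (P? v) (allFin order))
    where
    go : ∀ us → total m us ≡ total m (filterᵇ isNZ us)
    go []       = refl
    go (u ∷ us) with isNZ u in eq
    ... | true  = cong (m u +_) (go us)
    ... | false with m u in mu
    ...   | zero  = go us
    ...   | suc k with () ← trans (sym eq) (1≤m⇒NZ {u} (subst (1 ≤_) (sym mu) (s≤s z≤n)))

  module Enough (M : ℕ) (order≤ : order ≤ 2 ^ M) where
    H : List (List Bool)
    H = hadamard M

    wide : All (λ h → order ≤ length h) H
    wide = All.map (λ w → subst (order ≤_) (sym w) order≤) (hadamard-widths M)

    uniform : ∀ {k} f → (∀ h → order ≤ length h → k ≤ count f h) → 2 ^ M * k ≤ total (count f) H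
    uniform {k} f le = subst (λ l → l * k ≤ total (count f) H) (length-hadamard M)
        (total-≥ {f = count f} (All.map (λ {h} → le h) wide))

    alone-or-partner : ∀ {j a} → dist a ≡ suc j → NZ a →
      nzLayer j ≡ a ∷ [] ⊎ ∃[ w ] NZ w × a ≢ w × dist w ≡ suc j
    alone-or-partner d na with shape d na
    ... | lone only     = inj₁ only
    ... | first w pair  = inj₂ (w , NZ-w , u≢w , dist-w)
      where
      open Partners (partners pair)
    ... | second w pair = inj₂ (w , NZ-u , u≢w ∘ sym , dist-u)
      where
      open Partners (partners pair)

    -- If `a` is alone in its layer, all 12 candidates pick it, and 5 · 2 ≤ 12. Otherwise the layer
    -- constraint forces the value ½, and the 6 candidates that come from probability ½ in both
    -- modes exceed the required 5.
    single-enough : ∀ v a → nzPath v ≡ a ∷ [] → 2 ^ M * (5 * m a) ≤ total (count (hit v)) H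
    single-enough v a eq with ∈-nzPath⁻ {v = v} (subst (a ∈_) (sym eq) (here refl))
    ... | a∈ , na with dist-suc na
    ...   | j , d , j< with alone-or-partner d na
    ...     | inj₁ only = uniform (hit v) λ h _ → ℕₚ.≤-trans (ℕₚ.*-monoʳ-≤ 5 m≤2) (ℕₚ.≤-trans (ℕₚ.m≤m+n 10 2)
                (ℕₚ.≤-reflexive (sym (cong₂ (λ p q → p + 2 * q)
                  (part-full {hit v true} h (λ τ g → hit-picked na a∈ true τ g (picked-lone true τ g only na d)))
                  (part-full {hit v false} h
                      (λ τ g → hit-picked na a∈ false τ g (picked-lone false τ g only na d)))))))
      where
      m≤2 : m a ≤ 2
      m≤2 = ℕₚ.≤-trans (ℕₚ.m≤m+n (m a) 0) (path-≤2 v ([] ∷ []) (a∈ ∷ []))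
    ...     | inj₂ (w , nw , a≢w , dw) = uniform (hit v) λ h le →
        ℕₚ.≤-trans (ℕₚ.*-monoʳ-≤ 5 m≤1) (ℕₚ.≤-trans (ℕₚ.m≤m+n 5 1)
          (ℕₚ.≤-trans (ℕₚ.+-mono-≤ (part-half {λ τ g → picked true τ g a} h
              (tied-top (suc (dist a)) ℕₚ.≤-refl na top-a h le))
                                   (ℕₚ.*-monoʳ-≤ 2 (untied h le)))
            (count-mono {λ t τ g → picked t τ g a} {hit v} h (hit-picked na a∈))))
      where
      top-a : IsTop a
      top-a {a′} a′∈ na′ with subst (a′ ∈_) eq (∈-nzPath⁺ {v = v} (path-trans a′∈ a∈) na′)
      ... | here eq′ = eq′
      m≤1 : m a ≤ 1
      m≤1 = ℕₚ.+-cancelʳ-≤ 1 (m a) 1 (ℕₚ.≤-trans (ℕₚ.+-monoʳ-≤ (m a) (ℕₚ.≤-trans (NZ⇒1≤m nw) (ℕₚ.m≤m+n (m w) 0)))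
        (layer-≤2 j ((a≢w ∷ []) ∷ [] ∷ []) (d ∷ dw ∷ [])))
      untied : ∀ h → order ≤ length h → 2 ≤ part (λ τ g → picked false τ g a) h
      untied h le with untied-top d na top-a
      ... | inj₁ all = subst (2 ≤_) (sym (part-full {λ τ g → picked false τ g a} h all)) (s≤s (s≤s z≤n))
      ... | inj₂ (ε , by) = part-half {λ τ g → picked false τ g a} h λ τ → trans
              (cong₂ _∨_ (by τ h) (trans (by τ (map not h))
                  (trans (cong (ε xor_) (bit-not h j (ℕₚ.≤-trans j< le))) (xor-notʳ ε (bit h j)))))
              (Boolₚ.∨-inverseʳ (ε xor bit h j))

    either≤hit : ∀ v {a b} → Below a b → NZ b → b ∈ path v → ∀ h → count (either a b) h ≤ count (hit v) h
    either≤hit v {a} {b} bl nb b∈ h = count-mono {either a b} {hit v} h λ t τ g →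
      ∨-case (hit-picked (Below.NZ-a bl) (path-trans (Below.a∈ bl) b∈) t τ g) (hit-picked nb b∈ t τ g)
      where
      ∨-case : ∀ {p q r} → (p ≡ true → r ≡ true) → (q ≡ true → r ≡ true) → p ∨ q ≡ true → r ≡ true
      ∨-case {true}  p⇒ q⇒ _  = p⇒ refl
      ∨-case {false} p⇒ q⇒ eq = q⇒ eq

    below-enough : ∀ v {a b} → Below a b → NZ b → b ∈ path v → 2 ^ M * 10 ≤ total (count (hit v)) H
    below-enough v {a} {b} bl nb b∈ with pair-count bl nb
    ... | enough le = uniform (hit v) λ h w → ℕₚ.≤-trans (le h w) (either≤hit v bl nb b∈ h)
    ... | average κ k base i< j< i≢j eq le = subst (λ s → 2 ^ M * s ≤ total (count (hit v)) H) eq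
      (total-average M κ k base (ℕₚ.≤-trans i< order≤) (ℕₚ.≤-trans j< order≤) i≢j
        (All.map (λ {h} w → ℕₚ.≤-trans (le h w) (either≤hit v bl nb b∈ h)) wide))

    pair-enough : ∀ v {a b} → a ∈ path v → b ∈ path v → NZ a → NZ b → a ≢ b → 2 ^ M * 10 ≤ total (count (hit v)) H
    pair-enough v {a} {b} a∈ b∈ na nb a≢b with ℕₚ.≤-total (dist a) (dist b)
    ... | inj₁ le = below-enough v (below na nb (path-linear a∈ b∈ le) a≢b) nb b∈
    ... | inj₂ le = below-enough v (below nb na (path-linear b∈ a∈ le) (a≢b ∘ sym)) na a∈

    vertex-enough : ∀ v → 2 ^ M * (5 * Q v) ≤ total (count (hit v)) H
    vertex-enough v rewrite Q-nzPath v = go (nzPath v) refl (nzPath-unique v)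
      where
      go : ∀ us → nzPath v ≡ us → Unique us → 2 ^ M * (5 * total m us) ≤ total (count (hit v)) H
      go [] _ _ rewrite ℕₚ.*-zeroʳ (2 ^ M) = z≤n
      go (a ∷ []) eq _ rewrite ℕₚ.+-identityʳ (m a) = single-enough v a eq
      -- The path constraint caps the demand at 5 · 2, so two nonzero vertices on the path are
      -- enough.
      go (a ∷ b ∷ us) eq uniq@((a≢b ∷ _) ∷ _) = ℕₚ.≤-trans
        (ℕₚ.*-monoʳ-≤ (2 ^ M) (ℕₚ.*-monoʳ-≤ 5 (path-≤2 v uniq (All.tabulate λ u∈ → proj₁ (mem u∈)))))
        (pair-enough v (proj₁ (mem (here refl))) (proj₁ (mem (there (here refl)))) (proj₂ (mem (here refl)))
            (proj₂ (mem (there (here refl)))) a≢b)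
        where
        mem : ∀ {u} → u ∈ a ∷ b ∷ us → u ∈ path v × NZ u
        mem u∈ = ∈-nzPath⁻ {v = v} (subst (_ ∈_) (sym eq) u∈)

  allV : List V
  allV = concat (applyUpTo (layer ∘ suc) order)

  allV-unique : Unique allV
  allV-unique = Uniqueₚ.concat⁺ (Allₚ.applyUpTo⁺₁ (layer ∘ suc) order (λ {i} _ → layer-unique i))
    (AllPairsₚ.applyUpTo⁺₁ (layer ∘ suc) order λ {i} {j} i<j _ (v∈i , v∈j) →
      ℕₚ.<⇒≢ i<j (ℕₚ.suc-injective (trans (sym (layer-dist (suc i) v∈i)) (layer-dist (suc j) v∈j))))

  ∈-allV : ∀ v → v ∈ source ∷ allV
  ∈-allV v with dist v in eq
  ... | zero  = here (dist-0 eq)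
  ... | suc j = there (∈-concat⁺′ (∈-layer (suc j) eq)
      (∈-applyUpTo⁺ (layer ∘ suc) (ℕₚ.<-trans ℕₚ.≤-refl (subst (_< order) eq (dist-<-order v)))))

  value-env : ∀ us → value env us ≡ total (λ v → 𝟙 (covered env us (ℓpath v))) allV
  value-env us = trans (length-filterᵇ (λ p → covered env us p) (concat (layers env)))
    (trans (cong (total (λ p → 𝟙 (covered env us p))) layers≡) (total-map (λ p → 𝟙 (covered env us p)) ℓpath allV))
    where
    layers≡ : concat (layers env) ≡ map ℓpath allV
    layers≡ = trans (cong concat (trans layers-env (sym (Listₚ.map-applyUpTo (layer ∘ suc) (map ℓpath) order))))
      (Listₚ.concat-map (applyUpTo (layer ∘ suc) order))

  bestValue : ℕ
  bestValue = value env (best env)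

  value-≤ : ∀ {us} → us ∈ strategies env → value env us ≤ bestValue
  value-≤ us∈ = All.lookup (proj₂ (proj₂ (best-of (value env) [] (strategies env)))) us∈

  -- `value` does not count the source, so the source must not contribute to the objective either.
  Q-source : Q source ≡ 0
  Q-source = trans (Q-nzPath source) (go (nzPath source) refl)
    where
    go : ∀ us → nzPath source ≡ us → total m us ≡ 0
    go []       _ = refl
    go (u ∷ us) eq with ∈-nzPath⁻ {v = source} (subst (u ∈_) (sym eq) (here refl))
    ... | u∈ , nu with subst (u ∈_) source-path u∈
    ...   | here u≡s = ⊥-elim (NZ⇒≢source nu u≡s)

  module Average (M : ℕ) (order≤ : order ≤ 2 ^ M) (rows≡ : rows env ≡ hadamard M) where
    open Enough M order≤

    picks-∈ : ∀ t τ {h} → h ∈ H ++ map (map not) H → picks (ctx t τ h) ∈ strategies env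
    picks-∈ t τ {h} h∈ = ∈-strategies⁺ env t τ (subst (λ R → h ∈ R ++ map (map not) R) (sym rows≡) h∈)

    hits-≤ : ∀ t τ {h} → h ∈ H ++ map (map not) H → total (λ v → 𝟙 (hit v t τ h)) allV ≤ bestValue
    hits-≤ t τ {h} h∈ = subst (_≤ bestValue) (value-env (picks (ctx t τ h))) (value-≤ (picks-∈ t τ h∈))

    part-≤ : ∀ t {h} → h ∈ H → total (λ v → part (hit v t) h) allV ≤ (bestValue + bestValue) + (bestValue + bestValue)
    part-≤ t {h} h∈ = ℕₚ.≤-trans
      (ℕₚ.≤-reflexive (trans (total-+ _ _ allV) (cong₂ _+_ (total-+ _ _ allV) (total-+ _ _ allV))))
      (ℕₚ.+-mono-≤ (ℕₚ.+-mono-≤ (hits-≤ t true pos) (hits-≤ t true neg))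
          (ℕₚ.+-mono-≤ (hits-≤ t false pos) (hits-≤ t false neg)))
      where
      pos : h ∈ H ++ map (map not) H
      pos = ∈-++⁺ˡ h∈
      neg : map not h ∈ H ++ map (map not) H
      neg = ∈-++⁺ʳ H (∈-map⁺ (map not) h∈)

    count-≤ : ∀ {h} → h ∈ H → total (λ v → count (hit v) h) allV ≤ 12 * bestValue
    count-≤ {h} h∈ = ℕₚ.≤-trans (ℕₚ.≤-reflexive
        (trans (total-+ _ _ allV) (cong (total (λ v → part (hit v true) h) allV +_) (total-* 2 _ allV))))
      (ℕₚ.≤-trans (ℕₚ.+-mono-≤ (part-≤ true h∈) (ℕₚ.*-monoʳ-≤ 2 (part-≤ false h∈)))
          (ℕₚ.≤-reflexive (twelve bestValue)))
      where
      twelve : ∀ b → ((b + b) + (b + b)) + 2 * ((b + b) + (b + b)) ≡ 12 * b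
      twelve = solve-∀

    -- Double counting of pairs of a vertex and a weighted candidate that hits it: per row, a vertex
    -- is hit at least `5 * Q v` times on average, and each of the 12 candidates hits at most
    -- `bestValue` vertices.
    five-twelfths : 5 * total Q (allFin order) ≤ 12 * bestValue
    five-twelfths = ℕₚ.*-cancelˡ-≤ (2 ^ M) {{ℕₚ.m^n≢0 2 M}} (begin
      2 ^ M * (5 * total Q (allFin order))
        ≤⟨ ℕₚ.*-monoʳ-≤ (2 ^ M) (ℕₚ.*-monoʳ-≤ 5 (total-⊆ Q (Uniqueₚ.allFin⁺ order) (λ {v} _ → ∈-allV v))) ⟩
      2 ^ M * (5 * (Q source + total Q allV))
        ≡⟨ cong (λ q → 2 ^ M * (5 * (q + total Q allV))) Q-source ⟩
      2 ^ M * (5 * total Q allV)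
        ≡⟨ cong (2 ^ M *_) (sym (total-* 5 Q allV)) ⟩
      2 ^ M * total (λ v → 5 * Q v) allV
        ≡⟨ sym (total-* (2 ^ M) _ allV) ⟩
      total (λ v → 2 ^ M * (5 * Q v)) allV
        ≤⟨ total-mono (All.universal vertex-enough allV) ⟩
      total (λ v → total (count (hit v)) H) allV
        ≡⟨ total-swap (λ v → count (hit v)) allV H ⟩
      total (λ h → total (λ v → count (hit v) h) allV) H
        ≤⟨ total-≤ (All.tabulate count-≤) ⟩
      length H * (12 * bestValue)
        ≡⟨ cong (_* (12 * bestValue)) (length-hadamard M) ⟩
      2 ^ M * (12 * bestValue) ∎)
      where open ℕₚ.≤-Reasoning

  -- From labels back to a strategy

  module Chosen (t τ : Bool) (h : List Bool) where
    private
      c = ctx t τ h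

    -- Each label that the program picks belongs to the source or to a vertex of the layer, so it
    -- can be lifted back to a vertex.
    pickV : ℕ → V
    pickV j = [ (λ _ → source) , proj₁ ]′ (pick-in-layer t τ h (picksUpTo c j) j)

    toℕ-pickV : ∀ j → toℕ (pickV j) ≡ pick c (picksUpTo c j) (Lv (suc j))
    toℕ-pickV j with pick-in-layer t τ h (picksUpTo c j) j
    ... | inj₁ eq           = sym eq
    ... | inj₂ (v , _ , eq) = sym eq

    picksUpTo-pickV : ∀ j → picksUpTo c j ≡ map toℕ (applyDownFrom pickV j)
    picksUpTo-pickV zero    = refl
    picksUpTo-pickV (suc j) = cong₂ _∷_ (sym (toℕ-pickV j)) (picksUpTo-pickV j)

    strategy : Strategy
    strategy = applyUpTo pickV order

    strategy-picks : map toℕ strategy ≡ reverse (picks c)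
    strategy-picks = sym (trans (cong reverse (trans (picks-env t τ h) (picksUpTo-pickV order)))
      (trans (sym (Listₚ.reverse-map toℕ (applyDownFrom pickV order)))
          (cong (map toℕ) (Listₚ.reverse-applyDownFrom pickV order))))

    take-applyUpTo : ∀ {A : Set} (f : ℕ → A) {d n} → d ≤ n → take d (applyUpTo f n) ≡ applyUpTo f d
    take-applyUpTo f z≤n       = refl
    take-applyUpTo f (s≤s d≤n) = cong (f 0 ∷_) (take-applyUpTo (f ∘ suc) d≤n)

    -- The witness is the position of a picked nonzero `u` on the path, which is its depth. By
    -- `picked-stable` the pick of `u` is among the first `dist u`, and `u` is not the source, so
    -- the position is at least 1.
    covered⇒saved : ∀ v → covered env (picks c) (ℓpath v) ≡ true → Saved strategy v
    covered⇒saved v eq with any⁻ (λ u → nz env u ∧ u ∈ᵇ picks c) (ℓpath v) eq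
    ... | k , k∈ , eq′ with ∈-ℓpath⁻ k∈ | ∧-true {nz env k} {k ∈ᵇ picks c} eq′
    ...   | u , refl , u∈ | nu , u∈picks = Any.index u∈ , 1≤ , subst₂ (λ a i → a ∈ take i strategy)
        (Anyₚ.lookup-index u∈) index≡ u∈take
      where
      index≡ : dist u ≡ toℕ (Any.index u∈)
      index≡ = proj₂ (path-prefix u∈)
      1≤ : 1 ≤ toℕ (Any.index u∈)
      1≤ with dist-suc nu
      ... | j , d , _ = subst (1 ≤_) (trans (sym d) index≡) (s≤s z≤n)
      u∈now : toℕ u ∈ picksUpTo c (dist u)
      u∈now = ∈ᵇ⁻ {toℕ u} {picksUpTo c (dist u)} (trans (sym (picked-stable t τ h nu order (ℕₚ.<⇒≤ (dist-<-order u))))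
        (trans (cong (toℕ u ∈ᵇ_) (sym (picks-env t τ h))) u∈picks))
      u∈take : u ∈ take (dist u) strategy
      u∈take with ∈-map⁻ toℕ (subst (toℕ u ∈_) (picksUpTo-pickV (dist u)) u∈now)
      ... | w , w∈ , u≡w with Finₚ.toℕ-injective {i = u} {w} u≡w | ∈-applyDownFrom⁻ pickV w∈
      ...   | refl | i , i< , eq″ = subst₂ _∈_ (sym eq″) (sym (take-applyUpTo pickV (ℕₚ.<⇒≤ (dist-<-order u))))
          (∈-applyUpTo⁺ pickV i<)

  Realizes : Strategy → List ℕ → Set
  Realizes S us = map toℕ S ≡ reverse us × (∀ v → covered env us (ℓpath v) ≡ true → Saved S v)

  realize-best : ∃[ S ] Realizes S (best env)
  realize-best with proj₁ (best-of (value env) [] (strategies env))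
  -- `best-of` leaves open that the search returns its starting value `[]`, which covers no vertex.
  ... | inj₁ eq = [] , cong reverse (sym eq) , λ v cov →
      ⊥-elim (nothing v (subst (λ us → covered env us (ℓpath v) ≡ true) eq cov))
    where
    nothing : ∀ v → covered env [] (ℓpath v) ≡ true → ⊥
    nothing v cov with any⁻ (λ u → nz env u ∧ false) (ℓpath v) cov
    ... | k , _ , eq′ with () ← proj₂ (∧-true {nz env k} eq′)
  ... | inj₂ best∈ with ∈-strategies⁻ env best∈
  ...   | t , τ , h , eq = strategy , trans strategy-picks (cong reverse (sym eq)) ,
            λ v cov → covered⇒saved v (subst (λ us → covered env us (ℓpath v) ≡ true) eq cov)
    where open Chosen t τ h

  output : Strategy
  output = proj₁ realize-best

  bestValue≤savedCount : bestValue ≤ savedCount output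
  bestValue≤savedCount = begin
    bestValue                                                              ≡⟨ value-env (best env) ⟩
    total (λ v → 𝟙 (covered env (best env) (ℓpath v))) allV
      ≤⟨ total-mono (All.universal (λ v → 𝟙-mono λ cov → dec-true (Saved? output v)
          (proj₂ (proj₂ realize-best) v cov)) allV) ⟩
    total (λ v → 𝟙 (does (Saved? output v))) allV
      ≤⟨ total-⊆ (λ v → 𝟙 (does (Saved? output v))) allV-unique (λ {v} _ → ∈-allFin v) ⟩
    total (λ v → 𝟙 (does (Saved? output v))) (allFin order)        ≡⟨ sym
        (length-filter-total (Saved? output) (allFin order)) ⟩
    savedCount output                                              ∎
    where open ℕₚ.≤-Reasoning

  guarantee : (ℤ.+ 5 / 6) ℚ.* sum y ℚ.≤ ℤ.+ savedCount output / 1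
  guarantee = let M , rows≡ , le = rows-hadamard env in
    five-sixths (total Q (allFin order)) (savedCount output) (sum-y≤ (allFin order))
      (ℕₚ.≤-trans (Average.five-twelfths M (subst (_≤ 2 ^ M) length-matrix le) rows≡)
          (ℕₚ.*-monoʳ-≤ 12 bestValue≤savedCount))
    where
    length-matrix : length (matrix env) ≡ order
    length-matrix = trans (Listₚ.length-map _ (allFin order)) (Listₚ.length-tabulate {n = order} id)

  input : ⟦ Input ⟧
  input = (map (λ u → map (adj u) (allFin order)) (allFin order) , toℕ source) ,
          (map (λ v → encodeℚ (x v)) (allFin order) , map (λ v → encodeℚ (y v)) (allFin order))

  enc-input : enc Input input ≡ encodeInstance 𝒯 x y
  enc-input = cong₂ cons
    (cong₂ cons (trans (encodeList-map (encodeList encodeBool) (λ u → map (adj u) (allFin order)) (allFin order))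
                       (encodeList-cong (allFin order) λ u → encodeList-map encodeBool (adj u) (allFin order))) refl)
    (cong₂ cons (encodeList-map (λ d → d) (λ v → encodeℚ (x v)) (allFin order))
        (encodeList-map (λ d → d) (λ v → encodeℚ (y v)) (allFin order)))

  solve-input : enc (list nat) (solve input) ≡ encodeStrategy 𝒯 output
  solve-input = trans (cong (encodeList encodeUnary)
      (trans (cong (λ N → reverse (best ((matrix env , toℕ source) , N)))
      (sym (Listₚ.map-∘ (allFin order)))) (sym (proj₁ (proj₂ realize-best)))))
    (encodeList-map encodeUnary toℕ output)

polynomial-algorithm : ∀ {A B} {f : ⟦ A ⟧ → ⟦ B ⟧} → PolyTime A B f →
  Σ[ p ∈ Cmd ] Σ[ c ∈ ℕ ] Σ[ k ∈ ℕ ]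
    (∀ a → p on enc A a yields enc B (f a) within (c * size (enc A a) ^ k))
polynomial-algorithm {A} F = let c , k , bound = monomial-bound (PolyTime.time F) in
  PolyTime.prog F 0 , c , k , λ a →
    let τ , t , run , (τ0 , _) , t≤ = PolyTime.runs F 0 (inputStore (enc A a)) a refl in
    τ , t , run , τ0 , ℕₚ.≤-trans t≤ (bound (size (enc A a)) (size≥1 (enc A a)))

abstract
  solver : Σ[ p ∈ Cmd ] Σ[ c ∈ ℕ ] Σ[ k ∈ ℕ ]
    (∀ i → p on enc Input i yields enc (list nat) (solve i) within (c * size (enc Input i) ^ k))
  solver = polynomial-algorithm solve-poly

open import Data.Integer.Base using (+_)

theorem16 : Σ[ algorithm ∈ Cmd ] Σ[ c ∈ ℕ ] Σ[ k ∈ ℕ ]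
    ((𝒯 : RootedTree) (let open RootedTree 𝒯) (x y : Vertex → ℚ) →
    Feasible x y → HalfIntegral x →
    Σ[ us ∈ Strategy ]
    (algorithm on encodeInstance 𝒯 x y yields encodeStrategy 𝒯 us
    within (c ℕ.* size (encodeInstance 𝒯 x y) ℕ.^ k))
    × (+ 5 / 6) ℚ.* sum y ℚ.≤ + savedCount us / 1)
theorem16 = let p , c , k , correct = solver in p , c , k , λ 𝒯 x y feasible halfIntegral →
  let open Final 𝒯 x y feasible halfIntegral in
  output ,
  subst (λ d → p on d yields encodeStrategy 𝒯 output within (c * size d ^ k)) enc-input
    (subst (λ d → p on enc Input input yields d within (c * size (enc Input input) ^ k)) solve-input
        (correct input)) ,
  guarantee
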